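{- For every strict partition $\lambda$, $$\pi(\mathcal P_\lambda)=\sum_\mu g^\lambda_\mu\,\mathcal S_\mu,$$ where $\mu$ runs over ordinary partitions and $g^\lambda_\mu$ are the coefficients of the Schur expansion $P_\lambda=\sum_\mu g^\lambda_\mu s_\mu$.
   Context: $X=\{1<2<\cdots\}$, $X'=\{1'<1<2'<2<\cdots\}$; words are finite sequences in $X$. A strict partition $\lambda=(\lambda_1>\cdots>\lambda_l>0)$ has shifted diagram with $\lambda_i$ cells in row $i$, row $i$ shifted $i-1$ units right. A shifted Young tableau of shape $\lambda$ is a filling with letters of $X'$, rows and columns weakly increasing, each unprimed $k$ at most once per column, each primed $k'$ at most once per row, no primed entries on the main diagonal; $x^T=\prod x_i^{a_i}$ with $a_i$ the number of entries $i$ or $i'$. The Schur $P$-function is $P_\lambda=\sum_{\mathrm{shape}(T)=\lambda}x^T$; $s_\mu$ are the ordinary Schur functions. Mixed insertion of $w=w_1\cdots w_n$: starting from the empty tableau, insert $w_1,\dots,w_n$ successively. A letter is inserted into the first row, bumping the smallest entry $a$ strictly greater than it (order of $X'$), or placed at the end of the row if none. Whenever $a$ is bumped: if off the main diagonal and unprimed, insert it into the next row likewise; if off the diagonal and primed, insert it into the next column to the right, bumping the smallest strictly greater entry there (or placing it at the end); if on the main diagonal, prime it and insert $a'$ into the next column to the right. Stop when a letter is placed at the end of a row or column. The result is $P_{\mathrm{mix}}(w)$. $[T]$ is the set of words with $P_{\mathrm{mix}}(w)=T$; these classes form the shifted plactic monoid $\mathbf S$ under $[u][v]=[uv]$, with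 algebra $\mathbb Q\mathbf S$, and $\mathcal P_\lambda=\sum_{\mathrm{shape}(T)=\lambda}[T]$ (formal sum). The plactic monoid $\mathbf P$ consists of plactic classes $\langle u\rangle$ (words with a given RSK insertion tableau $P_{\mathrm{RSK}}$), with $\langle u\rangle\langle v\rangle=\langle uv\rangle$; the shape of $\langle u\rangle$ is that of $P_{\mathrm{RSK}}(u)$, and the plactic Schur function $\mathcal S_\mu\in\mathbb Q\mathbf P$ is the sum of all plactic classes of shape $\mu$. Since words with the same mixed insertion tableau have the same RSK insertion tableau, there is a monoid homomorphism $\pi:\mathbf S\to\mathbf P$, $[u]\mapsto\langle u\rangle$, extended linearly. -}

module Defs where

open import Data.Bool.Base using (if_then_else_)
open import Data.List.Base using
  (List; []; _∷_; [_]; map; concat; concatMap; take; length; foldr; foldl; upTo; filter;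
   deduplicate; alignWith; cartesianProductWith)
open import Data.List.Properties using (≡-dec)
open import Data.List.Relation.Unary.All as All using (All)
open import Data.List.Relation.Unary.AllPairs using (AllPairs; allPairs?)
open import Data.List.Relation.Unary.Linked using (Linked; linked?)
open import Data.Maybe.Base as Maybe using (Maybe; just; nothing)
open import Data.Nat.Base using (ℕ; zero; suc; _+_; _*_; _≤_; _<_; _>_; _≥_)
open import Data.Nat.ListAction using (sum)
import Data.Nat.Properties as ℕ
open import Data.Product.Base using (_×_; _,_; map₁; map₂)
open import Data.Rational.Base as ℚ using (ℚ; 0ℚ; 1ℚ)
open import Data.These.Base as These using ()
open import Function.Base using (_on_)
open import Function.Bundles using (Func)
open import Level using (0ℓ)
open import Relation.Binary.Bundles using (Setoid)
open import Relation.Binary.Core using (Rel)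
open import Relation.Binary.Definitions using (Decidable; DecidableEquality)
import Relation.Binary.Construct.On as On
open import Relation.Binary.PropositionalEquality using (_≡_; refl; cong)
import Relation.Binary.PropositionalEquality.Properties as ≡
open import Relation.Nullary.Decidable using (Dec; yes; no; does; map′; _×-dec_; _→-dec_)
import Relation.Unary as Unary

private
  variable
    A : Set

sumℚ : List ℚ → ℚ
sumℚ = foldr ℚ._+_ 0ℚ

indicator : {P : Set} → Dec P → ℚ
indicator P? = if does P? then 1ℚ else 0ℚ

-- Letters are numbered from 0: the letter i : ℕ is the (i+1)-st letter of
-- X = {1 < 2 < ⋯}, and the corresponding variable is x_{i+1}.

Word : Set
Word = List ℕ

data X′ : Set where
  primed unprimed : ℕ → X′

-- The position of a letter in the chain 1′ < 1 < 2′ < 2 < ⋯.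
rank : X′ → ℕ
rank (primed i)   = 2 * i
rank (unprimed i) = suc (2 * i)

_≼_ _≺_ : Rel X′ 0ℓ
_≼_ = _≤_ on rank
_≺_ = _<_ on rank

_≼?_ : Decidable _≼_
x ≼? y = rank x ℕ.≤? rank y

_≺?_ : Decidable _≺_
x ≺? y = rank x ℕ.<? rank y

_≟′_ : DecidableEquality X′
primed i   ≟′ primed j   = map′ (cong primed) (λ { refl → refl }) (i ℕ.≟ j)
unprimed i ≟′ unprimed j = map′ (cong unprimed) (λ { refl → refl }) (i ℕ.≟ j)
primed i   ≟′ unprimed j = no λ ()
unprimed i ≟′ primed j   = no λ ()

data Primed : X′ → Set where
  primed : ∀ {i} → Primed (primed i)

data Unprimed : X′ → Set where
  unprimed : ∀ {i} → Unprimed (unprimed i)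

primed? : Unary.Decidable Primed
primed? (primed i)   = yes primed
primed? (unprimed i) = no λ ()

unprimed? : Unary.Decidable Unprimed
unprimed? (primed i)   = no λ ()
unprimed? (unprimed i) = yes unprimed

∣_∣ : X′ → ℕ
∣ primed i   ∣ = i
∣ unprimed i ∣ = i

prime : X′ → X′
prime x = primed ∣ x ∣

IsPartition : List ℕ → Set
IsPartition μ = All (0 <_) μ × Linked _≥_ μ

IsStrictPartition : List ℕ → Set
IsStrictPartition ν = All (0 <_) ν × Linked _>_ ν

isPartition? : Unary.Decidable IsPartition
isPartition? μ = All.all? (0 ℕ.<?_) μ ×-dec linked? ℕ._≥?_ μ

-- All finite sequences of positive integers with sum n, each listed once.
compositions : ℕ → List (List ℕ)
compositions zero    = [ [] ]
compositions (suc n) = concatMap (λ c → (1 ∷ c) ∷ enlarge c) (compositions n)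
  where
  enlarge : List ℕ → List (List ℕ)
  enlarge []       = []
  enlarge (k ∷ ks) = [ suc k ∷ ks ]

partitions : ℕ → List (List ℕ)
partitions n = filter isPartition? (compositions n)

-- A filling is given by its rows, top to bottom.  In a shifted diagram the
-- entry at index j of row i (both from 0) stands in column i + j.

Filling : Set → Set
Filling A = List (List A)

shape : Filling A → List ℕ
shape = map length

size : Filling A → ℕ
size T = length (concat T)

_≟ˢ_ : DecidableEquality (List ℕ)
_≟ˢ_ = ≡-dec ℕ._≟_

_≟ᵗ_ : DecidableEquality (Filling ℕ)
_≟ᵗ_ = ≡-dec _≟ˢ_

_≟ᵗ′_ : DecidableEquality (Filling X′)
_≟ᵗ′_ = ≡-dec (≡-dec _≟′_)

-- Puts the k-th entry of a row on top of the k-th column.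
addRow : List A → List (List A) → List (List A)
addRow = alignWith (These.fold [_] (λ c → c) _∷_)

columns : Filling A → List (List A)
columns []      = []
columns (r ∷ T) = addRow r (columns T)

shiftedColumns : Filling A → List (List A)
shiftedColumns []      = []
shiftedColumns (r ∷ T) = addRow r ([] ∷ shiftedColumns T)

diagonal : Filling A → List A
diagonal = concatMap (take 1)

IsYoungTableau : List ℕ → Filling ℕ → Set
IsYoungTableau μ T =
  shape T ≡ μ × All (AllPairs _≤_) T × All (AllPairs _<_) (columns T)

-- Equal entries in one row must be unprimed, equal entries in one column must
-- be primed.
RowPair ColumnPair : Rel X′ 0ℓ
RowPair    x y = x ≼ y × (x ≡ y → Unprimed x)
ColumnPair x y = x ≼ y × (x ≡ y → Primed x)

IsShiftedTableau : List ℕ → Filling X′ → Set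
IsShiftedTableau ν T =
  shape T ≡ ν
  × All (AllPairs RowPair) T
  × All (AllPairs ColumnPair) (shiftedColumns T)
  × All Unprimed (diagonal T)

isYoungTableau? : ∀ μ → Unary.Decidable (IsYoungTableau μ)
isYoungTableau? μ T =
  (shape T ≟ˢ μ)
  ×-dec All.all? (allPairs? ℕ._≤?_) T
  ×-dec All.all? (allPairs? ℕ._<?_) (columns T)

isShiftedTableau? : ∀ ν → Unary.Decidable (IsShiftedTableau ν)
isShiftedTableau? ν T =
  (shape T ≟ˢ ν)
  ×-dec All.all? (allPairs? λ x y → (x ≼? y) ×-dec ((x ≟′ y) →-dec unprimed? x)) T
  ×-dec All.all? (allPairs? λ x y → (x ≼? y) ×-dec ((x ≟′ y) →-dec primed? x))
          (shiftedColumns T)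
  ×-dec All.all? unprimed? (diagonal T)

wordsOver : List A → ℕ → List (List A)
wordsOver as zero    = [ [] ]
wordsOver as (suc n) = cartesianProductWith _∷_ as (wordsOver as n)

fillings : List A → List ℕ → List (Filling A)
fillings as []      = [ [] ]
fillings as (k ∷ s) = cartesianProductWith _∷_ (wordsOver as k) (fillings as s)

-- The tableaux of a given shape in the first n letters of the alphabet.

youngTableaux : ℕ → List ℕ → List (Filling ℕ)
youngTableaux n μ = filter (isYoungTableau? μ) (fillings (upTo n) μ)

shiftedTableaux : ℕ → List ℕ → List (Filling X′)
shiftedTableaux n ν = filter (isShiftedTableau? ν) (fillings alphabet ν)
  where
  alphabet : List X′
  alphabet = concatMap (λ i → primed i ∷ unprimed i ∷ []) (upTo n)

-- A formal power series in x₁, x₂, … is given by its coefficients; the list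
-- (a₁, …, aₙ) denotes the monomial x₁^a₁ ⋯ xₙ^aₙ.  In extracting the coefficient
-- of such a monomial only tableaux in the first n letters matter.

Series : Set
Series = List ℕ → ℚ

_≈ˢ_ : Rel Series 0ℓ
F ≈ˢ G = ∀ α → F α ≡ G α

exponents : ℕ → List ℕ → List ℕ
exponents n is = map (λ i → length (filter (ℕ._≟ i) is)) (upTo n)

-- x^T, as a power series, from the list of the letters of T without primes.
monomial : List ℕ → Series
monomial is α = indicator (exponents (length α) is ≟ˢ α)

schur : List ℕ → Series
schur μ α = sumℚ (map (λ T → monomial (concat T) α) (youngTableaux (length α) μ))

schurP : List ℕ → Series
schurP ν α =
  sumℚ (map (λ T → monomial (map ∣_∣ (concat T)) α) (shiftedTableaux (length α) ν))

-- Σ_μ g_μ s_μ over all partitions μ.  As s_μ is homogeneous of degree |μ|, only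
-- the partitions of the degree of a monomial contribute to its coefficient.
schurSeries : (List ℕ → ℚ) → Series
schurSeries g α = sumℚ (map (λ μ → g μ ℚ.* schur μ α) (partitions (sum α)))

-- The insertion procedures bump the first entry greater than the inserted one:
-- rows and columns being weakly increasing, it is the smallest such entry, and
-- the first one among equal entries.

-- The result of inserting into a row, and the bumped entry with its index.
rowBump : {_<ᴬ_ : Rel A 0ℓ} → Decidable _<ᴬ_ → A → List A → List A × Maybe (ℕ × A)
rowBump _<?_ x []       = [ x ] , nothing
rowBump _<?_ x (y ∷ ys) =
  if does (x <? y) then (x ∷ ys , just (0 , y))
  else (let ys′ , b = rowBump _<?_ x ys in y ∷ ys′ , Maybe.map (map₁ suc) b)

rskInsert : ℕ → Filling ℕ → Filling ℕ
rskInsert x []      = [ [ x ] ]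
rskInsert x (r ∷ T) with rowBump ℕ._<?_ x r
... | r′ , nothing      = r′ ∷ T
... | r′ , just (_ , a) = r′ ∷ rskInsert a T

P-RSK : Word → Filling ℕ
P-RSK = foldl (λ T x → rskInsert x T) []

-- The i-th row or c-th column of a shifted diagram (from 0); a cell is a row and
-- a column number.
data Line : Set where
  row col : ℕ → Line

Cell : Set
Cell = ℕ × ℕ

-- Insertion into row i; the index of the bumped entry is relative to the row.
insertRow : ℕ → X′ → Filling X′ → Filling X′ × Maybe (ℕ × X′)
insertRow i       x []      = [ [ x ] ] , nothing
insertRow zero    x (r ∷ T) = map₁ (_∷ T) (rowBump _≺?_ x r)
insertRow (suc i) x (r ∷ T) = map₁ (r ∷_) (insertRow i x T)

-- Tries to put x at index j of a row: the new row and the entry x replaces (if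
-- the row is too short to have one), or nothing if that entry is not greater
-- than x.
putAt : ℕ → X′ → List X′ → Maybe (List X′ × Maybe X′)
putAt j       x []       = just ([ x ] , nothing)
putAt zero    x (y ∷ ys) = if does (x ≺? y) then just (x ∷ ys , just y) else nothing
putAt (suc j) x (y ∷ ys) = Maybe.map (map₁ (y ∷_)) (putAt j x ys)

-- Insertion into the column meeting the first row at index j, hence the next
-- row at index j - 1; the bumped entry comes with the number of its row.  A
-- column ends on the diagonal (j = 0), and the last line of the definition is
-- never reached from a shifted tableau.
insertColumn : ℕ → X′ → Filling X′ → Filling X′ × Maybe (ℕ × X′)
insertColumn j x []      = [ [ x ] ] , nothing
insertColumn j x (r ∷ T) with putAt j x r | j
... | just (r′ , b) | _     = r′ ∷ T , Maybe.map (0 ,_) b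
... | nothing       | suc k = let T′ , b = insertColumn k x T in
                              r ∷ T′ , Maybe.map (map₁ suc) b
... | nothing       | zero  = r ∷ T , nothing

insertLine : Line → X′ → Filling X′ → Filling X′ × Maybe (Cell × X′)
insertLine (row i) x T = map₂ (Maybe.map λ (j , a) → (i , i + j) , a) (insertRow i x T)
insertLine (col c) x T = map₂ (Maybe.map λ (i , a) → (i , c) , a) (insertColumn c x T)

-- Where an entry bumped from a given cell goes next, and as which letter.
redirect : Cell → X′ → Line × X′
redirect (i , c) a with i ℕ.≟ c | a
... | yes _ | _          = col (suc c) , prime a
... | no _  | unprimed _ = row (suc i) , a
... | no _  | primed _   = col (suc c) , a

-- The first argument bounds the number of letters placed.
insertSteps : ℕ → Line → X′ → Filling X′ → Filling X′
insertSteps zero    ℓ x T = T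
insertSteps (suc n) ℓ x T with insertLine ℓ x T
... | T′ , nothing      = T′
... | T′ , just (p , a) = let ℓ′ , y = redirect p a in insertSteps n ℓ′ y T′

-- The bound is never attained prematurely: if x bumps a and y is inserted next,
-- then y is a or prime a, so a ≻ x gives y ≽ x, and the tableau now has fewer
-- entries ≻ y than it had entries ≻ x.  So there are at most size T bumps.
mixInsert : ℕ → Filling X′ → Filling X′
mixInsert i T = insertSteps (suc (size T)) (row 0) (unprimed i) T

P-mix : Word → Filling X′
P-mix = foldl (λ T i → mixInsert i T) []

-- The underlying sets of the shifted plactic monoid 𝐒 and of the plactic monoid
-- 𝐏: a word w represents its class [w], respectively ⟨w⟩.

𝐒 𝐏 : Setoid 0ℓ 0ℓ
𝐒 = On.setoid (≡.setoid (Filling X′)) P-mix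
𝐏 = On.setoid (≡.setoid (Filling ℕ)) P-RSK

-- Possibly infinite formal ℚ-linear combinations of elements of M, given by
-- their coefficients.
FormalSum : Setoid 0ℓ 0ℓ → Set
FormalSum M = Func M (≡.setoid ℚ)

open Func using (to)

_≈ᶠ_ : {M : Setoid 0ℓ 0ℓ} → Rel (FormalSum M) 0ℓ
f ≈ᶠ h = ∀ u → to f u ≡ to h u

-- Σ [T] over the shifted tableaux T of shape ν: the class [w] is [T] for
-- T = P-mix w only.
𝒫 : List ℕ → FormalSum 𝐒
𝒫 ν = record
  { to   = λ w → indicator (isShiftedTableau? ν (P-mix w))
  ; cong = cong λ T → indicator (isShiftedTableau? ν T)
  }

𝒮 : List ℕ → FormalSum 𝐏
𝒮 μ = record
  { to   = λ u → indicator (shape (P-RSK u) ≟ˢ μ)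
  ; cong = cong λ U → indicator (shape U ≟ˢ μ)
  }

-- Σ_μ g_μ 𝒮_μ over all partitions μ.  Only shapes with as many cells as P-RSK u
-- contribute to the coefficient of ⟨u⟩.
placticSchurSum : (List ℕ → ℚ) → FormalSum 𝐏
placticSchurSum g = record
  { to   = λ u →
      sumℚ (map (λ μ → g μ ℚ.* to (𝒮 μ) u) (partitions (size (P-RSK u))))
  ; cong = cong λ U →
      sumℚ (map (λ μ → g μ ℚ.* indicator (shape U ≟ˢ μ)) (partitions (size U)))
  }

-- The words with RSK insertion tableau U, possibly repeated: insertion preserves
-- the multiset of letters, so they are words in the entries of U.
placticClass : Filling ℕ → List Word
placticClass U = filter (λ w → P-RSK w ≟ᵗ U) (wordsOver (concat U) (size U))

-- One representative of each shifted plactic class [w] with ⟨w⟩ the class of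
-- the words with insertion tableau U.
fibre : Filling ℕ → List Word
fibre U = deduplicate (λ v w → P-mix v ≟ᵗ′ P-mix w) (placticClass U)

-- The linear extension of π : 𝐒 → 𝐏, [u] ↦ ⟨u⟩.  It is defined on infinite sums
-- too, since the fibres of π are finite: the coefficient of ⟨u⟩ in π f is the
-- sum of the coefficients in f of the classes that π maps to ⟨u⟩.
π : FormalSum 𝐒 → FormalSum 𝐏
π f = record
  { to   = λ u → sumℚ (map (to f) (fibre (P-RSK u)))
  ; cong = cong λ U → sumℚ (map (to f) (fibre U))
  }

{-# OPTIONS --safe #-}
-- A tableau is recorded as the chain of its letters in increasing order, each
-- with its cell.  An insertion passes through the chain once: a letter learns
-- which cell has been added to the shape of the smaller letters and, if it
-- stands there, moves on to the next row (plain, that is unprimed, letters) or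
-- to the next column (barred, that is primed, letters).
--
-- Following Haiman, the mixed insertion of w = w₁ w₂ ⋯ becomes in the doubled,
-- straight shape the insertion of w̄₁ w₁ w̄₂ w₂ ⋯ with respect to the order
-- 1̄ < 1 < 2̄ < 2 < ⋯, barred letters being inserted into columns.  Exchanging two
-- letters of opposite marks that are neighbours in the order changes at most the
-- cells of these two letters, in a way determined by the cells alone, and does
-- not change the cells added.  Moving all plain letters to the front of the
-- order shows that P-mix w determines P-RSK w.  As the letters at the back only
-- see the cells added by those at the front, it also shows that the RSK
-- recording tableau determines the mixed recording tableau.  Since both
-- insertions are bijective, the number of shifted classes of shape ν over a
-- plactic class thus depends only on the shape of the latter.  Counting by
-- content, the unitriangularity of the Kostka numbers identifies this number
-- with the coefficient in the Schur expansion of P_ν.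
module Submission where

open import Data.Bool.Base using (Bool; true; false; if_then_else_)
open import Data.Empty using (⊥; ⊥-elim)
open import Data.List.Base hiding (sum; find; [_])
open import Data.List.Membership.Propositional using (_∈_; find)
open import Data.List.Membership.Propositional.Properties
open import Data.List.Properties hiding (sum-++)
open import Data.List.Relation.Binary.Permutation.Propositional using
  (_↭_; prep; ↭-refl; ↭-sym; ↭-trans; ↭-reflexive)
import Data.List.Relation.Binary.Permutation.Propositional.Properties as ↭
open import Data.List.Relation.Unary.All as All using (All; []; _∷_)
import Data.List.Relation.Unary.All.Properties as All
open import Data.List.Relation.Unary.AllPairs as AllPairs using (AllPairs; []; _∷_)
import Data.List.Relation.Unary.AllPairs.Properties as AllPairs
open import Data.List.Relation.Unary.Any as Any using (Any; here; there)
import Data.List.Relation.Unary.Any.Properties as Any′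
open import Data.List.Relation.Unary.Linked using (Linked; []; [-]; _∷_)
open import Data.List.Relation.Unary.Unique.Propositional using (Unique)
import Data.List.Relation.Unary.Unique.Propositional.Properties as Unique
open import Data.Maybe.Base as Maybe using (Maybe; just; nothing)
open import Data.Nat.Base
open import Data.Nat.ListAction using (sum)
open import Data.Nat.ListAction.Properties using (sum-↭; sum-++)
open import Data.Nat.Properties
open import Data.Product.Base using (Σ-syntax; ∃; ∃₂; _×_; _,_; proj₁; proj₂; map₁; map₂; swap)
import Data.Product.Properties as Product
open import Data.Rational.Base as ℚ using (ℚ; 0ℚ; 1ℚ)
import Data.Rational.Properties as ℚ
open import Data.Sum.Base using (_⊎_; inj₁; inj₂; [_,_]′)
open import Data.Unit.Base using (⊤; tt)
open import Function.Base using (_∘_; id; case_of_)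
open import Relation.Binary.Definitions using (Tri; tri<; tri≈; tri>)
open import Relation.Binary.PropositionalEquality hiding ([_])
open import Relation.Nullary using (¬_; Dec; yes; no; does)
open import Relation.Nullary.Decidable using (dec-true; dec-false; ¬?)

open import Defs renaming (shape to shapeᵗ)

-- Shapes

-- In a shifted shape a letter may change its mark on the diagonal, so plain and barred letters
-- cannot be separated there. Doubling removes this obstacle: a straight shape has no special
-- diagonal, marks become permanent, and a change of mark is only a trade of places between the two
-- copies of an entry. The pass through the letters is preferred to the bumping path, which jumps
-- between rows and columns, because it makes the exchange of two neighbours in the order a local
-- matter.
--
-- Equal letters of a word are told apart by the time of their insertion. In a tableau the same
-- order is visible in the positions, and this has to be carried through every insertion and its
-- reversal.
--
-- The count over two Young tableaux of one shape is compared through words: fix a mixed recording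
-- path of shape `ν`, keep the RSK recording path of a word and replace its RSK tableau. The mixed
-- recording path cannot change, so the new mixed tableau has shape `ν` again.
--
-- The triangularity is measured by Σ i μ_i instead of the dominance order: it is the least possible
-- sum of the entries of a tableau of shape `μ`, and the actual sum when the content is `μ`.

data Kind : Set where
  straight shifted : Kind

data Mark : Set where
  plain barred : Mark

δ : ℕ → ℕ → ℕ
δ zero    zero    = 1
δ zero    (suc _) = 0
δ (suc _) zero    = 0
δ (suc i) (suc k) = δ i k

δ-refl : ∀ i → δ i i ≡ 1
δ-refl zero    = refl
δ-refl (suc i) = δ-refl i

δ-≢ : ∀ {i k} → i ≢ k → δ i k ≡ 0
δ-≢ {zero}  {zero}  i≢k = ⊥-elim (i≢k refl)
δ-≢ {zero}  {suc k} i≢k = refl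
δ-≢ {suc i} {zero}  i≢k = refl
δ-≢ {suc i} {suc k} i≢k = δ-≢ (i≢k ∘ cong suc)

-- rows i and cols j are the numbers of the first free column of row i and of
-- the first free row of column j.  Row i of a shifted diagram starts in column
-- offset i = i.
record Shape : Set where
  constructor shape
  field rows cols : ℕ → ℕ
open Shape public

offset : Kind → ℕ → ℕ
offset straight _ = 0
offset shifted  i = i

∅ : Kind → Shape
∅ k = shape (offset k) (λ _ → 0)

infixl 6 _⊕_ _⊕?_
infix  4 _≗ˢ_

-- Adding a cell is pointwise addition, whether or not the cell is addable, so commutation and
-- cancellation hold for all cells without case distinctions.
_⊕_ : Shape → Cell → Shape
S ⊕ (i , j) = shape (λ r → δ i r + rows S r) (λ c → δ j c + cols S c)

_⊕?_ : Shape → Maybe Cell → Shape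
S ⊕? nothing = S
S ⊕? just c  = S ⊕ c

-- Shapes consist of functions and are compared pointwise; hence the transport lemmas that accompany
-- the notions depending on a shape.
record _≗ˢ_ (S S′ : Shape) : Set where
  constructor _&_
  field
    rows-≗ : ∀ i → rows S i ≡ rows S′ i
    cols-≗ : ∀ j → cols S j ≡ cols S′ j
open _≗ˢ_ public

≗-refl : ∀ {S} → S ≗ˢ S
≗-refl = (λ _ → refl) & (λ _ → refl)

≗-sym : ∀ {S S′} → S ≗ˢ S′ → S′ ≗ˢ S
≗-sym (r & c) = (sym ∘ r) & (sym ∘ c)

≗-trans : ∀ {S S′ S″} → S ≗ˢ S′ → S′ ≗ˢ S″ → S ≗ˢ S″
≗-trans (r & c) (r′ & c′) = (λ i → trans (r i) (r′ i)) & (λ j → trans (c j) (c′ j))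

⊕-cong : ∀ {S S′} c → S ≗ˢ S′ → S ⊕ c ≗ˢ S′ ⊕ c
⊕-cong (i , j) (r & c) = (λ k → cong (δ i k +_) (r k)) & (λ k → cong (δ j k +_) (c k))

⊕?-cong : ∀ {S S′} c → S ≗ˢ S′ → S ⊕? c ≗ˢ S′ ⊕? c
⊕?-cong nothing  e = e
⊕?-cong (just c) e = ⊕-cong c e

+-swap : ∀ a b c → a + (b + c) ≡ b + (a + c)
+-swap a b c = trans (sym (+-assoc a b c)) (trans (cong (_+ c) (+-comm a b)) (+-assoc b a c))

⊕-comm : ∀ {S} c d → S ⊕ c ⊕ d ≗ˢ S ⊕ d ⊕ c
⊕-comm {S} (i , j) (i′ , j′) =
  (λ r → +-swap (δ i′ r) (δ i r) (rows S r)) & (λ k → +-swap (δ j′ k) (δ j k) (cols S k))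

⊕?-comm : ∀ {S} c d → S ⊕? c ⊕? d ≗ˢ S ⊕? d ⊕? c
⊕?-comm nothing  nothing  = ≗-refl
⊕?-comm nothing  (just d) = ≗-refl
⊕?-comm (just c) nothing  = ≗-refl
⊕?-comm (just c) (just d) = ⊕-comm c d

⊕-cancel : ∀ {S S′} c → S ⊕ c ≗ˢ S′ ⊕ c → S ≗ˢ S′
⊕-cancel (i , j) (r & c) =
  (λ k → +-cancelˡ-≡ (δ i k) _ _ (r k)) & (λ k → +-cancelˡ-≡ (δ j k) _ _ (c k))

rows-same : ∀ S i j → rows (S ⊕ (i , j)) i ≡ suc (rows S i)
rows-same S i j = cong (_+ rows S i) (δ-refl i)

cols-same : ∀ S i j → cols (S ⊕ (i , j)) j ≡ suc (cols S j)
cols-same S i j = cong (_+ cols S j) (δ-refl j)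

rows-other : ∀ S i j {r} → i ≢ r → rows (S ⊕ (i , j)) r ≡ rows S r
rows-other S i j {r} ne = cong (_+ rows S r) (δ-≢ ne)

cols-other : ∀ S i j {c} → j ≢ c → cols (S ⊕ (i , j)) c ≡ cols S c
cols-other S i j {c} ne = cong (_+ cols S c) (δ-≢ ne)

-- `rows` and `cols` describe one set of cells: in every row an interval from the offset on, in
-- every column an interval from 0 on. The sets that allow both descriptions are the ordinary or
-- shifted diagrams.
record Young (k : Kind) (S : Shape) : Set where
  field
    fits  : ∀ i → offset k i ≤ rows S i
    inRow : ∀ {i j} → i < cols S j → j < rows S i
    off   : ∀ {i j} → i < cols S j → offset k i ≤ j
    inCol : ∀ {i j} → offset k i ≤ j → j < rows S i → i < cols S j
open Young public

record Addable (S : Shape) (c : Cell) : Set where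
  constructor _⊹_
  field
    rowEq : rows S (proj₁ c) ≡ proj₂ c
    colEq : cols S (proj₂ c) ≡ proj₁ c
open Addable public

infix 3 _⊹_

Addable? : Shape → Maybe Cell → Set
Addable? S nothing  = ⊤
Addable? S (just c) = Addable S c

Addable-cong : ∀ {S S′} c → S ≗ˢ S′ → Addable S c → Addable S′ c
Addable-cong (i , j) (r & c) (a ⊹ b) = trans (sym (r i)) a ⊹ trans (sym (c j)) b

Addable?-cong : ∀ {S S′} c → S ≗ˢ S′ → Addable? S c → Addable? S′ c
Addable?-cong nothing  e a = a
Addable?-cong (just c) e a = Addable-cong c e a

offset-mono : ∀ k {i i′} → i ≤ i′ → offset k i ≤ offset k i′
offset-mono straight le = z≤n
offset-mono shifted  le = le

Young-∅ : ∀ k → Young k (∅ k)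
Young-∅ k = record
  { fits = λ _ → ≤-refl ; inRow = λ () ; off = λ ()
  ; inCol = λ o lt → ⊥-elim (<⇒≱ lt o) }

-- Membership of a cell (i , j) in a Young shape is i < cols S j.
lower : ∀ {k S} → Young k S → ∀ {i j i′ j′} → i′ < cols S j′ → i ≤ i′ → j ≤ j′ →
        offset k i ≤ j → i < cols S j
lower Y mem i≤ j≤ o = inCol Y o (≤-<-trans j≤ (inRow Y (≤-<-trans i≤ mem)))

addable-off : ∀ {k S} → Young k S → ∀ {i j} → Addable S (i , j) → offset k i ≤ j
addable-off {k} Y {i} (r ⊹ _) = subst (offset k i ≤_) r (fits Y i)

Young-⊕ : ∀ {k S c} → Young k S → Addable S c → Young k (S ⊕ c)
Young-⊕ {k} {S} {i , j} Y A@(r ⊹ c) = record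
  { fits = λ i′ → ≤-trans (fits Y i′) (m≤n+m _ _)
  ; inRow = λ {i′} {j′} → inRow′ i′ j′ ; off = λ {i′} {j′} → off′ i′ j′ ; inCol = λ {i′} {j′} → inCol′ i′ j′ }
  where
  inRow′ : ∀ i′ j′ → i′ < cols (S ⊕ (i , j)) j′ → j′ < rows (S ⊕ (i , j)) i′
  inRow′ i′ j′ lt with j ≟ j′
  ... | no ne = <-≤-trans (inRow Y (subst (i′ <_) (cols-other S i j ne) lt)) (m≤n+m _ _)
  ... | yes refl with i ≟ i′
  ...   | yes refl = subst (j <_) (sym (trans (rows-same S i j) (cong suc r))) ≤-refl
  ...   | no ne = <-≤-trans (inRow Y (≤∧≢⇒< (≤-trans (≤-pred (subst (suc i′ ≤_) (trans (cols-same S i j) (cong suc c)) lt)) (≤-reflexive (sym c))) (λ e → ne (trans (sym c) (sym e))))) (m≤n+m _ _)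
  off′ : ∀ i′ j′ → i′ < cols (S ⊕ (i , j)) j′ → offset k i′ ≤ j′
  off′ i′ j′ lt with j ≟ j′
  ... | no ne = off Y (subst (i′ <_) (cols-other S i j ne) lt)
  ... | yes refl = ≤-trans (offset-mono k (≤-pred (subst (suc i′ ≤_) (trans (cols-same S i j) (cong suc c)) lt))) (addable-off Y A)
  inCol′ : ∀ i′ j′ → offset k i′ ≤ j′ → j′ < rows (S ⊕ (i , j)) i′ → i′ < cols (S ⊕ (i , j)) j′
  inCol′ i′ j′ o lt with i ≟ i′
  ... | no ne = <-≤-trans (inCol Y o (subst (j′ <_) (rows-other S i j ne) lt)) (m≤n+m _ _)
  ... | yes refl with j ≟ j′
  ...   | yes refl = subst (i <_) (sym (trans (cols-same S i j) (cong suc c))) ≤-refl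
  ...   | no ne = <-≤-trans (inCol Y o (≤∧≢⇒< (≤-trans (≤-pred (subst (suc j′ ≤_) (trans (rows-same S i j) (cong suc r)) lt)) (≤-reflexive (sym r))) (λ e → ne (trans (sym r) (sym e))))) (m≤n+m _ _)

addable-same-row : ∀ {S i j j′} → Addable S (i , j) → Addable S (i , j′) → j ≡ j′
addable-same-row (r ⊹ _) (r′ ⊹ _) = trans (sym r) r′

addable-same-col : ∀ {S i i′ j} → Addable S (i , j) → Addable S (i′ , j) → i ≡ i′
addable-same-col (_ ⊹ c) (_ ⊹ c′) = trans (sym c) c′

-- Different addable cells share neither a row nor a column, so neither sees the other being filled.
addable-⊕ : ∀ {S c d} → Addable S c → Addable S d → c ≢ d → Addable (S ⊕ d) c
addable-⊕ {S} {i , j} {i′ , j′} A B ne =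
  trans (rows-other S i′ j′ (λ { refl → ne (cong (i ,_) (addable-same-row A B)) })) (rowEq A) ⊹
  trans (cols-other S i′ j′ (λ { refl → ne (cong (_, j) (addable-same-col A B)) })) (colEq A)

-- One letter of a tableau

-- `none` is a letter still to be inserted at a later time, `fresh` the letter whose insertion is
-- under way, without a cell so far.
data State : Set where
  none  : State
  fresh : Mark → State
  at    : Mark → Cell → State

cellOf : State → Maybe Cell
cellOf none      = nothing
cellOf (fresh _) = nothing
cellOf (at _ c)  = just c

infixl 6 _⊕ˢ_

_⊕ˢ_ : Shape → State → Shape
S ⊕ˢ s = S ⊕? cellOf s

OnDiagonal : Kind → Cell → Set
OnDiagonal straight _       = ⊥
OnDiagonal shifted  (i , j) = i ≡ j

onDiagonal? : ∀ k c → Dec (OnDiagonal k c)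
onDiagonal? straight _       = no λ ()
onDiagonal? shifted  (i , j) = i ≟ j

start : Shape → Mark → Cell
start S plain  = 0 , rows S 0
start S barred = cols S 0 , 0

rowEnd colEnd : Shape → ℕ → Cell
rowEnd S i = i , rows S i
colEnd S j = cols S j , j

-- How one letter reacts when the smaller letters have taken the shape S by
-- occupying the additional cell ev: if it stands in that cell it moves on, and
-- its new cell is passed to the larger letters.
data Act (k : Kind) (S : Shape) : Maybe Cell → State → State → Maybe Cell → Set where
  none  : ∀ {ev} → Act k S ev none none ev
  born  : ∀ {m d} → d ≡ start S m → Act k S nothing (fresh m) (at m d) (just d)
  still : ∀ {m c} → Act k S nothing (at m c) (at m c) nothing
  miss  : ∀ {m c p} → c ≢ p → Act k S (just p) (at m c) (at m c) (just p)
  down  : ∀ {i j d} → ¬ OnDiagonal k (i , j) → d ≡ rowEnd S (suc i) →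
          Act k S (just (i , j)) (at plain (i , j)) (at plain d) (just d)
  right : ∀ {i j d} → d ≡ colEnd S (suc j) →
          Act k S (just (i , j)) (at barred (i , j)) (at barred d) (just d)
  turn  : ∀ {i j d} → OnDiagonal k (i , j) → d ≡ colEnd S (suc j) →
          Act k S (just (i , j)) (at plain (i , j)) (at barred d) (just d)

-- The shape is that of the smaller letters after the insertion, so it already contains the cell of
-- the event; each letter adds its new cell before the next one acts.
data Pass (k : Kind) : Shape → Maybe Cell → List State → List State → Maybe Cell → Set where
  []  : ∀ {S ev} → Pass k S ev [] [] ev
  _∷_ : ∀ {S ev s s′ ev′ ss ss′ ev″} → Act k S ev s s′ ev′ →
        Pass k (S ⊕ˢ s′) ev′ ss ss′ ev″ → Pass k S ev (s ∷ ss) (s′ ∷ ss′) ev″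

start-cong : ∀ {S S′} m → S ≗ˢ S′ → start S m ≡ start S′ m
start-cong plain  e = cong (0 ,_) (rows-≗ e 0)
start-cong barred e = cong (_, 0) (cols-≗ e 0)

rowEnd-cong : ∀ {S S′} i → S ≗ˢ S′ → rowEnd S i ≡ rowEnd S′ i
rowEnd-cong i e = cong (i ,_) (rows-≗ e i)

colEnd-cong : ∀ {S S′} j → S ≗ˢ S′ → colEnd S j ≡ colEnd S′ j
colEnd-cong j e = cong (_, j) (cols-≗ e j)

Act-cong : ∀ {k S S′ ev s s′ ev′} → S ≗ˢ S′ → Act k S ev s s′ ev′ → Act k S′ ev s s′ ev′
Act-cong e none         = none
Act-cong e (born {m} q) = born (trans q (start-cong m e))
Act-cong e still        = still
Act-cong e (miss ne)    = miss ne
Act-cong e (down o q)   = down o (trans q (rowEnd-cong _ e))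
Act-cong e (right q)    = right (trans q (colEnd-cong _ e))
Act-cong e (turn o q)   = turn o (trans q (colEnd-cong _ e))

Pass-cong : ∀ {k S S′ ev ss ss′ ev′} → S ≗ˢ S′ → Pass k S ev ss ss′ ev′ → Pass k S′ ev ss ss′ ev′
Pass-cong e []       = []
Pass-cong e (_∷_ {s′ = s′} a p) = Act-cong e a ∷ Pass-cong (⊕?-cong (cellOf s′) e) p

Act-functional : ∀ {k S ev s s₁ s₂ e₁ e₂} → Act k S ev s s₁ e₁ → Act k S ev s s₂ e₂ →
                 s₁ ≡ s₂ × e₁ ≡ e₂
Act-functional none none = refl , refl
Act-functional (born refl) (born refl) = refl , refl
Act-functional still still = refl , refl
Act-functional (miss _) (miss _) = refl , refl
Act-functional (miss ne) (down _ _) = ⊥-elim (ne refl)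
Act-functional (miss ne) (right _) = ⊥-elim (ne refl)
Act-functional (miss ne) (turn _ _) = ⊥-elim (ne refl)
Act-functional (down _ _) (miss ne) = ⊥-elim (ne refl)
Act-functional (right _) (miss ne) = ⊥-elim (ne refl)
Act-functional (turn _ _) (miss ne) = ⊥-elim (ne refl)
Act-functional (down _ refl) (down _ refl) = refl , refl
Act-functional (right refl) (right refl) = refl , refl
Act-functional (turn _ refl) (turn _ refl) = refl , refl
Act-functional (down o _) (turn o′ _) = ⊥-elim (o o′)
Act-functional (turn o′ _) (down o _) = ⊥-elim (o o′)

Pass-functional : ∀ {k S ev ss s₁ s₂ e₁ e₂} → Pass k S ev ss s₁ e₁ → Pass k S ev ss s₂ e₂ →
                  s₁ ≡ s₂ × e₁ ≡ e₂
Pass-functional [] [] = refl , refl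
Pass-functional (a ∷ p) (b ∷ q) with Act-functional a b
... | refl , refl with Pass-functional p q
...   | refl , refl = refl , refl

MarkOK : Kind → Mark → Cell → Set
MarkOK k plain  c = ⊤
MarkOK k barred c = ¬ OnDiagonal k c

StateOK : Kind → Shape → State → Set
StateOK straight S none      = ⊤
StateOK straight S (fresh _) = ⊤
StateOK shifted  S none      = ⊤
StateOK shifted  S (fresh m) = m ≡ plain
StateOK k        S (at m c)  = Addable S c × MarkOK k m c

data Valid (k : Kind) : Shape → List State → Set where
  []  : ∀ {S} → Valid k S []
  _∷_ : ∀ {S s ss} → StateOK k S s → Valid k (S ⊕ˢ s) ss → Valid k S (s ∷ ss)

total : Shape → List State → Shape
total S []       = S
total S (s ∷ ss) = total (S ⊕ˢ s) ss

StateOK-cong : ∀ {S S′} k s → S ≗ˢ S′ → StateOK k S s → StateOK k S′ s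
StateOK-cong straight none      e ok = ok
StateOK-cong straight (fresh _) e ok = ok
StateOK-cong shifted  none      e ok = ok
StateOK-cong shifted  (fresh _) e ok = ok
StateOK-cong straight (at m c)  e (a , b) = Addable-cong c e a , b
StateOK-cong shifted  (at m c)  e (a , b) = Addable-cong c e a , b

Valid-cong : ∀ {k S S′ ss} → S ≗ˢ S′ → Valid k S ss → Valid k S′ ss
Valid-cong e [] = []
Valid-cong {k} e (_∷_ {s = s} ok v) = StateOK-cong k s e ok ∷ Valid-cong (⊕?-cong (cellOf s) e) v

total-cong : ∀ {S S′} ss → S ≗ˢ S′ → total S ss ≗ˢ total S′ ss
total-cong []       e = e
total-cong (s ∷ ss) e = total-cong ss (⊕?-cong (cellOf s) e)

stateCell : ∀ {k S m c} → StateOK k S (at m c) → Addable S c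
stateCell {straight} = proj₁
stateCell {shifted}  = proj₁

stateAddable : ∀ {S} k s → StateOK k S s → Addable? S (cellOf s)
stateAddable k none      ok = tt
stateAddable k (fresh _) ok = tt
stateAddable k (at m c)  ok = stateCell {k} {m = m} ok

stateMark : ∀ {k S m c} → StateOK k S (at m c) → MarkOK k m c
stateMark {straight} = proj₂
stateMark {shifted}  = proj₂

stateAt : ∀ {k S m c} → Addable S c → MarkOK k m c → StateOK k S (at m c)
stateAt {straight} = _,_
stateAt {shifted}  = _,_

Young-⊕? : ∀ {k S} c → Young k S → Addable? S c → Young k (S ⊕? c)
Young-⊕? nothing  Y a = Y
Young-⊕? (just c) Y a = Young-⊕ Y a

offDiagonal : ∀ {k i j} → ¬ OnDiagonal k (i , j) → offset k i ≤ j → offset k (suc i) ≤ j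
offDiagonal {straight} o le = z≤n
offDiagonal {shifted}  o le = ≤∧≢⇒< le o

module _ {k : Kind} {S : Shape} (Y : Young k S) {i j : ℕ} (A : Addable S (i , j)) where
  private
    S⁺ = S ⊕ (i , j)
    Y⁺ = Young-⊕ Y A

  rows-after : rows S⁺ i ≡ suc j
  rows-after = trans (rows-same S i j) (cong suc (rowEq A))

  cols-after : cols S⁺ j ≡ suc i
  cols-after = trans (cols-same S i j) (cong suc (colEq A))

  -- Row `i` now ends in column `j`, so column `suc j` cannot reach row `i`. This is why a letter
  -- moving to the next column goes weakly up, and by the same argument one moving to the next row
  -- goes weakly left.
  cols-next-≤ : cols S⁺ (suc j) ≤ i
  cols-next-≤ = ≮⇒≥ λ lt → n≮n _ (subst (suc j <_) rows-after (inRow Y⁺ lt))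

  rows-next-≤ : ¬ OnDiagonal k (i , j) → rows S⁺ (suc i) ≤ j
  rows-next-≤ o = ≮⇒≥ λ lt →
    n≮n _ (subst (suc i <_) cols-after (inCol Y⁺ (offDiagonal o (addable-off Y A)) lt))

  rowEnd-addable : ¬ OnDiagonal k (i , j) → Addable S⁺ (rowEnd S⁺ (suc i))
  rowEnd-addable o = refl ⊹ ≤-antisym
    (≮⇒≥ λ lt → n≮n _ (inRow Y⁺ lt))
    (inCol Y⁺ (≤-trans (offset-mono k (n≤1+n i)) (fits Y⁺ (suc i)))
      (subst (rows S⁺ (suc i) <_) (sym rows-after) (s≤s (rows-next-≤ o))))

  colEnd-addable : Addable S⁺ (colEnd S⁺ (suc j))
  colEnd-addable = ≤-antisym
    (≮⇒≥ λ lt → n≮n _ (inCol Y⁺ (≤-trans (off Y⁺ mem) (n≤1+n j)) lt))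
    (inRow Y⁺ mem) ⊹ refl
    where
    mem : cols S⁺ (suc j) < cols S⁺ j
    mem = subst (cols S⁺ (suc j) <_) (sym cols-after) (s≤s cols-next-≤)

  colEnd-offDiagonal : ¬ OnDiagonal k (colEnd S⁺ (suc j))
  colEnd-offDiagonal = go k Y A cols-next-≤
    where
    go : ∀ k → Young k S → Addable S (i , j) → cols S⁺ (suc j) ≤ i → ¬ OnDiagonal k (colEnd S⁺ (suc j))
    go straight _ _ _ ()
    go shifted Y A le e = n≮n _ (≤-trans (subst (_≤ i) e le) (addable-off Y A))

start-addable : ∀ {k S} m → Young k S → (k ≡ shifted → m ≡ plain) → Addable S (start S m)
start-addable plain Y _ = refl ⊹ n≤0⇒n≡0 (≮⇒≥ λ lt → n≮n _ (inRow Y lt))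
start-addable {straight} barred Y _ = n≤0⇒n≡0 (≮⇒≥ λ lt → n≮n _ (inCol Y z≤n lt)) ⊹ refl
start-addable {shifted} barred Y h with h refl
... | ()

-- The invariant of a pass: with `S` the old shape of the smaller letters, the shape up to and
-- including this letter grows by exactly the outgoing event. The next letter is thus in the same
-- situation as this one was.
record Acted (k : Kind) (S : Shape) (ev : Maybe Cell) (s s′ : State) (ev′ : Maybe Cell) : Set where
  field
    ok′  : StateOK k (S ⊕? ev) s′
    add′ : Addable? (S ⊕ˢ s) ev′
    sum′ : S ⊕? ev ⊕ˢ s′ ≗ˢ S ⊕ˢ s ⊕? ev′
open Acted public

acted : ∀ {k S ev s s′ ev′} → Young k S → Addable? S ev → StateOK k S s →
        Act k (S ⊕? ev) ev s s′ ev′ → Acted k S ev s s′ ev′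
acted {straight} Y A ok none = record { ok′ = tt ; add′ = A ; sum′ = ≗-refl }
acted {shifted}  Y A ok none = record { ok′ = tt ; add′ = A ; sum′ = ≗-refl }
acted {straight} Y A ok (born {m} refl) = record
  { ok′ = start-addable m Y (λ ()) , mk m ; add′ = start-addable m Y (λ ()) ; sum′ = ≗-refl }
  where
  mk : ∀ m {c} → MarkOK straight m c
  mk plain  = tt
  mk barred ()
acted {shifted} {S} Y A refl (born refl) = record
  { ok′ = start-addable plain Y (λ _ → refl) , tt ; add′ = start-addable plain Y (λ _ → refl) ; sum′ = ≗-refl }
acted Y A ok still = record { ok′ = ok ; add′ = A ; sum′ = ≗-refl }
acted {k} Y A ok (miss {m} {c} {p} ne) = record
  { ok′  = stateAt {k} {m = m} (addable-⊕ (stateCell {k} {m = m} ok) A ne) (stateMark {k} {m = m} ok)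
  ; add′ = addable-⊕ A (stateCell {k} {m = m} ok) (ne ∘ sym)
  ; sum′ = ⊕-comm p c }
acted {k} Y A ok (down o refl) = record
  { ok′ = stateAt {k} {m = plain} (rowEnd-addable Y A o) tt ; add′ = rowEnd-addable Y A o ; sum′ = ≗-refl }
acted {k} Y A ok (right refl) = record
  { ok′ = stateAt {k} {m = barred} (colEnd-addable Y A) (colEnd-offDiagonal Y A)
  ; add′ = colEnd-addable Y A ; sum′ = ≗-refl }
acted {k} Y A ok (turn o refl) = record
  { ok′ = stateAt {k} {m = barred} (colEnd-addable Y A) (colEnd-offDiagonal Y A)
  ; add′ = colEnd-addable Y A ; sum′ = ≗-refl }

record Passed (k : Kind) (S : Shape) (ev : Maybe Cell) (ss ss′ : List State) (ev′ : Maybe Cell) : Set where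
  field
    valid′ : Valid k (S ⊕? ev) ss′
    adds   : Addable? (total S ss) ev′
    totals : total (S ⊕? ev) ss′ ≗ˢ total S ss ⊕? ev′
open Passed public

passed : ∀ {k S ev ss ss′ ev′} → Young k S → Addable? S ev → Valid k S ss →
         Pass k (S ⊕? ev) ev ss ss′ ev′ → Passed k S ev ss ss′ ev′
passed Y A v [] = record { valid′ = [] ; adds = A ; totals = ≗-refl }
passed {k} Y A (_∷_ {s = s} ok v) (_∷_ {s′ = s′} {ss′ = ss′} a p) =
  let r = acted Y A ok a
      q = passed (Young-⊕? (cellOf s) Y (stateAddable k s ok)) (add′ r) v (Pass-cong (sum′ r) p)
  in record { valid′ = ok′ r ∷ Valid-cong (≗-sym (sum′ r)) (valid′ q)
            ; adds = adds q
            ; totals = ≗-trans (total-cong ss′ (sum′ r)) (totals q) }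

Young-total : ∀ {k S} ss → Young k S → Valid k S ss → Young k (total S ss)
Young-total []       Y v = Y
Young-total {k} (s ∷ ss) Y (ok ∷ v) = Young-total ss (Young-⊕? (cellOf s) Y (stateAddable k s ok)) v

-- Exchanging neighbouring letters of opposite marks

infix 4 _≟ᶜ_

_≟ᶜ_ : (c d : Cell) → Dec (c ≡ d)
_≟ᶜ_ = Product.≡-dec _≟_ _≟_

opposite : Mark → Mark
opposite plain  = barred
opposite barred = plain

data Marked (m : Mark) : State → Set where
  none  : Marked m none
  fresh : Marked m (fresh m)
  at    : ∀ {c} → Marked m (at m c)

-- The positions (a , b) of a plain letter and the barred letter following it
-- and the positions (b′ , a′) of the same letters in the opposite order.
data Exchange (S : Shape) : State → State → State → State → Set where
  apart    : ∀ {a b} → Marked plain a → Marked barred b →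
             Addable? S (cellOf a) → Addable? S (cellOf b) →
             (∀ {c} → cellOf a ≡ just c → cellOf b ≡ just c → ⊥) → Exchange S a b b a
  adjacent : ∀ {i j d} → Addable S (i , j) → Addable (S ⊕ (i , j)) d →
             d ≡ (i , suc j) ⊎ d ≡ (suc i , j) →
             Exchange S (at plain (i , j)) (at barred d) (at barred (i , j)) (at plain d)

record Exchanged (S : Shape) (ev : Maybe Cell) (a₁ b₁ b′ a′ : State) (e : Maybe Cell) : Set where
  constructor exchanged
  field
    {b₁′ a₁′} : State
    {mid} : Maybe Cell
    actᵇ  : Act straight S ev b′ b₁′ mid
    actᵃ  : Act straight (S ⊕ˢ b₁′) mid a′ a₁′ e
    still-exchange : Exchange S a₁ b₁ b₁′ a₁′

distinct : ∀ {c d : Cell} → c ≢ d → ∀ {e} → just c ≡ just e → just d ≡ just e → ⊥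
distinct ne refl refl = ne refl

module _ {S₀ : Shape} (Y : Young straight S₀) where

  private
    down! : ∀ {S i j d} → d ≡ rowEnd S (suc i) →
            Act straight S (just (i , j)) (at plain (i , j)) (at plain d) (just d)
    down! = down λ ()

  -- Adjacent cells arise when one letter is born at the spot of the other: a barred letter below a
  -- plain one ending the first column, or a plain letter beside a barred one ending the first row.
  -- In the opposite order the newcomer takes the old cell and pushes the other letter to the new
  -- one.
  exchange-none : ∀ {a b b′ a′ a₁ b₁ e₁ e₂} → Exchange S₀ a b b′ a′ →
    Act straight S₀ nothing a a₁ e₁ → Act straight (S₀ ⊕ˢ a₁) e₁ b b₁ e₂ →
    Exchanged S₀ nothing a₁ b₁ b′ a′ e₂
  exchange-none (apart ma mb A B ne) none none = exchanged none none (apart ma mb A B ne)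
  exchange-none (apart ma mb A B ne) none still = exchanged still none (apart ma mb A B ne)
  exchange-none (apart ma fresh A B ne) none (born refl) =
    exchanged (born refl) none (apart none at tt (start-addable barred Y (λ ())) λ ())
  exchange-none (apart ma mb A B ne) still none = exchanged none still (apart ma mb A B ne)
  exchange-none (apart ma mb A B ne) still still = exchanged still still (apart ma mb A B ne)
  exchange-none (apart (at {c = i , zero}) fresh A@(r ⊹ refl) B ne) still (born refl) =
    exchanged (born refl) (down! e) (adjacent A A′ (inj₂ (cong (_, 0) (cols-after Y A))))
    where
    A′ = start-addable barred (Young-⊕ Y A) (λ ())
    e : start (S₀ ⊕ (i , 0)) barred ≡ rowEnd (S₀ ⊕ (i , 0)) (suc i)
    e = cong₂ _,_ (cols-after Y A)
          (sym (trans (cong (rows (S₀ ⊕ (i , 0))) (sym (cols-after Y A))) (rowEq A′)))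
  exchange-none (apart (at {c = i , suc j}) fresh A B ne) still (born refl) =
    exchanged (born refl) (miss λ ()) (apart at at A (start-addable barred Y (λ ())) (distinct λ ()))
  exchange-none (apart fresh mb A B ne) (born refl) none =
    exchanged none (born refl) (apart at none (start-addable plain Y (λ ())) tt λ _ ())
  exchange-none (apart fresh (at {c = i , j}) A B ne) (born refl) (miss ne′) =
    exchanged still (born e) (apart at at (start-addable plain Y (λ ())) B (distinct (ne′ ∘ sym)))
    where
    e : start S₀ plain ≡ start (S₀ ⊕ (i , j)) plain
    e = cong (0 ,_) (sym (rows-other S₀ i j λ { refl → ne′ (cong (0 ,_) (sym (rowEq B))) }))
  exchange-none (apart fresh at A B ne) (born refl) (right refl) =
    exchanged still (born e) (adjacent B A″ (inj₁ (trans e (cong (0 ,_) (rows-after Y B)))))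
    where
    S₁ = S₀ ⊕ (0 , rows S₀ 0)
    A′ = start-addable plain (Young-⊕ Y B) (λ ())
    e : colEnd S₁ (suc (rows S₀ 0)) ≡ start S₁ plain
    e = cong₂ _,_ (trans (cong (cols S₁) (sym (rows-after Y B))) (colEq A′)) (sym (rows-after Y B))
    A″ = subst (Addable S₁) (sym e) A′
  exchange-none (adjacent A B w) still still = exchanged still still (adjacent A B w)

  -- The two orders differ only if the letters compete for a cell. A competition makes a separate
  -- pair adjacent, and an event at the first cell separates an adjacent pair again; the outgoing
  -- event is the same in either order.
  exchange-just : ∀ {p a b b′ a′ a₁ b₁ e₁ e₂} → Addable S₀ p → Exchange S₀ a b b′ a′ →
    Act straight (S₀ ⊕ p) (just p) a a₁ e₁ → Act straight (S₀ ⊕ p ⊕ˢ a₁) e₁ b b₁ e₂ →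
    Exchanged (S₀ ⊕ p) (just p) a₁ b₁ b′ a′ e₂
  exchange-just P (apart ma mb A B ne) none none = exchanged none none (apart ma mb tt tt ne)
  exchange-just P (apart ma at A B ne) none (miss x) =
    exchanged (miss x) none (apart none at tt (addable-⊕ B P x) λ ())
  exchange-just P (apart ma at A B ne) none (right refl) =
    exchanged (right refl) none (apart none at tt (colEnd-addable Y P) λ ())
  exchange-just P (apart at mb A B ne) (miss x) none =
    exchanged none (miss x) (apart at none (addable-⊕ A P x) tt λ _ ())
  exchange-just P (apart at at A B ne) (miss x) (miss y) =
    exchanged (miss y) (miss x) (apart at at (addable-⊕ A P x) (addable-⊕ B P y) ne)
  exchange-just {p = p@(i , j)} P (apart (at {c = c@(i′ , j′)}) at A B ne) (miss x) (right refl)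
    with j′ ≟ suc j
  ... | no j′≢ = exchanged (right (cong (_, suc j) (cols-other (S₀ ⊕ p) i′ j′ j′≢)))
                   (miss λ c≡d → j′≢ (cong proj₂ c≡d))
                   (apart at at (addable-⊕ A P x)
                     (subst (Addable (S₀ ⊕ p)) (cong (_, suc j) (sym (cols-other (S₀ ⊕ p) i′ j′ j′≢))) (colEnd-addable Y P))
                     (distinct λ c≡d → j′≢ (cong proj₂ c≡d)))
  -- The plain letter ends the column the barred one moves to. Going first, the barred letter takes
  -- its cell, and the plain letter drops to the cell below.
  ... | yes refl = exchanged (right (cong (_, suc j) (sym (colEq A₁)))) (down! e)
                     (adjacent A₁ D (inj₂ (cong (_, suc j) k)))
    where
    A₁ = addable-⊕ A P x
    k : cols (S₀ ⊕ p ⊕ c) (suc j) ≡ suc i′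
    k = trans (cols-same (S₀ ⊕ p) i′ (suc j)) (cong suc (colEq A₁))
    D : Addable (S₀ ⊕ p ⊕ c) (colEnd (S₀ ⊕ p ⊕ c) (suc j))
    D = subst (Addable (S₀ ⊕ p ⊕ c)) (colEnd-cong (suc j) (⊕-comm {S₀} c p)) (Addable-cong _ (⊕-comm {S₀} c p) (colEnd-addable (Young-⊕ Y A) (addable-⊕ P A (x ∘ sym))))
    e : colEnd (S₀ ⊕ p ⊕ c) (suc j) ≡ rowEnd (S₀ ⊕ p ⊕ c) (suc i′)
    e = cong₂ _,_ k (trans (sym (rowEq D)) (cong (rows (S₀ ⊕ p ⊕ c)) k))
  exchange-just P (apart at none A B ne) (down _ refl) none =
    exchanged none (down! refl) (apart at none (rowEnd-addable Y P λ ()) tt λ _ ())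
  exchange-just {p = p@(i , j)} P (apart at (at {c = c@(i′ , j′)}) A B ne) (down _ refl) (miss x) =
    exchanged (miss c≢p) (down! e) (apart at at (rowEnd-addable Y P λ ()) B₁ (distinct (x ∘ sym)))
    where
    c≢p : c ≢ p
    c≢p refl = ne refl refl
    B₁ = addable-⊕ B P c≢p
    e : rowEnd (S₀ ⊕ p) (suc i) ≡ rowEnd (S₀ ⊕ p ⊕ c) (suc i)
    e = cong (suc i ,_) (sym (rows-other (S₀ ⊕ p) i′ j′ λ { refl → x (cong (suc i ,_) (sym (rowEq B₁))) }))
  -- The plain letter lands on the barred one and pushes it one column on. In the opposite order the
  -- barred letter stays, and the plain one is placed behind it in the row.
  exchange-just {p = p@(i , j)} P (apart at (at {c = c@(_ , j′)}) A B ne) (down _ refl) (right refl) =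
    exchanged (miss c≢p) (down! e)
      (adjacent B₁ (subst (Addable (S₀ ⊕ p ⊕ c)) (sym e) D) (inj₁ (trans e (cong (suc i ,_) k))))
    where
    c≢p : c ≢ p
    c≢p ()
    B₁ = addable-⊕ B P c≢p
    k : rows (S₀ ⊕ p ⊕ c) (suc i) ≡ suc j′
    k = rows-same (S₀ ⊕ p) (suc i) j′
    D : Addable (S₀ ⊕ p ⊕ c) (rowEnd (S₀ ⊕ p ⊕ c) (suc i))
    D = subst (Addable (S₀ ⊕ p ⊕ c)) (rowEnd-cong (suc i) (⊕-comm {S₀} c p)) (Addable-cong _ (⊕-comm {S₀} c p) (rowEnd-addable (Young-⊕ Y B) (addable-⊕ P B (c≢p ∘ sym)) λ ()))
    e : colEnd (S₀ ⊕ p ⊕ c) (suc j′) ≡ rowEnd (S₀ ⊕ p ⊕ c) (suc i)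
    e = cong₂ _,_ (trans (cong (cols (S₀ ⊕ p ⊕ c)) (sym k)) (colEq D)) (sym k)
  exchange-just {p = p} P (adjacent {i} {j} A B w) (miss x) (miss y) = exchanged (miss x) (miss y)
    (adjacent (addable-⊕ A P x)
      (Addable-cong _ (⊕-comm (i , j) p) (addable-⊕ B (addable-⊕ P A (x ∘ sym)) y)) w)
  -- The second of two adjacent cells is not addable before the first, so the event cannot have
  -- added it.
  exchange-just P (adjacent A B (inj₁ refl)) (miss x) (right _) =
    ⊥-elim (1+n≢n (trans (sym (rowEq P)) (rowEq A)))
  exchange-just P (adjacent A B (inj₂ refl)) (miss x) (right _) =
    ⊥-elim (1+n≢n (trans (sym (colEq P)) (colEq A)))
  -- Horizontal pair: in the opposite order the barred letter moves one cell to the right and pushes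
  -- the plain one down, to where it goes directly in the given order.
  exchange-just P (adjacent {i} {j} A B (inj₁ refl)) (down _ refl) (miss x) =
    exchanged (right (cong (_, suc j) (sym (colEq B))))
      (down! (cong (suc i ,_) (sym (rows-other (S₀ ⊕ (i , j)) i (suc j) (1+n≢n ∘ sym)))))
      (apart at at (rowEnd-addable Y A λ ()) B (distinct (x ∘ sym)))
  exchange-just P (adjacent {i} {j} A B (inj₂ refl)) (down _ refl) (miss x) =
    ⊥-elim (x (cong (suc i ,_) (sym (rowEq B))))
  exchange-just P (adjacent {i} {j} A B (inj₂ q)) (down _ refl) (right refl) =
    exchanged (right e) (miss λ d≡ → 1+n≢n (sym (cong proj₂ d≡)))
      (apart at at B (subst (Addable S₁) (sym e) (colEnd-addable Y A))
        (distinct λ d≡ → 1+n≢n (sym (cong proj₂ d≡))))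
    where
    S₁ = S₀ ⊕ (i , j)
    j′ = rows S₁ (suc i)
    j′≡ : j′ ≡ j
    j′≡ = cong proj₂ q
    e : colEnd (S₁ ⊕ (suc i , j′)) (suc j′) ≡ colEnd S₁ (suc j)
    e = cong₂ _,_ (trans (cols-other S₁ (suc i) j′ (1+n≢n ∘ sym)) (cong (cols S₁ ∘ suc) j′≡)) (cong suc j′≡)

-- Transposition, which interchanges the two marks

trᵒ : Shape → Shape
trᵒ S = shape (cols S) (rows S)

trᵐ : State → State
trᵐ none      = none
trᵐ (fresh m) = fresh (opposite m)
trᵐ (at m c)  = at (opposite m) (swap c)

opposite² : ∀ m → opposite (opposite m) ≡ m
opposite² plain  = refl
opposite² barred = refl

trᵐ² : ∀ s → trᵐ (trᵐ s) ≡ s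
trᵐ² none      = refl
trᵐ² (fresh m) = cong fresh (opposite² m)
trᵐ² (at m c)  = cong (λ x → at x c) (opposite² m)

cellOf-tr : ∀ s → cellOf (trᵐ s) ≡ Maybe.map swap (cellOf s)
cellOf-tr none      = refl
cellOf-tr (fresh _) = refl
cellOf-tr (at _ _)  = refl

⊕?-tr : ∀ S c → trᵒ (S ⊕? c) ≡ trᵒ S ⊕? Maybe.map swap c
⊕?-tr S nothing  = refl
⊕?-tr S (just c) = refl

⊕ˢ-tr : ∀ S s → trᵒ (S ⊕ˢ s) ≡ trᵒ S ⊕ˢ trᵐ s
⊕ˢ-tr S s = trans (⊕?-tr S (cellOf s)) (cong (trᵒ S ⊕?_) (sym (cellOf-tr s)))

Young-tr : ∀ {S} → Young straight S → Young straight (trᵒ S)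
Young-tr Y = record { fits = λ _ → z≤n ; inRow = inCol Y z≤n ; off = λ _ → z≤n ; inCol = λ _ → inRow Y }

Addable?-tr : ∀ {S} c → Addable? S c → Addable? (trᵒ S) (Maybe.map swap c)
Addable?-tr nothing  a       = tt
Addable?-tr (just c) (a ⊹ b) = b ⊹ a

start-tr : ∀ S m → swap (start S m) ≡ start (trᵒ S) (opposite m)
start-tr S plain  = refl
start-tr S barred = refl

Act-tr : ∀ {S ev s s′ ev′} → Act straight S ev s s′ ev′ →
         Act straight (trᵒ S) (Maybe.map swap ev) (trᵐ s) (trᵐ s′) (Maybe.map swap ev′)
Act-tr none = none
Act-tr {S} (born {m} refl) = born (start-tr S m)
Act-tr still = still
Act-tr (miss ne) = miss λ e → ne (cong swap e)
Act-tr (down o refl) = right refl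
Act-tr (right refl) = down (λ ()) refl

Pass-tr : ∀ {S ev ss ss′ ev′} → Pass straight S ev ss ss′ ev′ →
          Pass straight (trᵒ S) (Maybe.map swap ev) (map trᵐ ss) (map trᵐ ss′) (Maybe.map swap ev′)
Pass-tr [] = []
Pass-tr {S} (_∷_ {s′ = s′} a p) =
  Act-tr a ∷ subst (λ T → Pass straight T _ _ _ _) (⊕ˢ-tr S s′) (Pass-tr p)

exchange : ∀ {S₀ ev a b b′ a′ a₁ b₁ e₁ e₂} → Young straight S₀ → Addable? S₀ ev → Exchange S₀ a b b′ a′ →
  Act straight (S₀ ⊕? ev) ev a a₁ e₁ → Act straight (S₀ ⊕? ev ⊕ˢ a₁) e₁ b b₁ e₂ →
  Exchanged (S₀ ⊕? ev) ev a₁ b₁ b′ a′ e₂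
exchange {ev = nothing} Y A x f g = exchange-none Y x f g
exchange {ev = just p}  Y A x f g = exchange-just Y A x f g

-- The mark is that of the letter coming first; a barred letter before a plain one is the transposed
-- situation.
Exchange? : Mark → Shape → State → State → State → State → Set
Exchange? plain  S a b b′ a′ = Exchange S a b b′ a′
Exchange? barred S a b b′ a′ = Exchange (trᵒ S) (trᵐ a) (trᵐ b) (trᵐ b′) (trᵐ a′)

-- The place of the exchanged pair is part of the index, since the second list is determined by the
-- first only once this place is known.
data Conv (m : Mark) : ℕ → Shape → List State → List State → Set where
  here  : ∀ {S a b b′ a′ ss} → Exchange? m S a b b′ a′ → Conv m 0 S (a ∷ b ∷ ss) (b′ ∷ a′ ∷ ss)
  there : ∀ {n S s ss ts} → Conv m n (S ⊕ˢ s) ss ts → Conv m (suc n) S (s ∷ ss) (s ∷ ts)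

Exchange-cong : ∀ {S S′ a b b′ a′} → S ≗ˢ S′ → Exchange S a b b′ a′ → Exchange S′ a b b′ a′
Exchange-cong e (apart {a} {b} ma mb A B ne) =
  apart ma mb (Addable?-cong (cellOf a) e A) (Addable?-cong (cellOf b) e B) ne
Exchange-cong e (adjacent {i} {j} A B w) =
  adjacent (Addable-cong _ e A) (Addable-cong _ (⊕-cong (i , j) e) B) w

≗-tr : ∀ {S S′} → S ≗ˢ S′ → trᵒ S ≗ˢ trᵒ S′
≗-tr (r & c) = c & r

Conv-cong : ∀ {m n S S′ ss ts} → S ≗ˢ S′ → Conv m n S ss ts → Conv m n S′ ss ts
Conv-cong {plain}  e (here x)  = here (Exchange-cong e x)
Conv-cong {barred} e (here x)  = here (Exchange-cong (≗-tr e) x)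
Conv-cong e (there {s = s} c) = there (Conv-cong (⊕?-cong (cellOf s) e) c)

exchange-sum : ∀ {S a b b′ a′} → Exchange S a b b′ a′ → S ⊕ˢ a ⊕ˢ b ≗ˢ S ⊕ˢ b′ ⊕ˢ a′
exchange-sum (apart {a} {b} _ _ _ _ _) = ⊕?-comm (cellOf a) (cellOf b)
exchange-sum (adjacent _ _ _)          = ≗-refl

exchange?-sum : ∀ m {S a b b′ a′} → Exchange? m S a b b′ a′ → S ⊕ˢ a ⊕ˢ b ≗ˢ S ⊕ˢ b′ ⊕ˢ a′
exchange?-sum plain  x = exchange-sum x
exchange?-sum barred {S} {a} {b} {b′} {a′} x = ≗-tr (subst₂ _≗ˢ_ (eq a b) (eq b′ a′) (exchange-sum x))
  where
  eq : ∀ s t → trᵒ S ⊕ˢ trᵐ s ⊕ˢ trᵐ t ≡ trᵒ (S ⊕ˢ s ⊕ˢ t)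
  eq s t = sym (trans (⊕ˢ-tr (S ⊕ˢ s) t) (cong (_⊕ˢ trᵐ t) (⊕ˢ-tr S s)))

record Exchanged? (m : Mark) (S : Shape) (ev : Maybe Cell) (a₁ b₁ b′ a′ : State) (e : Maybe Cell) : Set where
  constructor exchanged?
  field
    {b₁′ a₁′} : State
    {mid} : Maybe Cell
    actᵇ  : Act straight S ev b′ b₁′ mid
    actᵃ  : Act straight (S ⊕ˢ b₁′) mid a′ a₁′ e
    still-exchange : Exchange? m S a₁ b₁ b₁′ a₁′

map-swap² : ∀ (c : Maybe Cell) → Maybe.map swap (Maybe.map swap c) ≡ c
map-swap² nothing  = refl
map-swap² (just _) = refl

exchange? : ∀ m {S₀ ev a b b′ a′ a₁ b₁ e₁ e₂} → Young straight S₀ → Addable? S₀ ev → Exchange? m S₀ a b b′ a′ →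
  Act straight (S₀ ⊕? ev) ev a a₁ e₁ → Act straight (S₀ ⊕? ev ⊕ˢ a₁) e₁ b b₁ e₂ →
  Exchanged? m (S₀ ⊕? ev) ev a₁ b₁ b′ a′ e₂
exchange? plain Y A x f g with exchange Y A x f g
... | exchanged p q r = exchanged? p q r
exchange? barred {S₀} {ev} {b′ = b′} {a′} {a₁} {b₁} {e₁} {e₂} Y A x f g
  with exchange (Young-tr Y) (Addable?-tr ev A) x
         (subst (λ T → Act straight T _ _ _ _) (⊕?-tr S₀ ev) (Act-tr f))
         (subst (λ T → Act straight T _ _ _ _)
           (trans (⊕ˢ-tr (S₀ ⊕? ev) a₁) (cong (_⊕ˢ trᵐ a₁) (⊕?-tr S₀ ev))) (Act-tr g))
... | exchanged {b₁′} {a₁′} {mid} p q r = exchanged? {b₁′ = trᵐ b₁′} {trᵐ a₁′} {Maybe.map swap mid}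
      (subst (λ e → Act straight (S₀ ⊕? ev) e b′ (trᵐ b₁′) (Maybe.map swap mid)) (map-swap² ev)
        (back (sym (⊕?-tr S₀ ev)) p))
      (subst (Act straight (S₀ ⊕? ev ⊕ˢ trᵐ b₁′) (Maybe.map swap mid) a′ (trᵐ a₁′)) (map-swap² e₂)
        (back (sym (trans (⊕ˢ-tr (S₀ ⊕? ev) (trᵐ b₁′)) (cong₂ _⊕ˢ_ (⊕?-tr S₀ ev) (trᵐ² b₁′)))) q))
      (subst (λ T → Exchange T _ _ _ _) (sym (⊕?-tr S₀ ev))
        (subst₂ (Exchange _ _ _) (sym (trᵐ² b₁′)) (sym (trᵐ² a₁′)) r))
  where
  back : ∀ {S T ev s s′ ev′} → T ≡ trᵒ S → Act straight T ev (trᵐ s) s′ ev′ →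
         Act straight S (Maybe.map swap ev) s (trᵐ s′) (Maybe.map swap ev′)
  back {s = s} refl act = subst (λ y → Act straight _ _ y _ _) (trᵐ² s) (Act-tr act)

-- Before the pair nothing differs, and the pair hands on the same shape and the same event in both
-- orders, so the later letters react identically.
conv-pass : ∀ m {n S₀ ev ss ts ss₁ e} → Young straight S₀ → Addable? S₀ ev → Valid straight S₀ ss →
  Conv m n S₀ ss ts → Pass straight (S₀ ⊕? ev) ev ss ss₁ e →
  Σ[ ts₁ ∈ List State ] Pass straight (S₀ ⊕? ev) ev ts ts₁ e × Conv m n (S₀ ⊕? ev) ss₁ ts₁
conv-pass m Y A v (here x) (_∷_ {s′ = a₁} f (_∷_ {s′ = b₁} g p)) with exchange? m Y A x f g
... | exchanged? f′ g′ x′ = _ , f′ ∷ (g′ ∷ Pass-cong (exchange?-sum m x′) p) , here x′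
conv-pass m Y A (ok ∷ v) (there {s = s} c) (_∷_ {s′ = s′} f p) =
  let r = acted Y A ok f
      ts₁ , p′ , c′ = conv-pass m (Young-⊕? (cellOf s) Y (stateAddable straight s ok)) (add′ r) v c
                        (Pass-cong (sum′ r) p)
  in s′ ∷ ts₁ , f ∷ Pass-cong (≗-sym (sum′ r)) p′ , there (Conv-cong (≗-sym (sum′ r)) c′)

-- The cells tell which rule applies: separate cells are both addable to `S`, whereas the second of
-- two adjacent cells is not. Labels do not enter, which is what makes the mixed tableau alone
-- decide the outcome of a reordering.
exchange-functional : ∀ {S a b b′ a′ b″ a″} → Exchange S a b b′ a′ → Exchange S a b b″ a″ →
                      b′ ≡ b″ × a′ ≡ a″
exchange-functional (apart _ _ _ _ _) (apart _ _ _ _ _) = refl , refl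
exchange-functional (adjacent _ _ _) (adjacent _ _ _) = refl , refl
exchange-functional (apart _ _ A B ne) (adjacent A′ B′ w) = ⊥-elim (¬adjacent A B B′ w)
  where
  ¬adjacent : ∀ {S i j d} → Addable S (i , j) → Addable S d → Addable (S ⊕ (i , j)) d →
              ¬ (d ≡ (i , suc j) ⊎ d ≡ (suc i , j))
  ¬adjacent A B _ (inj₁ refl) = 1+n≢n (trans (sym (rowEq B)) (rowEq A))
  ¬adjacent A B _ (inj₂ refl) = 1+n≢n (trans (sym (colEq B)) (colEq A))
exchange-functional (adjacent A′ B′ w) (apart _ _ A B ne) with w
... | inj₁ refl = ⊥-elim (1+n≢n (trans (sym (rowEq B)) (rowEq A)))
... | inj₂ refl = ⊥-elim (1+n≢n (trans (sym (colEq B)) (colEq A)))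

exchange?-functional : ∀ m {S a b b′ a′ b″ a″} → Exchange? m S a b b′ a′ → Exchange? m S a b b″ a″ →
                       b′ ≡ b″ × a′ ≡ a″
exchange?-functional plain x y = exchange-functional x y
exchange?-functional barred {b′ = b′} {a′} {b″} {a″} x y =
  let p , q = exchange-functional x y in inj b′ b″ p , inj a′ a″ q
  where
  inj : ∀ s t → trᵐ s ≡ trᵐ t → s ≡ t
  inj s t e = trans (sym (trᵐ² s)) (trans (cong trᵐ e) (trᵐ² t))

conv-functional : ∀ {m n S ss ts us} → Conv m n S ss ts → Conv m n S ss us → ts ≡ us
conv-functional {m} (here x) (here y) with exchange?-functional m x y
... | refl , refl = refl
conv-functional (there c) (there d) = cong (_ ∷_) (conv-functional c d)

-- Doubling

-- An entry k in cell (i , j) of a shifted tableau is recorded twice in the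
-- doubled straight shape: in (i , j + 1) and in (j , i).  The barred copy of k
-- is the one in (j , i) exactly if k is not primed.
reflected translated : Cell → Cell
reflected  (i , j) = j , i
translated (i , j) = i , suc j

-- A letter enters the doubled word as its barred copy followed by its plain one; hence a fresh
-- letter has a fresh barred copy and a plain copy not yet present.
barredCopy plainCopy : State → State
barredCopy none          = none
barredCopy (fresh _)     = fresh barred
barredCopy (at plain  c) = at barred (reflected c)
barredCopy (at barred c) = at barred (translated c)
plainCopy none          = none
plainCopy (fresh _)     = none
plainCopy (at plain  c) = at plain (translated c)
plainCopy (at barred c) = at plain (reflected c)

-- Row `r` of the doubled shape consists of the translated cells of row `r` and the reflected cells
-- of column `r`; similarly for columns, where translation shifts the index by one. The summands `r`
-- and `suc c` on the left stand for the missing cells before the diagonal and avoid subtraction.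
record Doubled (S M : Shape) : Set where
  field
    rows-dbl  : ∀ r → r + rows M r ≡ rows S r + cols S r
    cols-dbl₀ : cols M 0 ≡ rows S 0
    cols-dbl  : ∀ c → suc c + cols M (suc c) ≡ cols S c + rows S (suc c)
open Doubled

Doubled-∅ : Doubled (∅ shifted) (∅ straight)
Doubled-∅ = record { rows-dbl = λ _ → refl ; cols-dbl₀ = refl ; cols-dbl = λ c → +-identityʳ (suc c) }

private
  shuffle : ∀ r a b m s t → r + m ≡ s + t → r + (a + (b + m)) ≡ (a + s) + (b + t)
  shuffle r a b m s t e = begin
    r + (a + (b + m)) ≡⟨ +-swap r a (b + m) ⟩
    a + (r + (b + m)) ≡⟨ cong (a +_) (+-swap r b m) ⟩
    a + (b + (r + m)) ≡⟨ cong (λ x → a + (b + x)) e ⟩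
    a + (b + (s + t)) ≡⟨ cong (a +_) (+-swap b s t) ⟩
    a + (s + (b + t)) ≡⟨ sym (+-assoc a s (b + t)) ⟩
    (a + s) + (b + t) ∎
    where open ≡-Reasoning

Doubled-⊕ : ∀ {S M} p → Doubled S M → Doubled (S ⊕ p) (M ⊕ reflected p ⊕ translated p)
Doubled-⊕ {S} {M} (i , j) D = record
  { rows-dbl  = λ r → shuffle r (δ i r) (δ j r) _ (rows S r) (cols S r) (rows-dbl D r)
  ; cols-dbl₀ = cong (δ i 0 +_) (cols-dbl₀ D)
  ; cols-dbl  = λ c → shuffle (suc c) (δ j c) (δ i (suc c)) _ (cols S c) (rows S (suc c)) (cols-dbl D c)
  }

Doubled-cong : ∀ {S S′ M M′} → S ≗ˢ S′ → M ≗ˢ M′ → Doubled S M → Doubled S′ M′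
Doubled-cong (r & c) (r′ & c′) D = record
  { rows-dbl  = λ x → subst₂ _≡_ (cong (x +_) (r′ x)) (cong₂ _+_ (r x) (c x)) (rows-dbl D x)
  ; cols-dbl₀ = trans (sym (c′ 0)) (trans (cols-dbl₀ D) (r 0))
  ; cols-dbl  = λ x → subst₂ _≡_ (cong (suc x +_) (c′ (suc x))) (cong₂ _+_ (c x) (r (suc x))) (cols-dbl D x)
  }

Doubled-⊕ˢ : ∀ {S M} s → Doubled S M → Doubled (S ⊕ˢ s) (M ⊕ˢ barredCopy s ⊕ˢ plainCopy s)
Doubled-⊕ˢ none          D = D
Doubled-⊕ˢ (fresh _)     D = D
Doubled-⊕ˢ (at plain  c) D = Doubled-⊕ c D
Doubled-⊕ˢ (at barred c) D = Doubled-cong ≗-refl (⊕-comm (reflected c) (translated c)) (Doubled-⊕ c D)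

module _ {S : Shape} (Y : Young shifted S) where

  cols-bound : ∀ j → cols S j ≤ suc j
  cols-bound j = ≮⇒≥ λ lt → n≮n _ (off Y lt)

  cols-full : ∀ {j} → j < rows S j → cols S j ≡ suc j
  cols-full {j} lt = ≤-antisym (cols-bound j) (inCol Y ≤-refl lt)

module _ {S₀ : Shape} (Y : Young shifted S₀) {i j : ℕ} (A : Addable S₀ (i , j)) where
  private
    S = S₀ ⊕ (i , j)
    Y⁺ = Young-⊕ Y A
    i≤j = addable-off Y A

  -- A cell in row `suc j` would put the diagonal cell of that row into column `suc j`, which ends
  -- above row `i` with `i ≤ j`.
  row-empty : rows S (suc j) ≡ suc j
  row-empty = ≤-antisym
    (≮⇒≥ λ lt → <⇒≱ (inCol Y⁺ ≤-refl lt) (≤-trans (cols-next-≤ Y A) (m≤n⇒m≤1+n i≤j)))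
    (fits Y⁺ (suc j))

  row-empty′ : rows S (suc (suc j)) ≡ suc (suc j)
  row-empty′ = ≤-antisym
    (≮⇒≥ λ lt → <⇒≱ (lower Y⁺ (inCol Y⁺ ≤-refl lt) (n≤1+n _) (n≤1+n _) ≤-refl)
       (≤-trans (cols-next-≤ Y A) (m≤n⇒m≤1+n i≤j)))
    (fits Y⁺ (suc (suc j)))

  cols-diagonal : i ≢ j → cols S₀ i ≡ suc i
  cols-diagonal ne = cols-full Y (subst (i <_) (sym (rowEq A)) (≤∧≢⇒< i≤j ne))

  module _ {M₀ : Shape} (D : Doubled S₀ M₀) where
    private
      e₁ = reflected (i , j)
      e₂ = translated (i , j)
      M₁ = M₀ ⊕ e₁
      M₂ = M₁ ⊕ e₂
      D₂ = Doubled-⊕ (i , j) D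

    -- This and the next identities match the row and column ends of the doubled shape, at the
    -- intermediate stages of the two insertions, with the copies of the cell that the shifted
    -- insertion reaches.
    down-barred : i ≢ j → (rows S (suc i) , suc i) ≡ colEnd M₁ (suc i)
    down-barred ne = cong (_, suc i) (sym (begin
      cols M₁ (suc i)  ≡⟨ cols-other M₀ j i (1+n≢n ∘ sym) ⟩
      cols M₀ (suc i)  ≡⟨ +-cancelˡ-≡ (suc i) _ _ (trans (cols-dbl D i) (cong (_+ rows S₀ (suc i)) (cols-diagonal ne))) ⟩
      rows S₀ (suc i)  ≡⟨ sym (rows-other S₀ i j (1+n≢n ∘ sym)) ⟩
      rows S (suc i)   ∎))
      where open ≡-Reasoning

    down-plain : i ≢ j → (suc i , suc (rows S (suc i))) ≡ rowEnd (M₂ ⊕ (rows S (suc i) , suc i)) (suc i)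
    down-plain ne = cong (suc i ,_) (sym (+-cancelˡ-≡ (suc i) _ _ (trans (+-swap (suc i) (δ R (suc i)) _)
      (trans (cong (δ R (suc i) +_) (rows-dbl D₂ (suc i))) (go (R ≟ suc i))))))
      where
      R = rows S (suc i)
      i<j = ≤∧≢⇒< i≤j ne
      -- If the new cell is diagonal, its reflected copy lies in row `suc i` itself and counts there
      -- through `δ`; otherwise the diagonal cell is already present and column `suc i` is longer by
      -- one. Both give the same total.
      go : Dec (R ≡ suc i) → δ R (suc i) + (R + cols S (suc i)) ≡ suc i + suc R
      go (yes e) = begin
        δ R (suc i) + (R + cols S (suc i)) ≡⟨ cong₂ (λ x y → δ x (suc i) + (x + y)) e c ⟩
        δ i i + (suc i + suc i)            ≡⟨ cong (_+ (suc i + suc i)) (δ-refl i) ⟩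
        suc (suc i + suc i)                ≡⟨ sym (+-suc (suc i) (suc i)) ⟩
        suc i + suc (suc i)                ≡⟨ cong (λ x → suc i + suc x) (sym e) ⟩
        suc i + suc R ∎
        where
        open ≡-Reasoning
        c : cols S (suc i) ≡ suc i
        c = ≤-antisym (≮⇒≥ λ lt → <⇒≢ (inRow Y⁺ lt) (sym e))
              (inCol Y⁺ (n≤1+n i) (subst (suc i <_) (sym (rows-after Y A)) (s≤s i<j)))
      go (no ne′) = begin
        δ R (suc i) + (R + cols S (suc i)) ≡⟨ cong (_+ (R + cols S (suc i))) (δ-≢ ne′) ⟩
        R + cols S (suc i)   ≡⟨ cong (R +_) (cols-full Y⁺ (≤∧≢⇒< (fits Y⁺ (suc i)) (ne′ ∘ sym))) ⟩
        R + suc (suc i)      ≡⟨ +-suc R (suc i) ⟩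
        suc (R + suc i)      ≡⟨ cong suc (+-comm R (suc i)) ⟩
        suc (suc i + R)      ≡⟨ sym (+-suc (suc i) R) ⟩
        suc i + suc R        ∎
        where open ≡-Reasoning

    right-plain : (suc j , cols S (suc j)) ≡ rowEnd M₂ (suc j)
    right-plain = cong (suc j ,_) (sym (+-cancelˡ-≡ (suc j) _ _
      (trans (rows-dbl D₂ (suc j)) (cong (_+ cols S (suc j)) row-empty))))

    right-barred : (cols S (suc j) , suc (suc j)) ≡ colEnd M₂ (suc (suc j))
    right-barred = cong (_, suc (suc j)) (sym (+-cancelˡ-≡ (suc (suc j)) _ _
      (trans (cols-dbl D₂ (suc j)) (trans (cong (cols S (suc j) +_) row-empty′) (+-comm (cols S (suc j)) _)))))

    turn-barred : i ≡ j → (i , suc j) ≡ colEnd M₁ (suc i)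
    turn-barred refl = cong (_, suc i) (sym (begin
      cols M₁ (suc i)  ≡⟨ cols-other M₀ i i (1+n≢n ∘ sym) ⟩
      cols M₀ (suc i)  ≡⟨ +-cancelˡ-≡ (suc i) _ _ (trans (cols-dbl D i)
                            (trans (cong₂ _+_ (colEq A) (trans (sym (rows-other S₀ i i (1+n≢n ∘ sym))) row-empty)) (+-comm i (suc i)))) ⟩
      i ∎))
      where open ≡-Reasoning

-- The two steps of the doubled insertion at the two copies of a letter.
record DoubleAct (M₀ : Shape) (ev : Maybe Cell) (s s′ : State) (ev′ : Maybe Cell) (b a : State) (up : State → State) : Set where
  M₁ = M₀ ⊕? Maybe.map reflected ev
  M₂ = M₁ ⊕? Maybe.map translated ev
  M₀′ = M₀ ⊕ˢ barredCopy s ⊕ˢ plainCopy s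
  field
    {b₁ a₁} : State
    {g g′}  : Maybe Cell
    act₁ : Act straight M₁ (Maybe.map reflected ev) b b₁ g
    act₂ : Act straight (M₁ ⊕ˢ b₁) g a a₁ (Maybe.map reflected ev′)
    act₃ : Act straight M₂ (Maybe.map translated ev) b₁ (barredCopy s′) g′
    act₄ : Act straight (M₂ ⊕ˢ barredCopy s′) g′ (up a₁) (plainCopy s′) (Maybe.map translated ev′)
    sum₁ : M₁ ⊕ˢ b₁ ⊕ˢ a₁ ≗ˢ M₀′ ⊕? Maybe.map reflected ev′
    sum₂ : M₂ ⊕ˢ barredCopy s′ ⊕ˢ plainCopy s′ ≗ˢ M₀′ ⊕? Maybe.map reflected ev′ ⊕? Maybe.map translated ev′

rz : Mark → State → State
rz m none = fresh m
rz m s    = s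

private
  rotate : ∀ M e b a → M ⊕ e ⊕ b ⊕ a ≗ˢ M ⊕ b ⊕ a ⊕ e
  rotate M e b a = ≗-trans (⊕-cong a (⊕-comm {M} e b)) (⊕-comm {M ⊕ b} e a)

  rotate₂ : ∀ M e f b a → M ⊕ e ⊕ f ⊕ b ⊕ a ≗ˢ M ⊕ b ⊕ a ⊕ e ⊕ f
  rotate₂ M e f b a = ≗-trans (rotate (M ⊕ e) f b a) (⊕-cong f (rotate M e b a))

  fixed : ∀ {up : State → State} → (∀ m c → up (at m c) ≡ at m c) → ∀ {S ev m c s′ ev′} →
          Act straight S ev (at m c) s′ ev′ → Act straight S ev (up (at m c)) s′ ev′
  fixed up {S} {ev} {m} {c} {s′} {ev′} a = subst (λ s → Act straight S ev s s′ ev′) (sym (up m c)) a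

  -- Reflected cells lie on or below the diagonal, translated ones strictly above it.
  reflected≢translated : ∀ {i j i′ j′} → i ≤ j → i′ ≤ j′ → reflected (i , j) ≢ translated (i′ , j′)
  reflected≢translated {i} {j} {i′} {j′} le le′ e =
    1+n≰n (≤-trans (s≤s (≤-trans le (≤-trans (≤-reflexive (cong proj₁ e)) le′))) (≤-reflexive (sym (cong proj₂ e))))

module _ {S₀ M₀ : Shape} (Y : Young shifted S₀) (D : Doubled S₀ M₀)
         (up : State → State) (up-at : ∀ m c → up (at m c) ≡ at m c) where

  double-none : ∀ {ev} → up none ≡ none → DoubleAct M₀ ev none none ev none none up
  double-none {ev} e = record { act₁ = none ; act₂ = none ; act₃ = none
    ; act₄ = subst (λ s → Act straight _ _ s _ _) (sym e) none ; sum₁ = ≗-refl ; sum₂ = ≗-refl }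

  double-still : ∀ {m c} → DoubleAct M₀ nothing (at m c) (at m c) nothing
                             (barredCopy (at m c)) (plainCopy (at m c)) up
  double-still {plain}  = record { act₁ = still ; act₂ = still ; act₃ = still ; act₄ = fixed {up} up-at still ; sum₁ = ≗-refl ; sum₂ = ≗-refl }
  double-still {barred} = record { act₁ = still ; act₂ = still ; act₃ = still ; act₄ = fixed {up} up-at still ; sum₁ = ≗-refl ; sum₂ = ≗-refl }

  double-miss : ∀ {m c p} → Addable S₀ p → Addable S₀ c → c ≢ p → DoubleAct M₀ (just p) (at m c) (at m c) (just p)
                             (barredCopy (at m c)) (plainCopy (at m c)) up
  double-miss {plain} {c} {p} P C ne = record
    { act₁ = miss λ { refl → ne refl } ; act₂ = miss λ e → reflected≢translated (addable-off Y P) (addable-off Y C) (sym e)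
    ; act₃ = miss (reflected≢translated (addable-off Y C) (addable-off Y P)) ; act₄ = fixed {up} up-at (miss λ { refl → ne refl })
    ; sum₁ = rotate M₀ (reflected p) (reflected c) (translated c) ; sum₂ = rotate₂ M₀ (reflected p) (translated p) (reflected c) (translated c) }
  double-miss {barred} {c} {p} P C ne = record
    { act₁ = miss λ e → reflected≢translated (addable-off Y P) (addable-off Y C) (sym e) ; act₂ = miss λ { refl → ne refl }
    ; act₃ = miss λ { refl → ne refl } ; act₄ = fixed {up} up-at (miss (reflected≢translated (addable-off Y C) (addable-off Y P)))
    ; sum₁ = rotate M₀ (reflected p) (translated c) (reflected c) ; sum₂ = rotate₂ M₀ (reflected p) (translated p) (translated c) (reflected c) }

  -- The reflected event hits only the barred copy and sends it right; the translated event hits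
  -- only the plain copy and sends it down.
  double-down : ∀ {i j} → Addable S₀ (i , j) → i ≢ j →
    let d = rowEnd (S₀ ⊕ (i , j)) (suc i) in
    DoubleAct M₀ (just (i , j)) (at plain (i , j)) (at plain d) (just d) (at barred (j , i)) (at plain (i , suc j)) up
  double-down {i} {j} A ne = record
    { act₁ = right (down-barred Y A D ne)
    ; act₂ = miss (λ e → i≢R (cong proj₁ e))
    ; act₃ = miss (λ e → i≢R (sym (cong proj₁ e)))
    ; act₄ = fixed {up} up-at (down (λ ()) (down-plain Y A D ne))
    ; sum₁ = ⊕-comm {M₀ ⊕ (j , i)} (R , suc i) (i , suc j) ; sum₂ = ≗-refl }
    where
    R = rows (S₀ ⊕ (i , j)) (suc i)
    i≢R : i ≢ R
    i≢R = <⇒≢ (fits (Young-⊕ Y A) (suc i))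

  module _ {i j} (A : Addable S₀ (i , j)) where
    private
      C = cols (S₀ ⊕ (i , j)) (suc j)
      suc-j≢C : suc j ≢ C
      suc-j≢C e = <⇒≢ (s≤s (≤-trans (cols-next-≤ Y A) (addable-off Y A))) (sym e)

    -- The copies stand in the other two places here, so the reflected event moves the plain copy
    -- down and the translated one moves the barred copy right.
    double-right :
      let d = colEnd (S₀ ⊕ (i , j)) (suc j) in
      DoubleAct M₀ (just (i , j)) (at barred (i , j)) (at barred d) (just d) (at barred (i , suc j)) (at plain (j , i)) up
    double-right = record
      { act₁ = miss (λ e → reflected≢translated (addable-off Y A) (addable-off Y A) (sym e))
      ; act₂ = down (λ ()) (right-plain Y A D)
      ; act₃ = right (right-barred Y A D)
      ; act₄ = fixed {up} up-at (miss λ e → suc-j≢C (cong proj₁ e))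
      ; sum₁ = ⊕-cong (suc j , C) (⊕-comm {M₀} (j , i) (i , suc j))
      ; sum₂ = ≗-trans (⊕-comm {M₀ ⊕ (j , i) ⊕ (i , suc j)} (C , suc (suc j)) (suc j , C))
                 (⊕-cong (C , suc (suc j)) (⊕-cong (suc j , C) (⊕-comm {M₀} (j , i) (i , suc j)))) }

    -- Here the mark changes. On the diagonal the barred copy moves right onto the plain one and
    -- pushes it down, into a reflected cell; the translated event then hits the barred copy a
    -- second time and sends it to a translated cell. The copies have traded places.
    double-turn : i ≡ j →
      let d = colEnd (S₀ ⊕ (i , j)) (suc j) in
      DoubleAct M₀ (just (i , j)) (at plain (i , j)) (at barred d) (just d) (at barred (j , i)) (at plain (i , suc j)) up
    double-turn e = record
      { act₁ = right (turn-barred Y A D e)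
      ; act₂ = subst (λ x → Act straight (M₀ ⊕ (j , i) ⊕ (i , suc j)) (just (i , suc j)) (at plain (i , suc j)) (at plain (x , C)) (just (suc j , C))) refl
                 (down (λ ()) (trans (right-plain Y A D) (cong (rowEnd (M₀ ⊕ (j , i) ⊕ (i , suc j)) ∘ suc) (sym e))))
      ; act₃ = right (right-barred Y A D)
      ; act₄ = fixed {up} up-at (miss λ e → suc-j≢C (cong proj₁ e))
      ; sum₁ = ≗-refl
      ; sum₂ = ⊕-comm {M₀ ⊕ (j , i) ⊕ (i , suc j)} (C , suc (suc j)) (suc j , C) }

double-born : ∀ {S₀ M₀} → Young shifted S₀ → Doubled S₀ M₀ → let d = start S₀ plain in
  DoubleAct M₀ nothing (fresh plain) (at plain d) (just d) (fresh barred) none (rz plain)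
double-born {S₀} {M₀} Y D = record
  { act₁ = born (cong (_, 0) (sym (cols-dbl₀ D))) ; act₂ = none ; act₃ = still
  ; act₄ = born (cong (0 ,_) (sym (trans (cong (δ R 0 +_) (rows-dbl D 0)) (go (R ≟ 0)))))
  ; sum₁ = ≗-refl ; sum₂ = ≗-refl }
  where
  R = rows S₀ 0
  -- The very first letter is placed in the corner, and its reflected copy then lies in row 0;
  -- afterwards column 0 has its single cell.
  go : Dec (R ≡ 0) → δ R 0 + (R + cols S₀ 0) ≡ suc R
  go (yes e) = trans (cong₂ (λ x y → δ x 0 + (x + y)) e (trans (cong (cols S₀) (sym e)) (colEq (start-addable plain Y (λ _ → refl)))))
                 (cong suc (sym e))
  go (no ne) = trans (cong₂ _+_ (δ-≢ ne) (trans (cong (R +_) (cols-full Y (≤∧≢⇒< z≤n (ne ∘ sym)))) (+-comm R 1))) refl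

double-act : ∀ {S₀ M₀ ev s s′ ev′} → Young shifted S₀ → Doubled S₀ M₀ → Addable? S₀ ev → StateOK shifted S₀ s →
  (up : State → State) → (∀ m c → up (at m c) ≡ at m c) → (s ≡ none → up none ≡ none) → (∀ {m} → s ≡ fresh m → up none ≡ rz plain none) →
  Act shifted (S₀ ⊕? ev) ev s s′ ev′ → DoubleAct M₀ ev s s′ ev′ (barredCopy s) (plainCopy s) up
double-act Y D A ok up h n f none = double-none Y D up h (n refl)
double-act Y D A refl up h n f (born refl) = record
  { DoubleAct (double-born Y D) hiding (act₄) ; act₄ = subst (λ x → Act straight _ _ x _ _) (sym (f refl)) (DoubleAct.act₄ (double-born Y D)) }
double-act Y D A ok up h n f still = double-still Y D up h
double-act Y D A ok up h n f (miss ne) = double-miss Y D up h A (proj₁ ok) ne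
double-act Y D A ok up h n f (down o refl) = double-down Y D up h A o
double-act Y D A ok up h n f (right refl) = double-right Y D up h A
double-act Y D A ok up h n f (turn o refl) = double-turn Y D up h A o

-- Insertion of a sequence of labelled letters

Label : Set
Label = Mark × ℕ

sameLabel : Label → Label → Bool
sameLabel (plain  , i) (plain  , j) = i ≡ᵇ j
sameLabel (barred , i) (barred , j) = i ≡ᵇ j
sameLabel _            _            = false

-- Announces the insertion of `ℓ`: its state changes from `none` to `fresh`. A letter that is
-- already placed remains as it is.
raise : Label → Label → State → State
raise ℓ l s = if sameLabel l ℓ then rz (proj₁ l) s else s

flag : Label → List Label → List State → List State
flag ℓ (l ∷ ls) (s ∷ ss) = raise ℓ l s ∷ flag ℓ ls ss
flag ℓ _        _        = []

-- Run k L st ss os: inserting the letters st (the last one first) into the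
-- empty tableau leads to the states ss of the letters L, which are listed in
-- increasing order, and os are the cells added on the way.
data Run (k : Kind) (L : List Label) : List Label → List State → List (Maybe Cell) → Set where
  []   : Run k L [] (map (λ _ → none) L) []
  step : ∀ {ℓ st ss ss′ o os} → Run k L st ss os → Pass k (∅ k) nothing (flag ℓ L ss) ss′ o →
         Run k L (ℓ ∷ st) ss′ (o ∷ os)

raise-≡ : ∀ ℓ l s → raise ℓ l s ≡ s ⊎ s ≡ none × raise ℓ l s ≡ fresh (proj₁ l)
raise-≡ ℓ l s with sameLabel l ℓ
raise-≡ ℓ l s         | false = inj₁ refl
raise-≡ ℓ l none      | true  = inj₂ (refl , refl)
raise-≡ ℓ l (fresh _) | true  = inj₁ refl
raise-≡ ℓ l (at _ _)  | true  = inj₁ refl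

raise-at : ∀ ℓ l m c → raise ℓ l (at m c) ≡ at m c
raise-at ℓ l m c with sameLabel l ℓ
... | false = refl
... | true  = refl

cellOf-raise : ∀ ℓ l s → cellOf (raise ℓ l s) ≡ cellOf s
cellOf-raise ℓ l s with raise-≡ ℓ l s
... | inj₁ e = cong cellOf e
... | inj₂ (refl , e) = cong cellOf e

Plain : Label → Set
Plain l = proj₁ l ≡ plain

raise-ok : ∀ {k S} ℓ l s → (k ≡ shifted → Plain l) → StateOK k S s → StateOK k S (raise ℓ l s)
raise-ok {k} {S} ℓ l s h ok with raise-≡ ℓ l s
... | inj₁ e = subst (StateOK k S) (sym e) ok
raise-ok {straight} ℓ l s h ok | inj₂ (refl , e) = subst (StateOK straight _) (sym e) tt
raise-ok {shifted}  ℓ l s h ok | inj₂ (refl , e) = subst (StateOK shifted _) (sym e) (h refl)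

flag-valid : ∀ {k S} ℓ L {ss} → (k ≡ shifted → All Plain L) → Valid k S ss → Valid k S (flag ℓ L ss)
flag-valid ℓ []      h v        = []
flag-valid ℓ (l ∷ L) h []       = []
flag-valid {k} ℓ (l ∷ L) h (_∷_ {s = s} ok v) =
  raise-ok {k} ℓ l s (All.head ∘ h) ok ∷
  subst (λ c → Valid k (_ ⊕? c) _) (sym (cellOf-raise ℓ l s)) (flag-valid ℓ L (All.tail ∘ h) v)

total-flag : ∀ {S} ℓ L ss → length ss ≡ length L → total S (flag ℓ L ss) ≡ total S ss
total-flag ℓ []      []       e = refl
total-flag {S} ℓ (l ∷ L) (s ∷ ss) e =
  trans (cong (λ c → total (S ⊕? c) (flag ℓ L ss)) (cellOf-raise ℓ l s)) (total-flag ℓ L ss (suc-injective e))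

flag-length : ∀ ℓ L ss → length ss ≡ length L → length (flag ℓ L ss) ≡ length L
flag-length ℓ []      []       e = refl
flag-length ℓ (l ∷ L) (s ∷ ss) e = cong suc (flag-length ℓ L ss (suc-injective e))

pass-length : ∀ {k S ev ss ss′ o} → Pass k S ev ss ss′ o → length ss′ ≡ length ss
pass-length []      = refl
pass-length (_ ∷ p) = cong suc (pass-length p)

run-length : ∀ {k L st ss os} → Run k L st ss os → length ss ≡ length L
run-length {L = L} [] = length-map _ L
run-length {L = L} (step {ℓ} {ss = ss} r p) = trans (pass-length p) (flag-length ℓ L ss (run-length r))

data Settled : State → Set where
  none : Settled none
  at   : ∀ {m c} → Settled (at m c)

act-settled : ∀ {k S ev s s′ o} → Act k S ev s s′ o → Settled s′
act-settled none       = none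
act-settled (born _)   = at
act-settled still      = at
act-settled (miss _)   = at
act-settled (down _ _) = at
act-settled (right _)  = at
act-settled (turn _ _) = at

pass-settled : ∀ {k S ev ss ss′ o} → Pass k S ev ss ss′ o → All Settled ss′
pass-settled []      = []
pass-settled (a ∷ p) = act-settled a ∷ pass-settled p

nones-settled : ∀ (L : List Label) → All Settled (map (λ _ → none) L)
nones-settled []      = []
nones-settled (_ ∷ L) = none ∷ nones-settled L

run-settled : ∀ {k L st ss os} → Run k L st ss os → All Settled ss
run-settled {L = L} [] = nones-settled L
run-settled (step r p) = pass-settled p

nones-valid : ∀ {k S} (L : List Label) → Valid k S (map (λ _ → none) L)
nones-valid []      = []
nones-valid {straight} (_ ∷ L) = tt ∷ nones-valid L
nones-valid {shifted}  (_ ∷ L) = tt ∷ nones-valid L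

nones-total : ∀ {S} (L : List Label) → total S (map (λ _ → none) L) ≡ S
nones-total []      = refl
nones-total (_ ∷ L) = nones-total L

run-valid : ∀ {k L st ss os} → (k ≡ shifted → All Plain L) → Run k L st ss os → Valid k (∅ k) ss
run-valid {L = L} h [] = nones-valid L
run-valid {k} {L} h (step {ℓ} r p) = valid′ (passed (Young-∅ k) tt (flag-valid ℓ L h (run-valid h r)) p)

runShape : Kind → List (Maybe Cell) → Shape
runShape k []       = ∅ k
runShape k (o ∷ os) = runShape k os ⊕? o

run-total : ∀ {k L st ss os} → (k ≡ shifted → All Plain L) → Run k L st ss os → total (∅ k) ss ≗ˢ runShape k os
run-total {k} {L} h [] = subst (_≗ˢ ∅ k) (sym (nones-total L)) ≗-refl
run-total {k} {L} h (step {ℓ} {ss = ss} {o = o} r p) = ≗-trans (totals (passed (Young-∅ k) tt (flag-valid ℓ L h (run-valid h r)) p))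
  (⊕?-cong o (subst (_≗ˢ _) (sym (total-flag ℓ L ss (run-length r))) (run-total h r)))

run-functional : ∀ {k L st ss ss′ os os′} → Run k L st ss os → Run k L st ss′ os′ → ss ≡ ss′ × os ≡ os′
run-functional [] [] = refl , refl
run-functional (step r p) (step r′ p′) with run-functional r r′
... | refl , refl with Pass-functional p p′
...   | refl , refl = refl , refl

flag-++ : ∀ ℓ X Y xs ys → length xs ≡ length X → flag ℓ (X ++ Y) (xs ++ ys) ≡ flag ℓ X xs ++ flag ℓ Y ys
flag-++ ℓ []      Y []       ys e = refl
flag-++ ℓ (x ∷ X) Y (s ∷ xs) ys e = cong (raise ℓ x s ∷_) (flag-++ ℓ X Y xs ys (suc-injective e))

pass-++⁺ : ∀ {k S ev xs xs′ mid ys ys′ o} → Pass k S ev xs xs′ mid → Pass k (total S xs′) mid ys ys′ o →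
           Pass k S ev (xs ++ ys) (xs′ ++ ys′) o
pass-++⁺ []      q = q
pass-++⁺ (a ∷ p) q = a ∷ pass-++⁺ p q

pass-++⁻ : ∀ {k S ev} xs {ys zs o} → Pass k S ev (xs ++ ys) zs o →
           Σ[ xs′ ∈ List State ] Σ[ ys′ ∈ List State ] Σ[ mid ∈ Maybe Cell ]
             zs ≡ xs′ ++ ys′ × Pass k S ev xs xs′ mid × Pass k (total S xs′) mid ys ys′ o
pass-++⁻ []       p = [] , _ , _ , refl , [] , p
pass-++⁻ (x ∷ xs) (a ∷ p) with pass-++⁻ xs p
... | xs′ , ys′ , mid , refl , q , q′ = _ ∷ xs′ , ys′ , mid , refl , a ∷ q , q′

-- The letters Y following X see only the cells X adds.
run-replace : ∀ {X X′ Y st zs xs xs′ os es} → Run straight (X ++ Y) st zs os →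
  Run straight X st xs es → Run straight X′ st xs′ es →
  Σ[ ys ∈ List State ] zs ≡ xs ++ ys × Run straight (X′ ++ Y) st (xs′ ++ ys) os
run-replace {X} {X′} {Y} [] [] [] =
  map (λ _ → none) Y , map-++ _ X Y , subst (λ zs → Run straight (X′ ++ Y) [] zs []) (map-++ _ X′ Y) []
run-replace {X} {X′} {Y} (step {ℓ} {ss = zs} r p) rx@(step {ss = xs} r₁ p₁) rx′@(step {ss = xs′} {ss′ = xs₁′} r₂ p₂)
  with run-replace r r₁ r₂
... | ys , refl , r′ with pass-++⁻ (flag ℓ X xs) (subst (λ z → Pass straight _ _ z _ _) (flag-++ ℓ X Y xs ys (run-length r₁)) p)
...   | _ , ys₁ , _ , refl , q , q′ with Pass-functional q p₁
...     | refl , refl = ys₁ , refl , step r′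
            (subst (λ z → Pass straight _ _ z _ _) (sym (flag-++ ℓ X′ Y xs′ ys (run-length r₂)))
              (pass-++⁺ p₂ (Pass-cong (≗-trans (run-total (λ ()) rx) (≗-sym (run-total (λ ()) rx′))) q′)))

-- Reordering the alphabet

-- Only neighbours of opposite marks are exchanged, so the plain letters keep their order among
-- themselves, and so do the barred ones.
data _⇝_ {A : Set} : List (Mark × A) → List (Mark × A) → Set where
  done : ∀ {L} → L ⇝ L
  exch : ∀ pre {m x y post Q} → (pre ++ (opposite m , y) ∷ (m , x) ∷ post) ⇝ Q →
         (pre ++ (m , x) ∷ (opposite m , y) ∷ post) ⇝ Q

⇝-trans : ∀ {A} {L P Q : List (Mark × A)} → L ⇝ P → P ⇝ Q → L ⇝ Q
⇝-trans done         q = q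
⇝-trans (exch pre p) q = exch pre (⇝-trans p q)

⇝-prep : ∀ {A} {L P : List (Mark × A)} l → L ⇝ P → (l ∷ L) ⇝ (l ∷ P)
⇝-prep l done         = done
⇝-prep l (exch pre p) = exch (l ∷ pre) (⇝-prep l p)

marked : ∀ {A : Set} → Mark → List A → List (Mark × A)
marked m = map (m ,_)

interleave : ∀ {A : Set} → List A → List (Mark × A)
interleave []       = []
interleave (k ∷ ks) = (barred , k) ∷ (plain , k) ∷ interleave ks

⇝-move : ∀ {A : Set} m (x : A) ys zs → ((m , x) ∷ marked (opposite m) ys ++ zs) ⇝ (marked (opposite m) ys ++ (m , x) ∷ zs)
⇝-move m x []       zs = done
⇝-move m x (y ∷ ys) zs = exch [] (⇝-prep _ (⇝-move m x ys zs))

interleave⇝plain-first : ∀ {A : Set} (ks : List A) → interleave ks ⇝ (marked plain ks ++ marked barred ks)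
interleave⇝plain-first []       = done
interleave⇝plain-first (k ∷ ks) = ⇝-trans (⇝-prep _ (⇝-prep _ (interleave⇝plain-first ks)))
  (exch [] (⇝-prep _ (⇝-move barred k ks (marked barred ks))))

interleave⇝barred-first : ∀ {A : Set} (ks : List A) → interleave ks ⇝ (marked barred ks ++ marked plain ks)
interleave⇝barred-first []       = done
interleave⇝barred-first (k ∷ ks) = ⇝-prep _ (⇝-trans (⇝-prep _ (interleave⇝barred-first ks))
  (⇝-move plain k ks (marked plain ks)))

plain⇝barred-first : ∀ {A : Set} (ks ks′ : List A) → (marked plain ks ++ marked barred ks′) ⇝ (marked barred ks′ ++ marked plain ks)
plain⇝barred-first []       ks′ = subst (marked barred ks′ ⇝_) (sym (++-identityʳ _)) done
plain⇝barred-first (k ∷ ks) ks′ = ⇝-trans (⇝-prep _ (plain⇝barred-first ks ks′)) (⇝-move plain k ks′ (marked plain ks))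

exchange-raise-a : ∀ {S a b b′ a′} ℓ x → Exchange S a b b′ a′ →
  Exchange S (raise ℓ (plain , x) a) b b′ (raise ℓ (plain , x) a′)
exchange-raise-a ℓ x X with sameLabel (plain , x) ℓ
... | false = X
... | true with X
...   | apart none mb A B ne  = apart fresh mb tt B λ ()
...   | apart fresh mb A B ne = X
...   | apart at mb A B ne    = X
...   | adjacent _ _ _        = X

exchange-raise-b : ∀ {S a b b′ a′} ℓ y → Exchange S a b b′ a′ →
  Exchange S a (raise ℓ (barred , y) b) (raise ℓ (barred , y) b′) a′
exchange-raise-b ℓ x X with sameLabel (barred , x) ℓ
... | false = X
... | true with X
...   | apart ma none A B ne  = apart ma fresh A tt λ _ ()
...   | apart ma fresh A B ne = X
...   | apart ma at A B ne    = X
...   | adjacent _ _ _        = X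

trˡ : Label → Label
trˡ (m , x) = opposite m , x

trᵐ-raise : ∀ ℓ l s → trᵐ (raise ℓ l s) ≡ raise (trˡ ℓ) (trˡ l) (trᵐ s)
trᵐ-raise ℓ l s with sameLabel l ℓ | sameLabel (trˡ l) (trˡ ℓ) | same ℓ l
  where
  same : ∀ ℓ l → sameLabel l ℓ ≡ sameLabel (trˡ l) (trˡ ℓ)
  same (plain  , i) (plain  , j) = refl
  same (plain  , i) (barred , j) = refl
  same (barred , i) (plain  , j) = refl
  same (barred , i) (barred , j) = refl
trᵐ-raise ℓ l s         | false | _ | refl = refl
trᵐ-raise ℓ l none      | true  | _ | refl = refl
trᵐ-raise ℓ l (fresh _) | true  | _ | refl = refl
trᵐ-raise ℓ l (at _ _)  | true  | _ | refl = refl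

exchange?-raise : ∀ m {S a b b′ a′} ℓ x y → Exchange? m S a b b′ a′ →
  Exchange? m S (raise ℓ (m , x) a) (raise ℓ (opposite m , y) b) (raise ℓ (opposite m , y) b′) (raise ℓ (m , x) a′)
exchange?-raise plain ℓ x y X = exchange-raise-b ℓ y (exchange-raise-a ℓ x X)
exchange?-raise barred {a = a} {b} {b′} {a′} ℓ x y X
  rewrite trᵐ-raise ℓ (barred , x) a | trᵐ-raise ℓ (plain , y) b
        | trᵐ-raise ℓ (plain , y) b′ | trᵐ-raise ℓ (barred , x) a′
  = exchange-raise-b (trˡ ℓ) y (exchange-raise-a (trˡ ℓ) x X)

flag-conv : ∀ pre {m x y post S ss ts} ℓ → Conv m (length pre) S ss ts →
  Conv m (length pre) S (flag ℓ (pre ++ (m , x) ∷ (opposite m , y) ∷ post) ss)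
                        (flag ℓ (pre ++ (opposite m , y) ∷ (m , x) ∷ post) ts)
flag-conv []        {m} ℓ (here X) = here (exchange?-raise m ℓ _ _ X)
flag-conv (l ∷ pre) {m} ℓ (there {s = s} c) =
  there (subst (λ o → Conv m _ (_ ⊕? o) _ _) (sym (cellOf-raise ℓ l s)) (flag-conv pre ℓ c))

nones-conv : ∀ pre {m S} {x y : ℕ} {post} →
  Conv m (length pre) S (map (λ _ → none) (pre ++ (m , x) ∷ (opposite m , y) ∷ post))
                        (map (λ _ → none) (pre ++ (opposite m , y) ∷ (m , x) ∷ post))
nones-conv [] {plain}  = here (apart none none tt tt λ ())
nones-conv [] {barred} = here (apart none none tt tt λ ())
nones-conv (l ∷ pre)   = there (nones-conv pre)

-- The order of the alphabet is altered, not the sequence of insertions; at every time the two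
-- orders stay related by `Conv` and add the same cell.
exchange-run : ∀ pre {m x y post st ss os} → Run straight (pre ++ (m , x) ∷ (opposite m , y) ∷ post) st ss os →
  Σ[ ts ∈ List State ] Run straight (pre ++ (opposite m , y) ∷ (m , x) ∷ post) st ts os
                     × Conv m (length pre) (∅ straight) ss ts
exchange-run pre [] = _ , [] , nones-conv pre
exchange-run pre {m} (step {ℓ} r p) =
  let ts , r′ , c = exchange-run pre r
      ts₁ , p′ , c′ = conv-pass m (Young-∅ straight) tt (flag-valid ℓ _ (λ ()) (run-valid (λ ()) r)) (flag-conv pre ℓ c) p
  in ts₁ , step r′ p′ , c′

reorder-run : ∀ {L P st ss os} → L ⇝ P → Run straight L st ss os → Σ[ ts ∈ List State ] Run straight P st ts os
reorder-run done         r = _ , r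
reorder-run (exch pre q) r = reorder-run q (proj₁ (proj₂ (exchange-run pre r)))

relabel : ∀ {A B : Set} → (A → B) → List (Mark × A) → List (Mark × B)
relabel f = map (map₂ f)

-- `f` and `g` read two labellings off a common list. Both runs end in the same states, and each
-- exchange acts on states by a function of the states and the place, so they still agree at the
-- end.
reorder-same : ∀ {A : Set} (f g : A → ℕ) {Z W : List (Mark × A)} {st st′ ss os os′} → Z ⇝ W →
  Run straight (relabel f Z) st ss os → Run straight (relabel g Z) st′ ss os′ →
  Σ[ ts ∈ List State ] Run straight (relabel f W) st ts os × Run straight (relabel g W) st′ ts os′
reorder-same f g done r r′ = _ , r , r′
reorder-same f g {st = st} {st′} {ss} {os} {os′} (exch pre {m} {x} {y} {post} q) r r′ = reorder-same f g q
    (subst (λ L → Run straight L st t os) (sym (map-++ _ pre _)) s)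
    (subst (λ L → Run straight L st′ t os′) (sym (map-++ _ pre _))
      (subst (λ ts → Run straight _ st′ ts os′) (conv-functional (subst (λ n → Conv m n (∅ straight) ss (proj₁ a′)) (len g) c′)
        (subst (λ n → Conv m n (∅ straight) ss (proj₁ a)) (len f) c)) s′))
  where
  a = exchange-run (relabel f pre) (subst (λ L → Run straight L st ss os) (map-++ _ pre _) r)
  a′ = exchange-run (relabel g pre) (subst (λ L → Run straight L st′ ss os′) (map-++ _ pre _) r′)
  t = proj₁ a
  s = proj₁ (proj₂ a)
  c = proj₂ (proj₂ a)
  s′ = proj₁ (proj₂ a′)
  c′ = proj₂ (proj₂ a′)
  len : ∀ f → length (relabel f pre) ≡ length pre
  len f = length-map _ pre

-- Doubling a whole run

doubleStates : List State → List State
doubleStates []       = []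
doubleStates (s ∷ ss) = barredCopy s ∷ plainCopy s ∷ doubleStates ss

-- Events are listed backwards in time: the plain copy is inserted second, so its translated cell
-- comes first.
doubleEvents : List (Maybe Cell) → List (Maybe Cell)
doubleEvents []       = []
doubleEvents (o ∷ os) = Maybe.map translated o ∷ Maybe.map reflected o ∷ doubleEvents os

-- A letter is labelled by the time of its insertion. Labels are therefore distinct even where the
-- word repeats a letter.
letters : Mark → ℕ → List Label
letters m zero    = []
letters m (suc n) = (m , n) ∷ letters m n

bothLetters : ℕ → List Label
bothLetters zero    = []
bothLetters (suc n) = (plain , n) ∷ (barred , n) ∷ bothLetters n

≡ᵇ-refl : ∀ n → (n ≡ᵇ n) ≡ true
≡ᵇ-refl zero    = refl
≡ᵇ-refl (suc n) = ≡ᵇ-refl n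

double-letter : ∀ {S₀ M₀ ev s₀ s′ ev′} n k → Young shifted S₀ → Doubled S₀ M₀ → Addable? S₀ ev →
  Settled s₀ → let s = raise (plain , n) (plain , k) s₀ in StateOK shifted S₀ s →
  Act shifted (S₀ ⊕? ev) ev s s′ ev′ →
  DoubleAct M₀ ev s s′ ev′ (raise (barred , n) (barred , k) (barredCopy s₀)) (plainCopy s₀)
    (raise (plain , n) (plain , k))
double-letter n k Y D A none ok a with k ≡ᵇ n
... | false = double-act Y D A ok id (λ _ _ → refl) (λ _ → refl) (λ ()) a
... | true  = double-act Y D A ok (rz plain) (λ _ _ → refl) (λ ()) (λ _ → refl) a
double-letter n k Y D A (at {plain}) ok a with k ≡ᵇ n
... | false = double-act Y D A ok id (λ _ _ → refl) (λ _ → refl) (λ ()) a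
... | true  = double-act Y D A ok (rz plain) (λ _ _ → refl) (λ ()) (λ _ → refl) a
double-letter n k Y D A (at {barred}) ok a with k ≡ᵇ n
... | false = double-act Y D A ok id (λ _ _ → refl) (λ _ → refl) (λ ()) a
... | true  = double-act Y D A ok (rz plain) (λ _ _ → refl) (λ ()) (λ _ → refl) a

-- Both doubled passes are followed in step with the single shifted one. `mid` holds the states
-- between them, when the barred copy of the new letter is placed and the plain one is not.
double-pass : ∀ ks n {S₀ M₀ ev ss ss′ o} → Young shifted S₀ → Doubled S₀ M₀ → Addable? S₀ ev →
  All Settled ss → length ss ≡ length ks → let L = marked plain ks ; M = interleave ks in
  Valid shifted S₀ (flag (plain , n) L ss) → Pass shifted (S₀ ⊕? ev) ev (flag (plain , n) L ss) ss′ o →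
  Σ[ mid ∈ List State ]
    Pass straight (M₀ ⊕? Maybe.map reflected ev) (Maybe.map reflected ev)
      (flag (barred , n) M (doubleStates ss)) mid (Maybe.map reflected o)
  × Pass straight (M₀ ⊕? Maybe.map reflected ev ⊕? Maybe.map translated ev) (Maybe.map translated ev)
      (flag (plain , n) M mid) (doubleStates ss′) (Maybe.map translated o)
double-pass [] n {ss = []} Y D A _ e _ [] = [] , [] , []
double-pass (k ∷ ks) n Y D A (st ∷ sts) e (ok ∷ v) (_∷_ {s = s} {s′} {ev′} a p) =
  let r = acted Y A ok a
      d = double-letter n k Y D A st ok a
      open DoubleAct d
      mid , q , q′ = double-pass ks n (Young-⊕? (cellOf s) Y (stateAddable shifted s ok)) (Doubled-⊕ˢ s D)
                       (add′ r) sts (suc-injective e) v (Pass-cong (sum′ r) p)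
  in b₁ ∷ a₁ ∷ mid
   , act₁ ∷ (act₂ ∷ Pass-cong (≗-sym sum₁) q)
   , act₃ ∷ (act₄ ∷ Pass-cong (≗-sym sum₂) q′)

all-plain : ∀ ks → All Plain (marked plain ks)
all-plain []       = []
all-plain (_ ∷ ks) = refl ∷ all-plain ks

run-double : ∀ {ks n ss os} → Run shifted (marked plain ks) (letters plain n) ss os →
             Run straight (interleave ks) (bothLetters n) (doubleStates ss) (doubleEvents os)
run-double {ks} {zero} [] = subst (λ z → Run straight (interleave ks) [] z []) (sym (nones ks)) []
  where
  nones : ∀ ks → doubleStates (map (λ _ → none) (marked plain ks)) ≡ map (λ _ → none) (interleave ks)
  nones []       = refl
  nones (_ ∷ ks) = cong (λ x → none ∷ none ∷ x) (nones ks)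
run-double {ks} {suc n} (step r p) =
  let mid , q , q′ = double-pass ks n (Young-∅ shifted) Doubled-∅ tt (run-settled r)
                       (trans (run-length r) (length-map _ ks))
                       (flag-valid _ _ (λ _ → all-plain ks) (run-valid (λ _ → all-plain ks) r)) p
  in step (step (run-double r) q) q′

-- Runs of letters of one mark within the doubled sequence

idle : ∀ {k S ss} → All Settled ss → Pass k S nothing ss ss nothing
idle []          = []
idle (none ∷ st) = none ∷ idle st
idle (at ∷ st)   = still ∷ idle st

flag-plain : ∀ {n} ks ss → length ss ≡ length ks → flag (barred , n) (marked plain ks) ss ≡ ss
flag-plain []       []       e = refl
flag-plain (_ ∷ ks) (s ∷ ss) e = cong (s ∷_) (flag-plain ks ss (suc-injective e))

flag-barred : ∀ {n} ks ss → length ss ≡ length ks → flag (plain , n) (marked barred ks) ss ≡ ss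
flag-barred []       []       e = refl
flag-barred (_ ∷ ks) (s ∷ ss) e = cong (s ∷_) (flag-barred ks ss (suc-injective e))

plainEvents barredEvents : List (Maybe Cell) → List (Maybe Cell)
plainEvents []       = []
plainEvents (o ∷ os) = o ∷ nothing ∷ plainEvents os
barredEvents []       = []
barredEvents (o ∷ os) = nothing ∷ o ∷ barredEvents os

-- Smaller letters never notice larger ones. With all plain letters in front, the insertion of a
-- barred letter leaves them idle, and the doubled sequence reduces to row insertion.
run-plain : ∀ {ks n ss os} → Run straight (marked plain ks) (letters plain n) ss os →
            Run straight (marked plain ks) (bothLetters n) ss (plainEvents os)
run-plain {n = zero} [] = []
run-plain {ks} {suc n} (step {ss = ss} r p) =
  step (step (run-plain r) (subst (λ z → Pass straight _ _ z ss nothing)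
    (sym (flag-plain ks ss (trans (run-length r) (length-map _ ks)))) (idle (run-settled r)))) p

run-barred : ∀ {ks n ss os} → Run straight (marked barred ks) (letters barred n) ss os →
             Run straight (marked barred ks) (bothLetters n) ss (barredEvents os)
run-barred {n = zero} [] = []
run-barred {ks} {suc n} (step {ss = ss₀} {ss} r p) =
  step (step (run-barred r) p) (subst (λ z → Pass straight _ _ z ss nothing)
    (sym (flag-barred ks ss (trans (trans (pass-length p) (flag-length (barred , n) (marked barred ks) ss₀ (run-length r))) (length-map {B = Label} (barred ,_) ks)))) (idle (pass-settled p)))

flag-tr : ∀ ℓ L ss → map trᵐ (flag ℓ L ss) ≡ flag (trˡ ℓ) (map trˡ L) (map trᵐ ss)
flag-tr ℓ []      ss       = refl
flag-tr ℓ (l ∷ L) []       = refl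
flag-tr ℓ (l ∷ L) (s ∷ ss) = cong₂ _∷_ (trᵐ-raise ℓ l s) (flag-tr ℓ L ss)

run-tr : ∀ {L st ss os} → Run straight L st ss os →
         Run straight (map trˡ L) (map trˡ st) (map trᵐ ss) (map (Maybe.map swap) os)
run-tr {L} [] = subst (λ z → Run straight (map trˡ L) [] z []) (nones L) []
  where
  nones : ∀ L → map (λ _ → none) (map trˡ L) ≡ map trᵐ (map (λ _ → none) L)
  nones []      = refl
  nones (_ ∷ L) = cong (none ∷_) (nones L)
run-tr {L} (step {ℓ} {ss = ss} r p) =
  step (run-tr r) (subst (λ z → Pass straight _ _ z _ _) (flag-tr ℓ L ss) (Pass-tr p))

-- Column insertion of barred letters is transposed row insertion; so the RSK recording path also
-- determines what the barred letters add when they come first.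
run-transposed : ∀ {ks n ss os} → Run straight (marked plain ks) (letters plain n) ss os →
  Run straight (marked barred ks) (letters barred n) (map trᵐ ss) (map (Maybe.map swap) os)
run-transposed {ks} {n} {ss} {os} r =
  subst₂ (λ L st → Run straight L st (map trᵐ ss) (map (Maybe.map swap) os)) (labels ks) (steps n) (run-tr r)
  where
  labels : ∀ ks → map trˡ (marked plain ks) ≡ marked barred ks
  labels ks = sym (map-∘ ks)
  steps : ∀ n → map trˡ (letters plain n) ≡ letters barred n
  steps zero    = refl
  steps (suc n) = cong ((barred , n) ∷_) (steps n)

doubleEvents-injective : ∀ os os′ → doubleEvents os ≡ doubleEvents os′ → os ≡ os′
doubleEvents-injective []             []               e = refl
doubleEvents-injective (nothing ∷ os) (nothing ∷ os′)  e =
  cong (nothing ∷_) (doubleEvents-injective os os′ (∷-injectiveʳ (∷-injectiveʳ e)))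
doubleEvents-injective (just (i , j) ∷ os) (just (i′ , j′) ∷ os′) e
  with ∷-injectiveˡ (∷-injectiveʳ e) | doubleEvents-injective os os′ (∷-injectiveʳ (∷-injectiveʳ e))
... | refl | refl = refl
doubleEvents-injective (nothing ∷ os) (just _ ∷ os′)  ()
doubleEvents-injective (just _ ∷ os)  (nothing ∷ os′) ()

-- The plain letters are replaced while they come first in the order, and then
-- the barred ones while those come first: the replaced letters add the same
-- cells, and the remaining ones see nothing else of them.
record-determined : ∀ {ks ks′ n xs xs′ us us′ os os′ qs} →
  Run shifted (marked plain ks) (letters plain n) xs os →
  Run shifted (marked plain ks′) (letters plain n) xs′ os′ →
  Run straight (marked plain ks) (letters plain n) us qs →
  Run straight (marked plain ks′) (letters plain n) us′ qs → os ≡ os′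
record-determined {ks} {ks′} r r′ q q′ = doubleEvents-injective _ _ (proj₂ (run-functional c₅ c₆))
  where
  c₁ = proj₂ (reorder-run (interleave⇝plain-first ks) (run-double r))
  c₂ = proj₂ (proj₂ (run-replace c₁ (run-plain q) (run-plain q′)))
  c₃ = proj₂ (reorder-run (plain⇝barred-first ks′ ks) c₂)
  c₅ = proj₂ (proj₂ (run-replace c₃ (run-barred (run-transposed q)) (run-barred (run-transposed q′))))
  c₆ = proj₂ (reorder-run (interleave⇝barred-first ks′) (run-double r′))

relabel-marked : ∀ {A B : Set} (f : A → B) m ks → relabel f (marked m ks) ≡ marked m (map f ks)
relabel-marked f m ks = trans (sym (map-∘ ks)) (map-∘ ks)

relabel-interleave : ∀ {A B : Set} (f : A → B) ks → relabel f (interleave ks) ≡ interleave (map f ks)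
relabel-interleave f []       = refl
relabel-interleave f (k ∷ ks) = cong (λ z → (barred , f k) ∷ (plain , f k) ∷ z) (relabel-interleave f ks)

run-prefix : ∀ {X Y st zs xs os es} → Run straight (X ++ Y) st zs os → Run straight X st xs es → Σ[ ys ∈ List State ] zs ≡ xs ++ ys
run-prefix r q with run-replace r q q
... | ys , e , _ = ys , e

++-cancel-≡ : ∀ {A : Set} (xs xs′ : List A) {ys ys′} → length xs ≡ length xs′ → xs ++ ys ≡ xs′ ++ ys′ → xs ≡ xs′ × ys ≡ ys′
++-cancel-≡ []       []         e q = refl , q
++-cancel-≡ (x ∷ xs) (x′ ∷ xs′) e q = map₁ (cong₂ _∷_ (∷-injectiveˡ q)) (++-cancel-≡ xs xs′ (suc-injective e) (∷-injectiveʳ q))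

-- Once all plain letters come first in the order, they undergo RSK insertion.
insertion-determined : ∀ (ps : List (ℕ × ℕ)) {n xs us us′ os os′ qs qs′} →
  let ks = map proj₁ ps ; ks′ = map proj₂ ps in
  Run shifted (marked plain ks) (letters plain n) xs os →
  Run shifted (marked plain ks′) (letters plain n) xs os′ →
  Run straight (marked plain ks) (letters plain n) us qs →
  Run straight (marked plain ks′) (letters plain n) us′ qs′ → us ≡ us′
insertion-determined ps {n} {xs} {us} {us′} {os} {os′} r r′ q q′ =
  let ts , a , a′ = reorder-same proj₁ proj₂ (interleave⇝plain-first ps)
        (subst (λ L → Run straight L (bothLetters n) (doubleStates xs) (doubleEvents os)) (sym (relabel-interleave proj₁ ps)) (run-double r))
        (subst (λ L → Run straight L (bothLetters n) (doubleStates xs) (doubleEvents os′)) (sym (relabel-interleave proj₂ ps)) (run-double r′))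
      ys , e = run-prefix (subst (λ L → Run straight L (bothLetters n) ts (doubleEvents os)) (labels proj₁) a) (run-plain q)
      ys′ , e′ = run-prefix (subst (λ L → Run straight L (bothLetters n) ts (doubleEvents os′)) (labels proj₂) a′) (run-plain q′)
  in proj₁ (++-cancel-≡ us us′ (trans (run-length q) (trans (len proj₁) (sym (trans (run-length q′) (len proj₂))))) (trans (sym e) e′))
  where
  labels : ∀ (f : ℕ × ℕ → ℕ) → relabel f (marked plain ps ++ marked barred ps) ≡ marked plain (map f ps) ++ marked barred (map f ps)
  labels f = trans (map-++ _ (marked plain ps) _) (cong₂ _++_ (relabel-marked f plain ps) (relabel-marked f barred ps))
  len : ∀ (f : ℕ × ℕ → ℕ) → length (marked plain (map f ps)) ≡ length ps
  len f = trans (length-map _ (map f ps)) (length-map f ps)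

-- Ascents

-- The relative position of two consecutive letters of which the first has been
-- inserted before the second.
data Asc : State → State → Set where
  plain<   : ∀ {i j i′ j′} → j < j′ → Asc (at plain (i , j)) (at plain (i′ , j′))
  barred<  : ∀ {i j i′ j′} → i < i′ → Asc (at barred (i , j)) (at barred (i′ , j′))
  mixed    : ∀ {c d} → Asc (at barred c) (at plain d)
  unplaced : ∀ {m c} → Asc (at m c) (fresh plain)

PlainFresh : State → Set
PlainFresh (fresh m) = m ≡ plain
PlainFresh _         = ⊤

onDiagonal : ∀ {k i j} → OnDiagonal k (i , j) → i ≡ j × k ≡ shifted
onDiagonal {shifted} refl = refl , refl

module _ {k : Kind} {S₀ : Shape} (Y : Young k S₀) where

  private
    outside : ∀ {S i j} → Addable S (i , j) → ¬ i < cols S j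
    outside A lt = <⇒≢ lt (sym (colEq A))

    inside : ∀ {i j} → Addable S₀ (i , j) → i < cols (S₀ ⊕ (i , j)) j
    inside A = ≤-reflexive (sym (cols-after Y A))

    not-before : ∀ {i j i′ j′} → Addable S₀ (i , j) → Addable (S₀ ⊕ (i , j)) (i′ , j′) →
                 i′ ≤ i → j′ ≤ j → ⊥
    not-before A B i′≤ j′≤ = outside B (lower Y⁺ (inside A) i′≤ j′≤ (addable-off Y⁺ B))
      where Y⁺ = Young-⊕ Y A

  asc-none : ∀ {s₁ s₁′ e₁ s₂ s₂′ e₂} → StateOK k S₀ s₁ → Act k S₀ nothing s₁ s₁′ e₁ →
    Act k (S₀ ⊕ˢ s₁′) e₁ s₂ s₂′ e₂ → Asc s₁ s₂ → Asc s₁′ s₂′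
  asc-none ok still still a = a
  asc-none ok (still {plain}) (born refl) unplaced =
    plain< (inRow Y⁺ (lower Y⁺ (inside A) z≤n ≤-refl (≤-trans (offset-mono k z≤n) (addable-off Y A))))
    where
    A = stateCell {k} {m = plain} ok
    Y⁺ = Young-⊕ Y A
  asc-none ok (still {barred}) (born refl) unplaced = mixed

  module _ {p : Cell} (P : Addable S₀ p) where
    private
      S = S₀ ⊕ p
      Y⁺ = Young-⊕ Y P

    -- Let the first of two plain letters be left of the second. If it moves down it goes weakly
    -- left and cannot hit the second; if only the second moves, the first lies in a lower row and
    -- the row end reached is still to its right. Barred letters behave alike with rows and columns
    -- interchanged. Turning the first letter of a plain pair gives `mixed`.
    asc-just : ∀ {s₁ s₁′ e₁ s₂ s₂′ e₂} → StateOK k S₀ s₁ → Act k S (just p) s₁ s₁′ e₁ →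
      Act k (S ⊕ˢ s₁′) e₁ s₂ s₂′ e₂ → Asc s₁ s₂ → Asc s₁′ s₂′
    asc-just ok (miss x) (miss y) a = a
    asc-just ok (miss {plain} x) (down o refl) (plain< lt) = plain< (inRow Y₂ (lower Y₂ mem (≰⇒> λ le →
        not-before P A₁ le (<⇒≤ lt)) ≤-refl (≤-trans (offset-mono k (≰⇒> λ le → not-before P A₁ le (<⇒≤ lt))) (addable-off Y⁺ A₁))))
      where
      A₁ = addable-⊕ (stateCell {k} {m = plain} ok) P x
      Y₂ = Young-⊕ Y⁺ A₁
      mem = ≤-reflexive (sym (cols-after Y⁺ A₁))
    asc-just ok (miss {plain} x) (turn o refl) (plain< lt) with onDiagonal {k} o
    ... | refl , refl = ⊥-elim (not-before P A₁ (≤-trans (addable-off Y⁺ A₁) (<⇒≤ lt)) (<⇒≤ lt))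
      where
      A₁ = addable-⊕ (stateCell {k} {m = plain} ok) P x
    asc-just ok (miss {barred} {i , j} x) (right {i₂} {j₂} refl) (barred< lt) =
      barred< (lower Y₂ (≤-reflexive (sym (cols-after Y⁺ A₁))) ≤-refl (≰⇒> λ le → not-before P A₁ (<⇒≤ lt) le)
        (≤-trans (offset-mono k (<⇒≤ lt)) (≤-trans (addable-off Y P) (n≤1+n j₂))))
      where
      A₁ = addable-⊕ (stateCell {k} {m = barred} ok) P x
      Y₂ = Young-⊕ Y⁺ A₁
    asc-just ok (miss {barred} x) (down o refl) mixed = mixed
    asc-just ok (miss {barred} {i , j} x) (turn {d} o refl) mixed with onDiagonal {k} o
    ... | refl , refl = barred< (lower Y₂ (≤-reflexive (sym (cols-after Y⁺ A₁))) ≤-refl d<j i≤)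
      where
      A₁ = addable-⊕ (stateCell {k} {m = barred} ok) P x
      Y₂ = Young-⊕ Y⁺ A₁
      d<j : d < j
      d<j = ≰⇒> λ le → not-before P A₁ (≤-trans (addable-off Y⁺ A₁) le) le
      i≤ : i ≤ suc d
      i≤ = ≮⇒≥ λ lt → <⇒≱ (subst (j <_) (row-empty Y P) (inRow Y⁺ (subst (suc d <_) (sym (colEq A₁)) lt))) d<j
    asc-just ok (down {i} {j} o refl) (miss y) (plain< lt) = plain< (≤-<-trans (rows-next-≤ Y P o) lt)
    asc-just ok (down o refl) (down o′ refl) (plain< lt) = ⊥-elim (<⇒≱ lt (rows-next-≤ Y P o))
    asc-just ok (down o refl) (turn o′ refl) (plain< lt) = ⊥-elim (<⇒≱ lt (rows-next-≤ Y P o))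
    asc-just ok (right refl) (miss y) (barred< lt) = barred< (≤-<-trans (cols-next-≤ Y P) lt)
    asc-just ok (right refl) (miss y) mixed = mixed
    asc-just ok (right refl) (right refl) (barred< lt) = ⊥-elim (<⇒≱ lt (cols-next-≤ Y P))
    asc-just ok (right refl) (down o refl) mixed = mixed
    asc-just ok (right refl) (turn o refl) mixed = ⊥-elim (colEnd-offDiagonal Y P o)
    asc-just ok (turn o refl) (miss y) (plain< lt) = mixed
    asc-just ok (turn o refl) (down o′ refl) (plain< lt) = mixed
    asc-just ok (turn o refl) (turn o′ refl) (plain< lt) = ⊥-elim (colEnd-offDiagonal Y P o′)

    -- The converse is needed for undoing an insertion: the letters recovered must have been in the
    -- order of their insertion as well.
    desc-just : ∀ {s₁ s₁′ e₁ s₂ s₂′ e₂} → StateOK k S₀ s₁ → StateOK k (S₀ ⊕ˢ s₁) s₂ →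
      Act k S (just p) s₁ s₁′ e₁ → Act k (S ⊕ˢ s₁′) e₁ s₂ s₂′ e₂ → Asc s₁′ s₂′ → Asc s₁ s₂
    desc-just ok ok₂ (miss x) (miss y) a = a
    desc-just ok ok₂ (miss {plain} {c} x) (down {i} {j} o refl) (plain< lt) = plain< (<-≤-trans lt (≤-trans
        (≤-reflexive (rows-≗ (⊕-comm {S₀} p c) (suc i))) (rows-next-≤ (Young-⊕ Y A) (addable-⊕ P A (x ∘ sym)) o)))
      where A = stateCell {k} {m = plain} ok
    desc-just ok ok₂ (miss {barred} x) (down o refl) mixed = mixed
    desc-just ok ok₂ (miss {barred} {c} x) (right {i} {j} refl) (barred< lt) = barred< (<-≤-trans lt (≤-trans
        (≤-reflexive (cols-≗ (⊕-comm {S₀} p c) (suc j))) (cols-next-≤ (Young-⊕ Y A) (addable-⊕ P A (x ∘ sym)))))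
      where A = stateCell {k} {m = barred} ok
    desc-just ok ok₂ (miss {barred} x) (turn o refl) a = mixed
    desc-just ok ok₂ (down {i} {j} o refl) (miss {plain} {i₂ , j₂} y) (plain< lt) = plain< (≰⇒> absurd)
      where
      B = stateCell {k} {m = plain} ok₂
      absurd : ¬ j₂ ≤ j
      absurd j₂≤j with m≤n⇒m<n∨m≡n (≰⇒> λ le → not-before P B le j₂≤j)
      ... | inj₂ refl = <⇒≢ lt (rowEq B)
      ... | inj₁ lt′ = <-asym lt (inRow Y⁺ (subst (suc i <_) (sym (colEq B)) lt′))
    desc-just ok ok₂ (down o refl) (down o′ refl) (plain< lt) =
      ⊥-elim (<⇒≱ lt (rows-next-≤ Y⁺ (rowEnd-addable Y P o) o′))
    desc-just ok ok₂ (right refl) (miss {plain} y) a = mixed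
    desc-just ok ok₂ (right {i} {j} refl) (miss {barred} {i₂ , j₂} y) (barred< lt) = barred< (≰⇒> absurd)
      where
      B = stateCell {k} {m = barred} ok₂
      absurd : ¬ i₂ ≤ i
      absurd i₂≤i with m≤n⇒m<n∨m≡n (≰⇒> λ le → not-before P B i₂≤i le)
      ... | inj₂ refl = <⇒≢ lt (colEq B)
      ... | inj₁ lt′ = <-asym lt (inCol Y⁺ (≤-trans (offset-mono k i₂≤i) (≤-trans (addable-off Y P) (n≤1+n j)))
                          (subst (suc j <_) (sym (rowEq B)) lt′))
    desc-just ok ok₂ (right refl) (down o refl) a = mixed
    desc-just ok ok₂ (right refl) (turn o refl) a = mixed
    desc-just ok ok₂ (right refl) (right refl) (barred< lt) =
      ⊥-elim (<⇒≱ lt (cols-next-≤ Y⁺ (colEnd-addable Y P)))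
    desc-just ok ok₂ (turn o refl) (miss {plain} {i₂ , j₂} y) a with onDiagonal {k} o
    ... | refl , refl = plain< (≰⇒> λ le → not-before P B (≤-trans (addable-off Y⁺ B) le) le)
      where B = stateCell {k} {m = plain} ok₂
    desc-just ok ok₂ (turn {i} o refl) (miss {barred} {i₂ , j₂} y) (barred< lt) with onDiagonal {k} o
    ... | refl , refl = ⊥-elim absurd
      where
      B = stateCell {k} {m = barred} ok₂
      absurd : ⊥
      absurd with m≤n⇒m<n∨m≡n (≰⇒> λ le → not-before P B (≤-trans (addable-off Y⁺ B) le) le)
      ... | inj₂ refl = <⇒≢ lt (colEq B)
      ... | inj₁ lt′ with i₂ ≤? suc i
      ...   | yes le = <-asym lt (inCol Y⁺ le (subst (suc i <_) (sym (rowEq B)) lt′))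
      ...   | no gt = <-asym lt′ (subst (j₂ <_) (row-empty Y P) (inRow Y⁺ (subst (suc i <_) (sym (colEq B)) (≰⇒> gt))))
    desc-just ok ok₂ (turn o refl) (down o′ refl) a with onDiagonal {k} o
    ... | refl , refl = plain< ≤-refl
    desc-just ok ok₂ (turn o refl) (turn o′ refl) a = ⊥-elim (colEnd-offDiagonal Y P o′)
    desc-just ok ok₂ (turn o refl) (right refl) (barred< lt) =
      ⊥-elim (<⇒≱ lt (cols-next-≤ Y⁺ (colEnd-addable Y P)))

  desc-none : ∀ {s₁ s₁′ e₁ s₂ s₂′ e₂} → PlainFresh s₁ → PlainFresh s₂ → StateOK k (S₀ ⊕ˢ s₁) s₂ →
    Act k S₀ nothing s₁ s₁′ e₁ → Act k (S₀ ⊕ˢ s₁′) e₁ s₂ s₂′ e₂ → Asc s₁′ s₂′ → Asc s₁ s₂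
  desc-none f f₂ ok₂ still still a = a
  desc-none f refl ok₂ still (born refl) a = unplaced
  desc-none refl f₂ ok₂ (born refl) (miss {plain} {zero , j₂} y) (plain< lt) =
    ⊥-elim (<⇒≢ lt (rowEq (stateCell {k} {m = plain} ok₂)))
  desc-none refl f₂ ok₂ (born refl) (miss {plain} {suc i₂ , j₂} y) (plain< lt) =
    ⊥-elim (<-asym lt (inRow Y (subst (0 <_) (sym (colEq (stateCell {k} {m = plain} ok₂))) z<s)))
  desc-none refl f₂ ok₂ (born refl) (down o refl) (plain< lt) =
    ⊥-elim (<⇒≱ lt (rows-next-≤ Y (start-addable plain Y (λ _ → refl)) o))

asc⁺ : ∀ {k S₀ ev s₁ s₁′ e₁ s₂ s₂′ e₂} → Young k S₀ → Addable? S₀ ev → StateOK k S₀ s₁ →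
  Act k (S₀ ⊕? ev) ev s₁ s₁′ e₁ → Act k (S₀ ⊕? ev ⊕ˢ s₁′) e₁ s₂ s₂′ e₂ → Asc s₁ s₂ → Asc s₁′ s₂′
asc⁺ {ev = nothing} Y A ok f g = asc-none Y ok f g
asc⁺ {ev = just p}  Y A ok f g = asc-just Y A ok f g

asc⁻ : ∀ {k S₀ ev s₁ s₁′ e₁ s₂ s₂′ e₂} → Young k S₀ → Addable? S₀ ev → PlainFresh s₁ → PlainFresh s₂ →
  StateOK k S₀ s₁ → StateOK k (S₀ ⊕ˢ s₁) s₂ →
  Act k (S₀ ⊕? ev) ev s₁ s₁′ e₁ → Act k (S₀ ⊕? ev ⊕ˢ s₁′) e₁ s₂ s₂′ e₂ → Asc s₁′ s₂′ → Asc s₁ s₂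
asc⁻ {ev = nothing} Y A f f₂ ok ok₂ = desc-none Y f f₂ ok₂
asc⁻ {ev = just p}  Y A f f₂ ok ok₂ = desc-just Y A ok ok₂

-- The order of the standardization: by value, and for equal values by time, which is expressed
-- through `Asc` on the positions.
Step : ℕ × State → ℕ × State → Set
Step (x , s) (y , t) = x < y ⊎ x ≡ y × Asc s t

data Steps : List ℕ → List State → Set where
  []  : Steps [] []
  [-] : ∀ {x s} → Steps (x ∷ []) (s ∷ [])
  _∷_ : ∀ {x s y t vs ss} → Step (x , s) (y , t) → Steps (y ∷ vs) (t ∷ ss) → Steps (x ∷ y ∷ vs) (s ∷ t ∷ ss)

steps⁺ : ∀ {k S₀ ev vs ss ss′ o} → Young k S₀ → Addable? S₀ ev → Valid k S₀ ss →
  Pass k (S₀ ⊕? ev) ev ss ss′ o → Steps vs ss → Steps vs ss′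
steps⁺ Y A v [] [] = []
steps⁺ Y A v (f ∷ []) [-] = [-]
steps⁺ {k} Y A (_∷_ {s = s} ok v) (_∷_ {s′ = s′} f (g ∷ p)) (st ∷ sts) =
  go st ∷ steps⁺ (Young-⊕? (cellOf s) Y (stateAddable k s ok)) (add′ r) v (Pass-cong (sum′ r) (g ∷ p)) sts
  where
  r = acted Y A ok f
  go : Step _ _ → Step _ _
  go (inj₁ lt) = inj₁ lt
  go (inj₂ (e , a)) = inj₂ (e , asc⁺ Y A ok f g a)

steps⁻ : ∀ {k S₀ ev vs ss ss′ o} → Young k S₀ → Addable? S₀ ev → Valid k S₀ ss → All PlainFresh ss →
  Pass k (S₀ ⊕? ev) ev ss ss′ o → Steps vs ss′ → Steps vs ss
steps⁻ Y A v pf [] [] = []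
steps⁻ Y A v pf (f ∷ []) [-] = [-]
steps⁻ {k} Y A (_∷_ {s = s} ok (ok₂ ∷ v)) (x ∷ y ∷ pf) (f ∷ (g ∷ p)) (st ∷ sts) =
  go st ∷ steps⁻ (Young-⊕? (cellOf s) Y (stateAddable k s ok)) (add′ r) (ok₂ ∷ v) (y ∷ pf) (Pass-cong (sum′ r) (g ∷ p)) sts
  where
  r = acted Y A ok f
  go : Step _ _ → Step _ _
  go (inj₁ lt) = inj₁ lt
  go (inj₂ (e , a)) = inj₂ (e , asc⁻ Y A x y ok ok₂ f g a)

-- Reversing an insertion

data Placed : State → Set where
  at : ∀ {m c} → Placed (at m c)

-- RSK insertion knows plain letters only. On shifted shapes the admissible marks are already
-- governed by `MarkOK`.
Tame : Kind → State → Set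
Tame straight (at m _) = m ≡ plain
Tame _        _        = ⊤

placed-settled : ∀ {ss} → All Placed ss → All Settled ss
placed-settled []        = []
placed-settled (at ∷ ps) = at ∷ placed-settled ps

act-total : ∀ k S p {s} → Placed s → ∃₂ λ s′ p′ → Act k S (just p) s s′ (just p′)
act-total k S p (at {m} {c}) with c ≟ᶜ p
... | no ne = _ , _ , miss ne
act-total k S p (at {barred} {c}) | yes refl = _ , _ , right refl
act-total k S p (at {plain}  {c}) | yes refl with onDiagonal? k c
... | yes o = _ , _ , turn o refl
... | no ¬o = _ , _ , down ¬o refl

pass-total : ∀ k S p {ss} → All Placed ss → ∃₂ λ ss′ p′ → Pass k S (just p) ss ss′ (just p′)
pass-total k S p [] = [] , p , []
pass-total k S p (pl ∷ pls) with act-total k S p pl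
... | s′ , p′ , a with pass-total k (S ⊕ˢ s′) p′ pls
...   | ss′ , p″ , q = s′ ∷ ss′ , p″ , a ∷ q

insert-total : ∀ k S {pre post} → All Placed pre → All Placed post →
  ∃₂ λ ss′ p → Pass k S nothing (pre ++ fresh plain ∷ post) ss′ (just p)
insert-total k S {pre} ps qs with pass-total k (total S pre ⊕ start (total S pre) plain) (start (total S pre) plain) qs
... | ss′ , p , q = _ , p , pass-++⁺ (idle (placed-settled ps)) (born refl ∷ q)

infixl 6 _⊖_

_⊖_ : Shape → Cell → Shape
S ⊖ (i , j) = shape (λ r → rows S r ∸ δ i r) (λ c → cols S c ∸ δ j c)

Removable : Shape → Cell → Set
Removable S (i , j) = rows S i ≡ suc j × cols S j ≡ suc i

module _ {k : Kind} {S : Shape} (Y : Young k S) {i j : ℕ} (R : Removable S (i , j)) (o : offset k i ≤ j) where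
  private
    S⁻ = S ⊖ (i , j)

    rows-i : rows S⁻ i ≡ j
    rows-i = cong₂ _∸_ (proj₁ R) (δ-refl i)

    cols-j : cols S⁻ j ≡ i
    cols-j = cong₂ _∸_ (proj₂ R) (δ-refl j)

    rows-≢ : ∀ {r} → i ≢ r → rows S⁻ r ≡ rows S r
    rows-≢ {r} ne = cong (rows S r ∸_) (δ-≢ ne)

    cols-≢ : ∀ {c} → j ≢ c → cols S⁻ c ≡ cols S c
    cols-≢ {c} ne = cong (cols S c ∸_) (δ-≢ ne)

  ⊖-addable : Addable S⁻ (i , j)
  ⊖-addable = rows-i ⊹ cols-j

  ⊖-⊕ : S⁻ ⊕ (i , j) ≗ˢ S
  ⊖-⊕ = r & c
    where
    r : ∀ x → δ i x + (rows S x ∸ δ i x) ≡ rows S x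
    r x with i ≟ x
    ... | yes refl = trans (cong₂ _+_ (δ-refl i) rows-i) (sym (proj₁ R))
    ... | no ne = cong₂ _+_ (δ-≢ ne) (rows-≢ ne)
    c : ∀ x → δ j x + (cols S x ∸ δ j x) ≡ cols S x
    c x with j ≟ x
    ... | yes refl = trans (cong₂ _+_ (δ-refl j) cols-j) (sym (proj₂ R))
    ... | no ne = cong₂ _+_ (δ-≢ ne) (cols-≢ ne)

  Young-⊖ : Young k S⁻
  Young-⊖ = record { fits = f ; inRow = λ {x} {y} → ir x y ; off = λ {x} {y} → of x y ; inCol = λ {x} {y} → ic x y }
    where
    f : ∀ x → offset k x ≤ rows S⁻ x
    f x with i ≟ x
    ... | yes refl = subst (offset k i ≤_) (sym rows-i) o
    ... | no ne = subst (offset k x ≤_) (sym (rows-≢ ne)) (fits Y x)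
    of : ∀ x y → x < cols S⁻ y → offset k x ≤ y
    of x y lt = off Y (<-≤-trans lt (m∸n≤m (cols S y) (δ j y)))
    ir : ∀ x y → x < cols S⁻ y → y < rows S⁻ x
    ir x y lt with i ≟ x
    ... | no ne = subst (y <_) (sym (rows-≢ ne)) (inRow Y (<-≤-trans lt (m∸n≤m (cols S y) (δ j y))))
    ... | yes refl with j ≟ y
    ...   | yes refl = ⊥-elim (n≮n i (subst (i <_) cols-j lt))
    ...   | no ne = subst (y <_) (sym rows-i) (≤∧≢⇒< (≤-pred (subst (y <_) (proj₁ R) (inRow Y (subst (i <_) (cols-≢ ne) lt)))) (ne ∘ sym))
    ic : ∀ x y → offset k x ≤ y → y < rows S⁻ x → x < cols S⁻ y
    ic x y ox lt with j ≟ y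
    ... | no ne = subst (x <_) (sym (cols-≢ ne)) (inCol Y ox (<-≤-trans lt (m∸n≤m (rows S x) (δ i x))))
    ... | yes refl with i ≟ x
    ...   | yes refl = ⊥-elim (n≮n j (subst (j <_) rows-i lt))
    ...   | no ne = subst (x <_) (sym cols-j) (≤∧≢⇒< (≤-pred (subst (x <_) (proj₂ R) (inCol Y ox (subst (j <_) (rows-≢ ne) lt)))) (ne ∘ sym))

-- The last steps of an insertion, undone down to the letters of shape S: either
-- the event adding p is still on its way, or the inserted letter has been found.
data Undone (k : Kind) (S : Shape) (ss′ : List State) (p′ : Cell) (Z : Shape) : Set where
  pending : ∀ p S₀ ss → S₀ ⊕ p ≗ˢ S → Young k S₀ → Addable S₀ p → Valid k S₀ ss → All Placed ss →
            All (Tame k) ss → Pass k S (just p) ss ss′ (just p′) → total S₀ ss ≗ˢ Z → Undone k S ss′ p′ Z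
  found   : ∀ pre post → Valid k S (pre ++ fresh plain ∷ post) → All Placed pre → All Placed post →
            All (Tame k) pre → All (Tame k) post →
            Pass k S nothing (pre ++ fresh plain ∷ post) ss′ (just p′) →
            total S (pre ++ fresh plain ∷ post) ≗ˢ Z → Undone k S ss′ p′ Z

fresh-ok : ∀ {k S} → StateOK k S (fresh plain)
fresh-ok {straight} = tt
fresh-ok {shifted}  = refl

-- The letter does not stand in the cell added by the event, so the event went past it: `p` is
-- already a corner of the shape `S` of the smaller letters and can be removed there.
undo-miss : ∀ {k S Z p′ m c ss ss′ p S₁} → Young k S → Young k S₁ → StateOK k S (at m c) → Tame k (at m c) → c ≢ p →
  S₁ ⊕ p ≗ˢ S ⊕ c → Addable S₁ p → Valid k S₁ ss → All Placed ss → All (Tame k) ss →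
  Pass k (S ⊕ c) (just p) ss ss′ (just p′) → total S₁ ss ≗ˢ Z → Undone k S (at m c ∷ ss′) p′ Z
undo-miss {k} {S} {m = m} {c = c@(i , j)} {ss} {p = p@(i₁ , j₁)} {S₁} Y Y₁ ok t ne e A v pl ts q tot =
  pending p S₀ (at m c ∷ ss) (⊖-⊕ Y R o) (Young-⊖ Y R o) (⊖-addable Y R o)
    (stateAt {k} {m = m} C (stateMark {k} {m = m} ok) ∷ Valid-cong (≗-sym S₀c) v) (at ∷ pl) (t ∷ ts)
    (miss ne ∷ q) (≗-trans (total-cong ss S₀c) tot)
  where
  C′ = stateCell {k} {m = m} ok
  rp : rows (S ⊕ c) i₁ ≡ suc j₁
  rp = trans (sym (rows-≗ e i₁)) (rows-after Y₁ A)
  cp : cols (S ⊕ c) j₁ ≡ suc i₁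
  cp = trans (sym (cols-≗ e j₁)) (cols-after Y₁ A)
  -- Both `c` and `p` are the last cells of their row and column in `S ⊕ c`; sharing a line would
  -- make them equal.
  i≢ : i ≢ i₁
  i≢ refl = ne (cong (i ,_) (suc-injective (trans (sym (rows-after Y C′)) rp)))
  j≢ : j ≢ j₁
  j≢ refl = ne (cong (_, j) (suc-injective (trans (sym (cols-after Y C′)) cp)))
  R : Removable S p
  R = trans (sym (rows-other S i j i≢)) rp , trans (sym (cols-other S i j j≢)) cp
  o = addable-off Y₁ A
  S₀ = S ⊖ p
  C : Addable S₀ c
  C = trans (cong (rows S i ∸_) (δ-≢ (i≢ ∘ sym))) (rowEq C′) ⊹ trans (cong (cols S j ∸_) (δ-≢ (j≢ ∘ sym))) (colEq C′)
  S₀c : S₀ ⊕ c ≗ˢ S₁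
  S₀c = ⊕-cancel p (≗-trans (⊕-comm {S₀} c p) (≗-trans (⊕-cong c (⊖-⊕ Y R o)) (≗-sym e)))

-- A letter standing in the added cell has just arrived. In row 0 a plain letter has just been born;
-- in a lower row it came from the end of the row above. A barred letter came from the end of the
-- column to the left.
undo-hit : ∀ {k S Z p′ m c ss ss′} → Young k S → StateOK k S (at m c) → Tame k (at m c) →
  Valid k S ss → All Placed ss → All (Tame k) ss →
  Pass k (S ⊕ c) (just c) ss ss′ (just p′) → total S ss ≗ˢ Z → Undone k S (at m c ∷ ss′) p′ Z
undo-hit {k} {S} {m = plain} {zero , j} {ss} Y ok t v pl ts q tot =
  found [] ss (fresh-ok ∷ v) [] pl [] ts (born (cong (0 ,_) (sym (rowEq (stateCell {k} {m = plain} ok)))) ∷ q) tot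
undo-hit {k} {S} {m = plain} {suc i , j} {ss} Y ok t v pl ts q tot =
  pending p (S ⊖ p) (at plain p ∷ ss) back (Young-⊖ Y R o) P
    (stateAt {k} {m = plain} P tt ∷ Valid-cong (≗-sym back) v) (at ∷ pl) (tame k ∷ ts)
    (down nd (cong (suc i ,_) (sym (rowEq C))) ∷ q) (≗-trans (total-cong ss back) tot)
  where
  C = stateCell {k} {m = plain} ok
  l = pred (rows S i)
  p = i , l
  j<r : j < rows S i
  j<r = inRow Y (subst (i <_) (sym (colEq C)) ≤-refl)
  r≡ : rows S i ≡ suc l
  r≡ = sym (suc-pred (rows S i) {{>-nonZero (≤-<-trans z≤n j<r)}})
  j≤l : j ≤ l
  j≤l = ≤-pred (subst (j <_) r≡ j<r)
  o : offset k i ≤ l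
  o = ≤-trans (offset-mono k (n≤1+n i)) (≤-trans (addable-off Y C) j≤l)
  R : Removable S p
  R = r≡ , ≤-antisym (≮⇒≥ λ lt → <⇒≱ (subst (l <_) (rowEq C) (inRow Y lt)) j≤l) (inCol Y o (subst (l <_) (sym r≡) ≤-refl))
  back = ⊖-⊕ Y R o
  P = ⊖-addable Y R o
  nd : ¬ OnDiagonal k p
  nd d with onDiagonal {k} d
  ... | e , refl = <⇒≱ (addable-off Y C) (≤-trans j≤l (≤-reflexive (sym e)))
  tame : ∀ k → Tame k (at plain p)
  tame straight = refl
  tame shifted  = tt
undo-hit {straight} {m = barred} Y ok () v pl ts q tot
undo-hit {shifted} {S} {m = barred} {i , zero} Y ok t v pl ts q tot =
  ⊥-elim (stateMark {shifted} {m = barred} ok (n≤0⇒n≡0 (addable-off Y (stateCell {shifted} {m = barred} ok))))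
undo-hit {shifted} {S} {Z} {p′} {m = barred} {i , suc j} {ss} {ss′} Y ok t v pl ts q tot = go (l ≟ j)
  where
  C = stateCell {shifted} {m = barred} ok
  l = pred (cols S j)
  p = l , j
  i≤j : i ≤ j
  i≤j = ≤-pred (≤∧≢⇒< (addable-off Y C) (stateMark {shifted} {m = barred} ok))
  i<c : i < cols S j
  i<c = inCol Y i≤j (subst (j <_) (sym (rowEq C)) ≤-refl)
  c≡ : cols S j ≡ suc l
  c≡ = sym (suc-pred (cols S j) {{>-nonZero (≤-<-trans z≤n i<c)}})
  i≤l : i ≤ l
  i≤l = ≤-pred (subst (i <_) c≡ i<c)
  l<c : l < cols S j
  l<c = subst (l <_) (sym c≡) ≤-refl
  o : l ≤ j
  o = off Y l<c
  R : Removable S p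
  R = ≤-antisym (≮⇒≥ λ lt → <⇒≱ (subst (l <_) (colEq C) (inCol Y (≤-trans o (n≤1+n j)) lt)) i≤l) (inRow Y l<c) , c≡
  back = ⊖-⊕ Y R o
  P = ⊖-addable Y R o
  e : (i , suc j) ≡ colEnd S (suc j)
  e = cong (_, suc j) (sym (colEq C))
  -- If the previous column ends on the diagonal, the letter was plain there and turned; otherwise
  -- it was barred before.
  go : Dec (l ≡ j) → Undone shifted S (at barred (i , suc j) ∷ ss′) p′ Z
  go (yes d) = pending p (S ⊖ p) (at plain p ∷ ss) back (Young-⊖ Y R o) P
    (stateAt {shifted} {m = plain} P tt ∷ Valid-cong (≗-sym back) v) (at ∷ pl) (tt ∷ ts)
    (turn d e ∷ q) (≗-trans (total-cong ss back) tot)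
  go (no nd) = pending p (S ⊖ p) (at barred p ∷ ss) back (Young-⊖ Y R o) P
    (stateAt {shifted} {m = barred} P nd ∷ Valid-cong (≗-sym back) v) (at ∷ pl) (tt ∷ ts)
    (right e ∷ q) (≗-trans (total-cong ss back) tot)

-- The larger letters are undone first: they reveal the event that must have reached them, and this
-- decides about the current letter.
undo : ∀ {k S Z p′} ss′ → Young k S → Valid k S ss′ → All Placed ss′ → All (Tame k) ss′ →
       total S ss′ ≗ˢ Z ⊕ p′ → Young k Z → Addable Z p′ → Undone k S ss′ p′ Z
undo [] Y v pl ts tot YZ A = pending _ _ [] (≗-sym tot) YZ A [] [] [] [] ≗-refl
undo {k} (at m c ∷ ss′) Y (ok ∷ v) (at ∷ pl) (t ∷ ts) tot YZ A
  with undo ss′ (Young-⊕ Y (stateCell {k} {m = m} ok)) v pl ts tot YZ A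
... | found pre post v′ pl₁ pl₂ t₁ t₂ q tot′ = found (at m c ∷ pre) post (ok ∷ v′) (at ∷ pl₁) pl₂ (t ∷ t₁) t₂ (still ∷ q) tot′
... | pending p S₁ ss e Y₁ P v′ pl′ ts′ q tot′ with c ≟ᶜ p
...   | no ne = undo-miss Y Y₁ ok t ne e P v′ pl′ ts′ q tot′
...   | yes refl = undo-hit Y ok t (Valid-cong S₁≗ v′) pl′ ts′ q (≗-trans (≗-sym (total-cong ss S₁≗)) tot′)
  where S₁≗ = ⊕-cancel c e

undo-insert : ∀ {k Z p′} ss′ → Valid k (∅ k) ss′ → All Placed ss′ → All (Tame k) ss′ →
  total (∅ k) ss′ ≗ˢ Z ⊕ p′ → Young k Z → Addable Z p′ →
  ∃₂ λ pre post → Valid k (∅ k) (pre ++ fresh plain ∷ post) × All Placed pre × All Placed post ×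
    All (Tame k) pre × All (Tame k) post ×
    Pass k (∅ k) nothing (pre ++ fresh plain ∷ post) ss′ (just p′) × total (∅ k) (pre ++ fresh plain ∷ post) ≗ˢ Z
undo-insert {k} ss′ v pl ts tot YZ A with undo ss′ (Young-∅ k) v pl ts tot YZ A
... | found pre post v′ pl₁ pl₂ t₁ t₂ q tot′ = pre , post , v′ , pl₁ , pl₂ , t₁ , t₂ , q , tot′
-- An event pending below all letters would be a cell of the empty shape, so the inserted letter has
-- been found.
... | pending (i , j) S₀ ss e Y₀ P _ _ _ _ _ =
  ⊥-elim (<⇒≱ (subst (_≤ offset k i) (trans (sym (rows-≗ e i)) (rows-same S₀ i j)) ≤-refl) (fits Y₀ i))

-- The row or column a letter has reached names the one it left, and the common shape after the
-- event gives the cell at its end. `right` and `turn` are kept apart because no barred letter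
-- stands on the diagonal.
act-back : ∀ {k S₀ S₁ ev ev₁ s s₁ s′ e} → Young k S₀ → Addable? S₀ ev → StateOK k S₀ s →
  Young k S₁ → Addable? S₁ ev₁ → StateOK k S₁ s₁ → S₀ ⊕? ev ≗ˢ S₁ ⊕? ev₁ →
  Act k (S₀ ⊕? ev) ev s s′ e → Act k (S₁ ⊕? ev₁) ev₁ s₁ s′ e → ev ≡ ev₁ × s ≡ s₁
act-back {k} {S₀} {S₁} Y A ok Y₁ A₁ ok₁ e f g = go f g A A₁ ok ok₁ e
  where
  same-row : ∀ {i j j₁} → Addable S₀ (i , j) → Addable S₁ (i , j₁) → S₀ ⊕ (i , j) ≗ˢ S₁ ⊕ (i , j₁) → j ≡ j₁
  same-row A A₁ e = suc-injective (trans (sym (rows-after Y A)) (trans (rows-≗ e _) (rows-after Y₁ A₁)))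
  same-col : ∀ {i i₁ j} → Addable S₀ (i , j) → Addable S₁ (i₁ , j) → S₀ ⊕ (i , j) ≗ˢ S₁ ⊕ (i₁ , j) → i ≡ i₁
  same-col A A₁ e = suc-injective (trans (sym (cols-after Y A)) (trans (cols-≗ e _) (cols-after Y₁ A₁)))
  go : ∀ {ev ev₁ s s₁ s′ e′} → Act k (S₀ ⊕? ev) ev s s′ e′ → Act k (S₁ ⊕? ev₁) ev₁ s₁ s′ e′ →
       Addable? S₀ ev → Addable? S₁ ev₁ → StateOK k S₀ s → StateOK k S₁ s₁ → S₀ ⊕? ev ≗ˢ S₁ ⊕? ev₁ → ev ≡ ev₁ × s ≡ s₁
  go none none _ _ _ _ _ = refl , refl
  go (born x) (born y) _ _ _ _ _ = refl , refl
  go (born x) (miss ne) _ _ _ _ _ = ⊥-elim (ne refl)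
  go (born x) (down o y) _ _ _ _ _ = ⊥-elim (0≢1+n (cong proj₁ (trans (sym x) y)))
  go (born x) (right y) _ _ _ _ _ = ⊥-elim (0≢1+n (cong proj₂ (trans (sym x) y)))
  go (born x) (turn o y) _ _ _ _ _ = ⊥-elim (0≢1+n (cong proj₂ (trans (sym x) y)))
  go still still _ _ _ _ _ = refl , refl
  go (miss ne) (born x) _ _ _ _ _ = ⊥-elim (ne refl)
  go (miss ne) (miss _) _ _ _ _ _ = refl , refl
  go (miss ne) (down _ _) _ _ _ _ _ = ⊥-elim (ne refl)
  go (miss ne) (right _) _ _ _ _ _ = ⊥-elim (ne refl)
  go (miss ne) (turn _ _) _ _ _ _ _ = ⊥-elim (ne refl)
  go (down o x) (born y) _ _ _ _ _ = ⊥-elim (0≢1+n (sym (cong proj₁ (trans (sym x) y))))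
  go (down o x) (miss ne) _ _ _ _ _ = ⊥-elim (ne refl)
  go (down o x) (down o′ y) A A₁ _ _ e with cong proj₁ (trans (sym x) y)
  ... | refl with same-row A A₁ e
  ...   | refl = refl , refl
  go (right x) (born y) _ _ _ _ _ = ⊥-elim (0≢1+n (sym (cong proj₂ (trans (sym x) y))))
  go (right x) (miss ne) _ _ _ _ _ = ⊥-elim (ne refl)
  go (right x) (right y) A A₁ _ _ e with cong proj₂ (trans (sym x) y)
  ... | refl with same-col A A₁ e
  ...   | refl = refl , refl
  go (right x) (turn o y) A A₁ ok ok₁ e with cong proj₂ (trans (sym x) y)
  ... | refl with same-col A A₁ e
  ...   | refl = ⊥-elim (stateMark {k} {m = barred} ok o)
  go (turn o x) (born y) _ _ _ _ _ = ⊥-elim (0≢1+n (sym (cong proj₂ (trans (sym x) y))))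
  go (turn o x) (miss ne) _ _ _ _ _ = ⊥-elim (ne refl)
  go (turn o x) (right y) A A₁ ok ok₁ e with cong proj₂ (trans (sym x) y)
  ... | refl with same-col A A₁ e
  ...   | refl = ⊥-elim (stateMark {k} {m = barred} ok₁ o)
  go (turn o x) (turn o′ y) A A₁ _ _ e with cong proj₂ (trans (sym x) y)
  ... | refl with same-col A A₁ e
  ...   | refl = refl , refl

pass-back : ∀ {k S₀ S₁ ev ev₁ ss ss₁ ss′ o} → Young k S₀ → Addable? S₀ ev → Valid k S₀ ss →
  Young k S₁ → Addable? S₁ ev₁ → Valid k S₁ ss₁ → S₀ ⊕? ev ≗ˢ S₁ ⊕? ev₁ →
  Pass k (S₀ ⊕? ev) ev ss ss′ o → Pass k (S₁ ⊕? ev₁) ev₁ ss₁ ss′ o → ev ≡ ev₁ × ss ≡ ss₁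
pass-back Y A v Y₁ A₁ v₁ e [] [] = refl , refl
pass-back {k} Y A (_∷_ {s = s} ok v) Y₁ A₁ (_∷_ {s = s₁} ok₁ v₁) e (_∷_ {s′ = s′} f p) (g ∷ q)
  with acted Y A ok f | acted Y₁ A₁ ok₁ g
... | r | r₁ with pass-back (Young-⊕? (cellOf s) Y (stateAddable k s ok)) (add′ r) v
                   (Young-⊕? (cellOf s₁) Y₁ (stateAddable k s₁ ok₁)) (add′ r₁) v₁
                   (≗-trans (≗-sym (sum′ r)) (≗-trans (⊕?-cong (cellOf s′) e) (sum′ r₁)))
                   (Pass-cong (sum′ r) p) (Pass-cong (sum′ r₁) q)
...   | refl , refl with act-back Y A ok Y₁ A₁ ok₁ e f g
...     | refl , refl = refl , refl

-- Placing a letter at the end of a row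

snocRow : ∀ {A : Set} → ℕ → A → Filling A → Filling A
snocRow i       y []      = (y ∷ []) ∷ []
snocRow zero    y (r ∷ T) = (r ∷ʳ y) ∷ T
snocRow (suc i) y (r ∷ T) = r ∷ snocRow i y T

rowLen : ∀ {A : Set} → Filling A → ℕ → ℕ
rowLen []      i       = 0
rowLen (r ∷ T) zero    = length r
rowLen (r ∷ T) (suc i) = rowLen T i

AllLetters : ∀ {A : Set} → (A → Set) → Filling A → Set
AllLetters P = All (All P)

allLetters-snoc : ∀ {A : Set} {P : A → Set} i {y} {T : Filling A} → P y → AllLetters P T → AllLetters P (snocRow i y T)
allLetters-snoc i       py []       = (py ∷ []) ∷ []
allLetters-snoc zero    py (r ∷ rs) = All.++⁺ r (py ∷ []) ∷ rs
allLetters-snoc (suc i) py (r ∷ rs) = r ∷ allLetters-snoc i py rs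

rowLen-snoc-same : ∀ {A : Set} i (y : A) T → i ≤ length T → rowLen (snocRow i y T) i ≡ suc (rowLen T i)
rowLen-snoc-same zero    y []      _ = refl
rowLen-snoc-same zero    y (r ∷ T) _ = trans (length-++ r) (+-comm (length r) 1)
rowLen-snoc-same (suc i) y (r ∷ T) (s≤s le) = rowLen-snoc-same i y T le

rowLen-snoc-other : ∀ {A : Set} i (y : A) T {r} → i ≤ length T → i ≢ r → rowLen (snocRow i y T) r ≡ rowLen T r
rowLen-snoc-other zero    y []      {zero}  _ ne = ⊥-elim (ne refl)
rowLen-snoc-other zero    y []      {suc r} _ ne = refl
rowLen-snoc-other zero    y (_ ∷ T) {zero}  _ ne = ⊥-elim (ne refl)
rowLen-snoc-other zero    y (_ ∷ T) {suc r} _ ne = refl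
rowLen-snoc-other (suc i) y (_ ∷ T) {zero}  _ ne = refl
rowLen-snoc-other (suc i) y (_ ∷ T) {suc r} (s≤s le) ne = rowLen-snoc-other i y T le (ne ∘ cong suc)

rowLen-< : ∀ {A : Set} (T : Filling A) i → 0 < rowLen T i → i < length T
rowLen-< (r ∷ T) zero    lt = z<s
rowLen-< (r ∷ T) (suc i) lt = s<s (rowLen-< T i lt)

shape-rowLen : ∀ {A B : Set} (T : Filling A) (U : Filling B) → shapeᵗ T ≡ shapeᵗ U → ∀ i → rowLen T i ≡ rowLen U i
shape-rowLen []      []      e i       = refl
shape-rowLen (r ∷ T) (q ∷ U) e zero    = ∷-injectiveˡ e
shape-rowLen (r ∷ T) (q ∷ U) e (suc i) = shape-rowLen T U (∷-injectiveʳ e) i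

shape-length : ∀ {A B : Set} (T : Filling A) (U : Filling B) → shapeᵗ T ≡ shapeᵗ U → length T ≡ length U
shape-length []      []      e = refl
shape-length (r ∷ T) (q ∷ U) e = cong suc (shape-length T U (∷-injectiveʳ e))

length-snoc : ∀ {A : Set} (r : List A) y → length (r ∷ʳ y) ≡ suc (length r)
length-snoc r y = trans (length-++ r) (+-comm (length r) 1)

shape-snoc : ∀ {A B : Set} i (y : A) (z : B) T U → shapeᵗ T ≡ shapeᵗ U → shapeᵗ (snocRow i y T) ≡ shapeᵗ (snocRow i z U)
shape-snoc i       y z []      []      e = refl
shape-snoc zero    y z (r ∷ T) (q ∷ U) e =
  cong₂ _∷_ (trans (length-snoc r y) (trans (cong suc (∷-injectiveˡ e)) (sym (length-snoc q z)))) (∷-injectiveʳ e)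
shape-snoc (suc i) y z (r ∷ T) (q ∷ U) e = cong₂ _∷_ (∷-injectiveˡ e) (shape-snoc i y z T U (∷-injectiveʳ e))

size-snoc : ∀ {A : Set} i (y : A) T → size (snocRow i y T) ≡ suc (size T)
size-snoc i       y []      = refl
size-snoc zero    y (r ∷ T) = begin
  length ((r ∷ʳ y) ++ concat T)        ≡⟨ length-++ (r ∷ʳ y) ⟩
  length (r ∷ʳ y) + length (concat T)  ≡⟨ cong (_+ length (concat T)) (length-snoc r y) ⟩
  suc (length r + length (concat T))   ≡⟨ cong suc (sym (length-++ r)) ⟩
  suc (length (r ++ concat T))         ∎
  where open ≡-Reasoning
size-snoc (suc i) y (r ∷ T) = begin
  length (r ++ concat (snocRow i y T))        ≡⟨ length-++ r ⟩
  length r + size (snocRow i y T)             ≡⟨ cong (length r +_) (size-snoc i y T) ⟩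
  length r + suc (size T)                     ≡⟨ +-suc (length r) (size T) ⟩
  suc (length r + size T)                     ≡⟨ cong suc (sym (length-++ r)) ⟩
  suc (length (r ++ concat T))                ∎
  where open ≡-Reasoning

-- Row insertion

≺-yes : ∀ {x y} → x ≺ y → does (x ≺? y) ≡ true
≺-yes {x} {y} lt = dec-true (x ≺? y) lt

≺-no : ∀ {x y} → ¬ x ≺ y → does (x ≺? y) ≡ false
≺-no {x} {y} ¬lt = dec-false (x ≺? y) ¬lt

module _ (x : X′) where

  private
    bump? : List X′ → List X′ × Maybe (ℕ × X′)
    bump? = rowBump _≺?_ x

  rowBump-stop : ∀ {r} → All (_≼ x) r → bump? r ≡ (r ∷ʳ x , nothing)
  rowBump-stop [] = refl
  rowBump-stop {y ∷ r} (le ∷ les) rewrite ≺-no {x} {y} (≤⇒≯ le) | rowBump-stop les = refl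

  rowBump-end : ∀ {r y} → All (_≼ x) r → x ≺ y → bump? (r ∷ʳ y) ≡ (r ∷ʳ x , just (length r , y))
  rowBump-end {[]} {y} [] lt rewrite ≺-yes {x} {y} lt = refl
  rowBump-end {z ∷ r} {y} (le ∷ les) lt rewrite ≺-no {x} {z} (≤⇒≯ le) | rowBump-end {r} {y} les lt = refl

  rowBump-snoc : ∀ r {r′ n a y} → bump? r ≡ (r′ , just (n , a)) → bump? (r ∷ʳ y) ≡ (r′ ∷ʳ y , just (n , a))
  rowBump-snoc (z ∷ r) e with does (x ≺? z)
  rowBump-snoc (z ∷ r) refl | true = refl
  ... | false with rowBump _≺?_ x r in eq
  rowBump-snoc (z ∷ r) {y = y} refl | false | r″ , just (n , a) rewrite rowBump-snoc r {y = y} eq = refl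

  putAt-snoc-bump : ∀ j r {r′ b y} → putAt j x r ≡ just (r′ , just b) → putAt j x (r ∷ʳ y) ≡ just (r′ ∷ʳ y , just b)
  putAt-snoc-bump zero (z ∷ r) e with does (x ≺? z)
  putAt-snoc-bump zero (z ∷ r) refl | true = refl
  putAt-snoc-bump (suc j) (z ∷ r) e with putAt j x r in eq
  putAt-snoc-bump (suc j) (z ∷ r) {y = y} refl | just (r″ , just b) rewrite putAt-snoc-bump j r {y = y} eq = refl

  putAt-snoc-nothing : ∀ j r {y} → putAt j x r ≡ nothing → putAt j x (r ∷ʳ y) ≡ nothing
  putAt-snoc-nothing zero (z ∷ r) e with does (x ≺? z)
  ... | false = refl
  putAt-snoc-nothing (suc j) (z ∷ r) {y} e with putAt j x r in eq
  ... | nothing rewrite putAt-snoc-nothing j r {y} eq = refl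

  putAt-nothing : ∀ {j r} → All (_≼ x) r → j < length r → putAt j x r ≡ nothing
  putAt-nothing {zero}  {z ∷ r} (le ∷ les) lt rewrite ≺-no {x} {z} (≤⇒≯ le) = refl
  putAt-nothing {suc j} {z ∷ r} (le ∷ les) (s≤s lt) rewrite putAt-nothing les lt = refl

  putAt-stop : ∀ r → putAt (length r) x r ≡ just (r ∷ʳ x , nothing)
  putAt-stop []      = refl
  putAt-stop (z ∷ r) rewrite putAt-stop r = refl

  putAt-end : ∀ r {y} → x ≺ y → putAt (length r) x (r ∷ʳ y) ≡ just (r ∷ʳ x , just y)
  putAt-end []      {y} lt rewrite ≺-yes {x} {y} lt = refl
  putAt-end (z ∷ r) {y} lt rewrite putAt-end r {y} lt = refl

-- `x` goes to the end of the row with the last index. Column numbers are relative to the first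
-- listed row and drop by one per row, as in `insertColumn`.
data Stop (x : X′) : Line → Filling X′ → ℕ → Set where
  row-[]    : Stop x (row 0) [] 0
  row-here  : ∀ {r T} → All (_≼ x) r → Stop x (row 0) (r ∷ T) 0
  row-there : ∀ {i r T} → Stop x (row i) T i → Stop x (row (suc i)) (r ∷ T) (suc i)
  col-here  : ∀ {r T} → Stop x (col (length r)) (r ∷ T) 0
  col-there : ∀ {c i r T} → putAt (suc c) x r ≡ nothing → Stop x (col c) T i → Stop x (col (suc c)) (r ∷ T) (suc i)

insertRow-stop : ∀ {x i T} → Stop x (row i) T i → insertRow i x T ≡ (snocRow i x T , nothing)
insertRow-stop row-[] = refl
insertRow-stop {x} (row-here a) rewrite rowBump-stop x a = refl
insertRow-stop (row-there s) rewrite insertRow-stop s = refl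

insertColumn-stop : ∀ {x c i T} → Stop x (col c) T i → insertColumn c x T ≡ (snocRow i x T , nothing)
insertColumn-stop {x} (col-here {r}) rewrite putAt-stop x r = refl
insertColumn-stop (col-there e s) rewrite e | insertColumn-stop s = refl

stop-row : ∀ {x i j T} → Stop x (row i) T j → j ≡ i
stop-row row-[]        = refl
stop-row (row-here _)  = refl
stop-row (row-there s) = refl

insertLine-stop : ∀ {x ℓ i T} → Stop x ℓ T i → insertLine ℓ x T ≡ (snocRow i x T , nothing)
insertLine-stop {ℓ = row i} s with stop-row s
... | refl rewrite insertRow-stop s = refl
insertLine-stop {ℓ = col c} s rewrite insertColumn-stop s = refl

stop-snoc : ∀ {x ℓ T i} i′ y → Stop x ℓ T i → i′ ≤ length T → i ≢ i′ → Stop x ℓ (snocRow i′ y T) i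
stop-snoc zero     y row-[]       le ne = ⊥-elim (ne refl)
stop-snoc zero     y (row-here a) le ne = ⊥-elim (ne refl)
stop-snoc (suc i′) y (row-here a) le ne = row-here a
stop-snoc zero     y (row-there s) le ne = row-there s
stop-snoc (suc i′) y (row-there s) (s≤s le) ne = row-there (stop-snoc i′ y s le (ne ∘ cong suc))
stop-snoc zero     y col-here le ne = ⊥-elim (ne refl)
stop-snoc (suc i′) y col-here le ne = col-here
stop-snoc {x} zero y (col-there {r = r} e s) le ne = col-there (putAt-snoc-nothing x _ r e) s
stop-snoc (suc i′) y (col-there e s) (s≤s le) ne = col-there e (stop-snoc i′ y s le (ne ∘ cong suc))

snoc-comm : ∀ {A : Set} i i′ (y z : A) T → i ≤ length T → i′ ≤ length T → i ≢ i′ →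
            snocRow i y (snocRow i′ z T) ≡ snocRow i′ z (snocRow i y T)
snoc-comm zero    zero     y z T       le le′ ne = ⊥-elim (ne refl)
snoc-comm zero    (suc i′) y z (r ∷ T) le le′ ne = refl
snoc-comm (suc i) zero     y z (r ∷ T) le le′ ne = refl
snoc-comm (suc i) (suc i′) y z (r ∷ T) (s≤s le) (s≤s le′) ne = cong (r ∷_) (snoc-comm i i′ y z T le le′ (ne ∘ cong suc))

stop-≤ : ∀ {x ℓ T i} → Stop x ℓ T i → i ≤ length T
stop-≤ row-[]          = z≤n
stop-≤ (row-here _)    = z≤n
stop-≤ (row-there s)   = s≤s (stop-≤ s)
stop-≤ col-here        = z≤n
stop-≤ (col-there _ s) = s≤s (stop-≤ s)

stopCell : ∀ {A : Set} → Filling A → ℕ → Cell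
stopCell T i = i , i + rowLen T i

stop-col : ∀ {x c T i} → Stop x (col c) T i → c ≡ i + rowLen T i
stop-col col-here        = refl
stop-col (col-there e s) = cong suc (stop-col s)

insertRow-end : ∀ {x y i T} → Stop x (row i) T i → x ≺ y →
                insertRow i x (snocRow i y T) ≡ (snocRow i x T , just (rowLen T i , y))
insertRow-end {x} {y} row-[] lt rewrite ≺-yes {x} {y} lt = refl
insertRow-end {x} {y} (row-here a) lt rewrite rowBump-end x {y = y} a lt = refl
insertRow-end {x} {y} (row-there s) lt rewrite insertRow-end {y = y} s lt = refl

insertColumn-end : ∀ {x y c i T} → Stop x (col c) T i → x ≺ y →
                   insertColumn c x (snocRow i y T) ≡ (snocRow i x T , just (i , y))
insertColumn-end {x} {y} (col-here {r}) lt rewrite putAt-end x r {y} lt = refl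
insertColumn-end {x} {y} (col-there {r = r} e s) lt rewrite e | insertColumn-end {y = y} s lt = refl

insertLine-end : ∀ {x y ℓ i T} → Stop x ℓ T i → x ≺ y →
                 insertLine ℓ x (snocRow i y T) ≡ (snocRow i x T , just (stopCell T i , y))
insertLine-end {y = y} {ℓ = row i} s lt with stop-row s
... | refl rewrite insertRow-end {y = y} s lt = refl
insertLine-end {y = y} {ℓ = col c} s lt rewrite insertColumn-end {y = y} s lt = cong (λ c → _ , just ((_ , c) , _)) (stop-col s)

insertRow-snoc : ∀ {x T₁ b} i i′ y T → insertRow i x T ≡ (T₁ , just b) →
                 insertRow i x (snocRow i′ y T) ≡ (snocRow i′ y T₁ , just b)
insertRow-snoc {x} zero zero y (r ∷ T) e with rowBump _≺?_ x r in eq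
insertRow-snoc {x} zero zero y (r ∷ T) refl | r′ , just b rewrite rowBump-snoc x r {y = y} eq = refl
insertRow-snoc {x} zero (suc i′) y (r ∷ T) e with rowBump _≺?_ x r
insertRow-snoc {x} zero (suc i′) y (r ∷ T) refl | r′ , just b = refl
insertRow-snoc {x} (suc i) zero y (r ∷ T) e with insertRow i x T
insertRow-snoc {x} (suc i) zero y (r ∷ T) refl | T′ , just b = refl
insertRow-snoc {x} (suc i) (suc i′) y (r ∷ T) e with insertRow i x T in eq
insertRow-snoc {x} (suc i) (suc i′) y (r ∷ T) refl | T′ , just b rewrite insertRow-snoc i i′ y T eq = refl

insertColumn-snoc : ∀ {x T₁ b} c i′ y T → insertColumn c x T ≡ (T₁ , just b) →
                    insertColumn c x (snocRow i′ y T) ≡ (snocRow i′ y T₁ , just b)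
insertColumn-snoc {x} c zero y (r ∷ T) e with putAt c x r in eq
insertColumn-snoc {x} c zero y (r ∷ T) refl | just (r′ , just b) rewrite putAt-snoc-bump x c r {y = y} eq = refl
insertColumn-snoc {x} (suc c) zero y (r ∷ T) e | nothing rewrite putAt-snoc-nothing x (suc c) r {y} eq with insertColumn c x T
insertColumn-snoc {x} (suc c) zero y (r ∷ T) refl | nothing | T′ , just b = refl
insertColumn-snoc {x} c (suc i′) y (r ∷ T) e with putAt c x r
insertColumn-snoc {x} c (suc i′) y (r ∷ T) refl | just (r′ , just b) = refl
insertColumn-snoc {x} (suc c) (suc i′) y (r ∷ T) e | nothing with insertColumn c x T in eq
insertColumn-snoc {x} (suc c) (suc i′) y (r ∷ T) refl | nothing | T′ , just b rewrite insertColumn-snoc c i′ y T eq = refl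

insertLine-snoc : ∀ {x T₁ d a} ℓ i′ y T → insertLine ℓ x T ≡ (T₁ , just (d , a)) →
                  insertLine ℓ x (snocRow i′ y T) ≡ (snocRow i′ y T₁ , just (d , a))
insertLine-snoc {x} (row i) i′ y T e with insertRow i x T in eq
insertLine-snoc {x} (row i) i′ y T refl | T′ , just b rewrite insertRow-snoc i i′ y T eq = refl
insertLine-snoc {x} (col c) i′ y T e with insertColumn c x T in eq
insertLine-snoc {x} (col c) i′ y T refl | T′ , just b rewrite insertColumn-snoc c i′ y T eq = refl

-- Mixed insertion

-- The insertion of x into T along the line ℓ ends with z in cell p.
data MixInto : Line → X′ → Filling X′ → Filling X′ → Cell → X′ → ℕ → Set where
  stop : ∀ {ℓ x T i} → Stop x ℓ T i → MixInto ℓ x T (snocRow i x T) (stopCell T i) x 1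
  bump : ∀ {ℓ x T T₁ T′ d a p z n} → insertLine ℓ x T ≡ (T₁ , just (d , a)) → shapeᵗ T₁ ≡ shapeᵗ T →
         MixInto (proj₁ (redirect d a)) (proj₂ (redirect d a)) T₁ T′ p z n → MixInto ℓ x T T′ p z (suc n)

insertSteps-≡ : ∀ {ℓ x T T′ p z n m} → MixInto ℓ x T T′ p z n → n ≤ m → insertSteps m ℓ x T ≡ T′
insertSteps-≡ (stop s) (s≤s _) rewrite insertLine-stop s = refl
insertSteps-≡ (bump e _ i) (s≤s le) rewrite e = insertSteps-≡ i le

-- An entry appended to a row stands behind every entry that was bumped without it; it can matter
-- only where the insertion stops.
mix-miss : ∀ {ℓ x T T′ p z n} i y → MixInto ℓ x T T′ p z n → i ≤ length T → proj₁ p ≢ i →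
           MixInto ℓ x (snocRow i y T) (snocRow i y T′) p z n
mix-miss {T = T} i y (stop {ℓ = ℓ} {x = x} {i = i₁} s) le ne = subst₂ (λ U p → MixInto ℓ x (snocRow i y T) U p x 1)
  (snoc-comm i₁ i x y T (stop-≤ s) le ne) (cong (λ l → i₁ , i₁ + l) (rowLen-snoc-other i y T le (ne ∘ sym)))
  (stop (stop-snoc i y s le ne))
mix-miss {T = T} i y (bump {T₁ = T₁} e sh m) le ne = bump (insertLine-snoc _ i y T e) (shape-snoc i y y T₁ T sh)
  (mix-miss i y m (subst (i ≤_) (sym (shape-length T₁ T sh)) le) ne)

-- The former last letter `z` now finds `y` in its place, and the insertion continues by one bump.
-- With `mix-miss` this translates one step of a pass.
mix-hit : ∀ {ℓ x T T′ p z n i ℓ′ y y′ i′} → MixInto ℓ x T T′ p z n → p ≡ stopCell T i → z ≺ y →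
          redirect p y ≡ (ℓ′ , y′) → Stop y′ ℓ′ T′ i′ →
          MixInto ℓ x (snocRow i y T) (snocRow i′ y′ T′) (stopCell T′ i′) y′ (suc n)
mix-hit {T = T} {y = y} (stop {x = x} {i = i} s) refl lt red s′ = bump (insertLine-end {y = y} s lt) (shape-snoc i x y T T refl)
  (subst (λ q → MixInto (proj₁ q) (proj₂ q) (snocRow i x T) _ _ _ 1) (sym red) (stop s′))
mix-hit {T = T} {i = i} {y = y} (bump {T₁ = T₁} e sh m) q lt red s′ = bump (insertLine-snoc _ i y T e) (shape-snoc i y y T₁ T sh)
  (mix-hit m (trans q (cong (λ l → i , i + l) (shape-rowLen T T₁ (sym sh) i))) lt red s′)

-- RSK insertion

-- RSK insertion over the alphabet `X′`, so that the lemmas on row bumping serve both insertion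
-- procedures.
rskInsert′ : X′ → Filling X′ → Filling X′
rskInsert′ x []      = (x ∷ []) ∷ []
rskInsert′ x (r ∷ T) with rowBump _≺?_ x r
... | r′ , nothing      = r′ ∷ T
... | r′ , just (_ , a) = r′ ∷ rskInsert′ a T

unprime : Filling ℕ → Filling X′
unprime = map (map unprimed)

unprimed-<? : ∀ x y → does (unprimed x ≺? unprimed y) ≡ does (x <? y)
unprimed-<? x y = go (x <? y)
  where
  go : Dec (x < y) → does (unprimed x ≺? unprimed y) ≡ does (x <? y)
  go (yes lt) = trans (≺-yes {unprimed x} {unprimed y} (s<s (*-monoʳ-< 2 lt))) (sym (dec-true (x <? y) lt))
  go (no ¬lt) = trans (≺-no {unprimed x} {unprimed y} λ lt → ¬lt (*-cancelˡ-< 2 x y (s<s⁻¹ lt))) (sym (dec-false (x <? y) ¬lt))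

rowBump-unprimed : ∀ x r → rowBump _≺?_ (unprimed x) (map unprimed r) ≡
  (map unprimed (proj₁ (rowBump _<?_ x r)) , Maybe.map (map₂ unprimed) (proj₂ (rowBump _<?_ x r)))
rowBump-unprimed x [] = refl
rowBump-unprimed x (y ∷ r) rewrite unprimed-<? x y with does (x <? y)
... | true = refl
... | false rewrite rowBump-unprimed x r with rowBump _<?_ x r
...   | r′ , nothing = refl
...   | r′ , just _  = refl

rskInsert-unprime : ∀ x U → rskInsert′ (unprimed x) (unprime U) ≡ unprime (rskInsert x U)
rskInsert-unprime x [] = refl
rskInsert-unprime x (r ∷ U) rewrite rowBump-unprimed x r with rowBump _<?_ x r
... | r′ , nothing      = refl
... | r′ , just (_ , a) = cong (map unprimed r′ ∷_) (rskInsert-unprime a U)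

data RowStop (x : X′) : Filling X′ → Set where
  []   : RowStop x []
  here : ∀ {r T} → All (_≼ x) r → RowStop x (r ∷ T)

data RowInto : X′ → Filling X′ → Filling X′ → ℕ → X′ → Set where
  stop : ∀ {x T} → RowStop x T → RowInto x T (snocRow 0 x T) 0 x
  bump : ∀ {x r r′ n a T T′ p z} → rowBump _≺?_ x r ≡ (r′ , just (n , a)) →
         RowInto a T T′ p z → RowInto x (r ∷ T) (r′ ∷ T′) (suc p) z

rskInsert′-≡ : ∀ {x T T′ p z} → RowInto x T T′ p z → rskInsert′ x T ≡ T′
rskInsert′-≡ (stop []) = refl
rskInsert′-≡ {x} (stop (here a)) rewrite rowBump-stop x a = refl
rskInsert′-≡ (bump e i) rewrite e = cong (_ ∷_) (rskInsert′-≡ i)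

row-miss : ∀ {x T T′ p z} i y → RowInto x T T′ p z → i ≤ length T → p ≢ i →
           RowInto x (snocRow i y T) (snocRow i y T′) p z
row-miss zero    y (stop s)        le ne = ⊥-elim (ne refl)
row-miss (suc i) y (stop (here a)) le ne = stop (here a)
row-miss zero    y (bump {x} {r} e m) le ne = bump (rowBump-snoc x r e) m
row-miss (suc i) y (bump e m) (s≤s le) ne = bump e (row-miss i y m le (ne ∘ cong suc))

row-hit : ∀ {x T T′ p z y} → RowInto x T T′ p z → z ≺ y → AllLetters (_≼ y) T′ →
          RowInto x (snocRow p y T) (snocRow (suc p) y T′) (suc p) y
row-hit {y = y} (stop {x} []) lt a = bump (rowBump-end x {y = y} [] lt) (stop [])
row-hit {y = y} (stop {x} (here {T = []} b)) lt a = bump (rowBump-end x {y = y} b lt) (stop [])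
row-hit {y = y} (stop {x} (here {T = r ∷ T} b)) lt (_ ∷ c ∷ _) = bump (rowBump-end x {y = y} b lt) (stop (here c))
row-hit (bump e m) lt (_ ∷ a) = bump e (row-hit m lt a)

-- The tableau of a list of letters

letter : Mark → ℕ → X′
letter plain  = unprimed
letter barred = primed

build : Filling X′ → List ℕ → List State → Filling X′
build T (v ∷ vs) (at m c ∷ ss) = build (snocRow (proj₁ c) (letter m v) T) vs ss
build T (v ∷ vs) (_ ∷ ss)      = build T vs ss
build T _        _             = T

Entry : Set
Entry = Cell × X′

entries : List ℕ → List State → List Entry
entries (v ∷ vs) (at m c ∷ ss) = (c , letter m v) ∷ entries vs ss
entries (v ∷ vs) (_ ∷ ss)      = entries vs ss
entries _        _             = []

-- Equal unprimed entries form a horizontal strip and are ordered from left to right, equal primed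
-- ones a vertical strip ordered from top to bottom. On a tableau this is the order of the
-- standardization.
data Before : Entry → Entry → Set where
  less   : ∀ {c d x y} → x ≺ y → Before (c , x) (d , y)
  across : ∀ {i j i′ j′ v} → j < j′ → Before ((i , j) , unprimed v) ((i′ , j′) , unprimed v)
  along  : ∀ {i j i′ j′ v} → i < i′ → Before ((i , j) , primed v) ((i′ , j′) , primed v)

before-≼ : ∀ {e f} → Before e f → proj₂ e ≼ proj₂ f
before-≼ (less lt)  = <⇒≤ lt
before-≼ (across _) = ≤-refl
before-≼ (along _)  = ≤-refl

before-trans : ∀ {e f g} → Before e f → Before f g → Before e g
before-trans (less a)   q          = less (<-≤-trans a (before-≼ q))
before-trans (across a) (less b)   = less b
before-trans (across a) (across b) = across (<-trans a b)
before-trans (along a)  (less b)   = less b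
before-trans (along a)  (along b)  = along (<-trans a b)

letter-mono : ∀ m m′ {x y} → x < y → letter m x ≺ letter m′ y
letter-mono plain  plain  lt = s<s (*-monoʳ-< 2 lt)
letter-mono plain  barred {x} {y} lt = ≤-trans (≤-reflexive (sym (*-suc 2 x))) (*-monoʳ-≤ 2 lt)
letter-mono barred plain  lt = m<n⇒m<1+n (*-monoʳ-< 2 lt)
letter-mono barred barred lt = *-monoʳ-< 2 lt

primed≺unprimed : ∀ v → primed v ≺ unprimed v
primed≺unprimed v = ≤-refl

step-before : ∀ {x y m m′ c d} → Step (x , at m c) (y , at m′ d) → Before (c , letter m x) (d , letter m′ y)
step-before {m = m} {m′} (inj₁ lt) = less (letter-mono m m′ lt)
step-before (inj₂ (refl , plain< lt))  = across lt
step-before (inj₂ (refl , barred< lt)) = along lt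
step-before (inj₂ (refl , mixed))      = less ≤-refl

steps-sorted : ∀ {vs ss} → Steps vs ss → All Placed ss → AllPairs Before (entries vs ss)
steps-sorted [] [] = []
steps-sorted [-] (at ∷ []) = [] ∷ []
steps-sorted (st ∷ sts) (at ∷ at ∷ ps) with steps-sorted sts (at ∷ ps)
... | a ∷ as = (step-before st ∷ All.map (before-trans (step-before st)) a) ∷ a ∷ as

Rows : ∀ {A : Set} → Kind → Filling A → Shape → Set
Rows k T S = ∀ i → offset k i + rowLen T i ≡ rows S i

rows-≤ : ∀ {A : Set} {k S c} {T : Filling A} → Young k S → Addable S c → Rows k T S → proj₁ c ≤ length T
rows-≤ {c = zero , j} Y A R = z≤n
rows-≤ {k = k} {S} {suc i , j} {T} Y A R =
  rowLen-< T i (+-cancelˡ-< (offset k i) 0 (rowLen T i) (≤-<-trans (≤-reflexive (+-identityʳ _))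
    (≤-<-trans (off Y mem) (subst (j <_) (sym (R i)) (inRow Y mem)))))
  where
  mem : i < cols S j
  mem = subst (i <_) (sym (colEq A)) ≤-refl

rows-snoc : ∀ {A : Set} {k S c y} {T : Filling A} → Young k S → Addable S c → Rows k T S → Rows k (snocRow (proj₁ c) y T) (S ⊕ c)
rows-snoc {k = k} {S} {i , j} {y} {T} Y A R r with i ≟ r
... | yes refl = trans (cong (offset k i +_) (rowLen-snoc-same i y T (rows-≤ {T = T} Y A R)))
                   (trans (+-suc (offset k i) _) (trans (cong suc (R i)) (sym (rows-same S i j))))
... | no ne = trans (cong (offset k r +_) (rowLen-snoc-other i y T (rows-≤ {T = T} Y A R) ne))
                (trans (R r) (sym (rows-other S i j ne)))

-- Comparing the insertion into a tableau with that into its part below a letter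

-- The letter `z` is the last one placed. The bound on `n` is the number of steps that `mixInsert`
-- grants.
Into : Kind → X′ → Filling X′ → Filling X′ → Cell → X′ → Set
Into straight x T T′ p z = RowInto x T T′ (proj₁ p) z
Into shifted  x T T′ p z = Σ[ n ∈ ℕ ] MixInto (row 0) x T T′ p z n × n ≤ suc (size T)

redirect-off-u : ∀ {i j} v → i ≢ j → redirect (i , j) (unprimed v) ≡ (row (suc i) , unprimed v)
redirect-off-u {i} {j} v ne with i ≟ j
... | yes e = ⊥-elim (ne e)
... | no _  = refl

redirect-off-p : ∀ {i j} v → i ≢ j → redirect (i , j) (primed v) ≡ (col (suc j) , primed v)
redirect-off-p {i} {j} v ne with i ≟ j
... | yes e = ⊥-elim (ne e)
... | no _  = refl

redirect-on : ∀ {i j} v → i ≡ j → redirect (i , j) (unprimed v) ≡ (col (suc j) , primed v)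
redirect-on {i} {j} v e with i ≟ j
... | yes _ = refl
... | no ne = ⊥-elim (ne e)

stopRow : ∀ {x T} i → AllLetters (_≼ x) T → i ≤ length T → Stop x (row i) T i
stopRow zero    []       le = row-[]
stopRow zero    (a ∷ as) le = row-here a
stopRow (suc i) (a ∷ as) (s≤s le) = row-there (stopRow i as le)

stopCol : ∀ {x T} c i → AllLetters (_≼ x) T → (∀ {r} → r < i → c < r + rowLen T r) → i + rowLen T i ≡ c →
          0 < rowLen T i → Stop x (col c) T i
stopCol c zero [] h e ()
stopCol c zero (a ∷ as) h refl lt = col-here
stopCol (suc c) (suc i) (a ∷ as) h e lt =
  col-there (putAt-nothing _ a (h z<s)) (stopCol c i as (λ r<i → s<s⁻¹ (h (s<s r<i))) (suc-injective e) lt)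

colEnd-stop : ∀ {x T S j} → Young shifted S → Rows shifted T S → AllLetters (_≼ x) T →
  Addable S (colEnd S (suc j)) → cols S (suc j) ≢ suc j → Stop x (col (suc j)) T (cols S (suc j))
colEnd-stop {x} {T} {S} {j} Y R a A nd = stopCol (suc j) C a
  (λ {r} lt → subst (suc j <_) (sym (R r)) (inRow Y lt)) (trans (R C) (rowEq A))
  (+-cancelˡ-< C 0 (rowLen T C) (≤-<-trans (≤-reflexive (+-identityʳ C))
    (subst (C <_) (sym (trans (R C) (rowEq A))) (≤∧≢⇒< (addable-off Y A) nd))))
  where C = cols S (suc j)

mix-end : ∀ {ℓ x T T′ p q z n} → p ≡ q → MixInto ℓ x T T′ p z n → MixInto ℓ x T T′ q z n
mix-end refl m = m

module _ {x : X′} {T T′ : Filling X′} {z : X′} {S₀ : Shape} where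

  letter-straight : ∀ {m c m′ c′ p q v} → Young straight S₀ → Addable S₀ p → Rows straight T S₀ →
    StateOK straight S₀ (at m c) → Tame straight (at m c) →
    Act straight (S₀ ⊕ p) (just p) (at m c) (at m′ c′) (just q) → RowInto x T T′ (proj₁ p) z →
    AllLetters (_≼ letter m′ v) T′ → Before (p , z) (c′ , letter m′ v) →
    Σ[ z′ ∈ X′ ] RowInto x (snocRow (proj₁ c) (letter m v) T) (snocRow (proj₁ c′) (letter m′ v) T′) (proj₁ q) z′
      × (q ≡ p × z′ ≡ z ⊎ q ≡ c′ × z′ ≡ letter m′ v)
  letter-straight {m} {v = v} Y P R ok t (miss ne) I a b =
    z , row-miss _ (letter m v) I (rows-≤ {T = T} Y C R) (λ { refl → ne (cong (_ ,_) (addable-same-row C P)) }) , inj₁ (refl , refl)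
    where C = stateCell {straight} {m = m} ok
  letter-straight {v = v} Y P R ok t (down o refl) I a b = unprimed v , row-hit I (lt b) a , inj₂ (refl , refl)
    where
    lt : Before (_ , z) (_ , unprimed v) → z ≺ unprimed v
    lt (less l)   = l
    -- A letter equal to `z` would have to end up to the right of `p`, but a letter moving down goes
    -- weakly left.
    lt (across l) = ⊥-elim (<⇒≱ l (rows-next-≤ Y P o))

  letter-shifted : ∀ {m c m′ c′ p q v n} → Young shifted S₀ → Addable S₀ p → Rows shifted T S₀ → Rows shifted T′ (S₀ ⊕ p) →
    StateOK shifted S₀ (at m c) →
    Act shifted (S₀ ⊕ p) (just p) (at m c) (at m′ c′) (just q) → MixInto (row 0) x T T′ p z n →
    AllLetters (_≼ letter m′ v) T′ → Before (p , z) (c′ , letter m′ v) →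
    Σ[ z′ ∈ X′ ] Σ[ n′ ∈ ℕ ] MixInto (row 0) x (snocRow (proj₁ c) (letter m v) T) (snocRow (proj₁ c′) (letter m′ v) T′) q z′ n′
      × n′ ≤ suc n × (q ≡ p × z′ ≡ z ⊎ q ≡ c′ × z′ ≡ letter m′ v)
  letter-shifted {m} {v = v} Y P R R′ (C , mk) (miss ne) I a b = z , _ ,
    mix-miss _ (letter m v) I (rows-≤ {T = T} Y C R) (λ { refl → ne (cong (_ ,_) (addable-same-row C P)) }) , n≤1+n _ , inj₁ (refl , refl)
  letter-shifted {p = i , j} {v = v} {n} Y P R R′ (C , mk) (down o refl) I a b =
    unprimed v , suc n , mix-end (cong (suc i ,_) (R′ (suc i)))
      (mix-hit {y = unprimed v} {y′ = unprimed v} I (cong (i ,_) (sym (trans (R i) (rowEq P)))) (lt b) (redirect-off-u v o)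
        (stopRow (suc i) a (rows-≤ {T = T′} (Young-⊕ Y P) (rowEnd-addable Y P o) R′))) , ≤-refl , inj₂ (refl , refl)
    where
    lt : Before (_ , z) (_ , unprimed v) → z ≺ unprimed v
    lt (less l)   = l
    lt (across l) = ⊥-elim (<⇒≱ l (rows-next-≤ Y P o))
  letter-shifted {p = i , j} {v = v} {n} Y P R R′ (C , mk) (right refl) I a b =
    primed v , suc n , mix-end (cong (E ,_) (trans (R′ E) (rowEq A)))
      (mix-hit {y = primed v} {y′ = primed v} I (cong (i ,_) (sym (trans (R i) (rowEq P)))) (lt b) (redirect-off-p v mk)
        (colEnd-stop (Young-⊕ Y P) R′ a A (colEnd-offDiagonal Y P))) , ≤-refl , inj₂ (refl , refl)
    where
    E = cols (S₀ ⊕ (i , j)) (suc j)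
    A = colEnd-addable Y P
    lt : Before (_ , z) (_ , primed v) → z ≺ primed v
    lt (less l)  = l
    lt (along l) = ⊥-elim (<⇒≱ l (cols-next-≤ Y P))
  -- The letter bumped is `unprimed v`, the letter placed `primed v`. The order only gives
  -- `z ≼ primed v`, which suffices for `z` to bump it.
  letter-shifted {p = i , j} {v = v} {n} Y P R R′ (C , mk) (turn o refl) I a b =
    primed v , suc n , mix-end (cong (E ,_) (trans (R′ E) (rowEq A)))
      (mix-hit {y = unprimed v} {y′ = primed v} I (cong (i ,_) (sym (trans (R i) (rowEq P)))) (≤-<-trans (before-≼ b) (primed≺unprimed v)) (redirect-on v o)
        (colEnd-stop (Young-⊕ Y P) R′ a A (colEnd-offDiagonal Y P))) , ≤-refl , inj₂ (refl , refl)
    where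
    E = cols (S₀ ⊕ (i , j)) (suc j)
    A = colEnd-addable Y P

letter-into : ∀ k {x T T′ p z S₀ m c m′ c′ q v} → Young k S₀ → Addable S₀ p → Rows k T S₀ → Rows k T′ (S₀ ⊕ p) →
  StateOK k S₀ (at m c) → Tame k (at m c) →
  Act k (S₀ ⊕ p) (just p) (at m c) (at m′ c′) (just q) → Into k x T T′ p z →
  AllLetters (_≼ letter m′ v) T′ → Before (p , z) (c′ , letter m′ v) →
  Σ[ z′ ∈ X′ ] Into k x (snocRow (proj₁ c) (letter m v) T) (snocRow (proj₁ c′) (letter m′ v) T′) q z′
    × (q ≡ p × z′ ≡ z ⊎ q ≡ c′ × z′ ≡ letter m′ v)
letter-into straight Y P R R′ ok t f I a b = letter-straight Y P R ok t f I a b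
letter-into shifted {T = T} {c = c} Y P R R′ ok t f (n , I , le) a b with letter-shifted Y P R R′ ok f I a b
... | z′ , n′ , I′ , le′ , w = z′ , (n′ , I′ , ≤-trans le′ (s≤s (≤-trans le (≤-reflexive (sym (size-snoc (proj₁ c) _ T)))))) , w

act-at : ∀ {k S p m c s′ e} → Act k S (just p) (at m c) s′ e →
         ∃₂ λ m′ c′ → ∃ λ q → s′ ≡ at m′ c′ × e ≡ just q
act-at (miss _)   = _ , _ , _ , refl , refl
act-at (down _ _) = _ , _ , _ , refl , refl
act-at (right _)  = _ , _ , _ , refl , refl
act-at (turn _ _) = _ , _ , _ , refl , refl

-- The remaining letters are added one by one to the tableau before and to that after the insertion.
-- Each is at least as large as all entries so far, so it prolongs the insertion by at most one
-- bump.
build-into : ∀ k {x T T′ p z S₀ ss ss′ q} vs → Young k S₀ → Addable S₀ p → Rows k T S₀ → Rows k T′ (S₀ ⊕ p) →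
  Valid k S₀ ss → All Placed ss → All (Tame k) ss → Pass k (S₀ ⊕ p) (just p) ss ss′ (just q) → length vs ≡ length ss →
  Into k x T T′ p z → All (λ e → AllLetters (_≼ proj₂ e) T′) (entries vs ss′) →
  All (Before (p , z)) (entries vs ss′) → AllPairs Before (entries vs ss′) →
  Σ[ z′ ∈ X′ ] Into k x (build T vs ss) (build T′ vs ss′) q z′
build-into k [] Y P R R′ v [] ts [] l I h₁ h₂ h₃ = _ , I
build-into k {T = T} {T′} (v ∷ vs) Y P R R′ (_∷_ {s = s} ok vd) (at {m} {c} ∷ ps) (t ∷ ts) (_∷_ {s′ = s′} f p) l I h₁ h₂ h₃
  with act-at f
build-into k {T = T} {T′} {p = p₀} {S₀ = S₀} (v ∷ vs) Y P R R′ (ok ∷ vd) (at {m} {c} ∷ ps) (t ∷ ts) (f ∷ p) l I (a ∷ h₁) (b ∷ h₂) (h ∷ h₃)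
  | m′ , c′ , q , refl , refl with letter-into k {m = m} {m′ = m′} {v = v} Y P R R′ ok t f I a b
... | z′ , I′ , w = build-into k vs (Young-⊕ Y C) (add′ r) (rows-snoc {T = T} Y C R)
        (λ i → trans (rows-snoc {T = T′} (Young-⊕ Y P) (stateCell {k} {m = m′} (ok′ r)) R′ i) (rows-≗ (sum′ r) i))
        vd ps ts (Pass-cong (sum′ r) p) (suc-injective l) I′ (both h₁ h) (next w) h₃
  where
  C = stateCell {k} {m = m} ok
  r = acted Y P ok f
  both : ∀ {es} → All (λ e → AllLetters (_≼ proj₂ e) T′) es → All (Before (c′ , letter m′ v)) es →
         All (λ e → AllLetters (_≼ proj₂ e) (snocRow (proj₁ c′) (letter m′ v) T′)) es
  both [] [] = []
  both (x ∷ xs) (y ∷ ys) = allLetters-snoc (proj₁ c′) (before-≼ y) x ∷ both xs ys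
  next : (q ≡ p₀ × z′ ≡ _ ⊎ q ≡ c′ × z′ ≡ letter m′ v) → All (Before (q , z′)) _
  next (inj₁ (refl , refl)) = h₂
  next (inj₂ (refl , refl)) = h

-- Cells of fillings

data Nth {A : Set} : List A → ℕ → A → Set where
  zero : ∀ {x r} → Nth (x ∷ r) 0 x
  suc  : ∀ {x y r j} → Nth r j x → Nth (y ∷ r) (suc j) x

shiftBy : Kind → ℕ → ℕ
shiftBy straight j = j
shiftBy shifted  j = suc j

-- The column is the true one in the diagram: in the shifted case it increases by one with every row
-- passed.
data In {A : Set} (k : Kind) : Filling A → ℕ → ℕ → A → Set where
  here  : ∀ {r T j x} → Nth r j x → In k (r ∷ T) 0 j x
  there : ∀ {r T i j x} → In k T i j x → In k (r ∷ T) (suc i) (shiftBy k j) x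

AllCells : ∀ {A : Set} → Kind → (Cell × A → Set) → Filling A → Set
AllCells k P T = ∀ {i j x} → In k T i j x → P ((i , j) , x)

nth-< : ∀ {A : Set} {r : List A} {j x} → Nth r j x → j < length r
nth-< zero    = z<s
nth-< (suc n) = s<s (nth-< n)

nth-exists : ∀ {A : Set} (r : List A) {j} → j < length r → Σ[ x ∈ A ] Nth r j x
nth-exists (x ∷ r) {zero}  lt = x , zero
nth-exists (x ∷ r) {suc j} lt = map₂ suc (nth-exists r (s<s⁻¹ lt))

nth-++ˡ : ∀ {A : Set} {r r′ : List A} {j x} → Nth r j x → Nth (r ++ r′) j x
nth-++ˡ zero    = zero
nth-++ˡ (suc n) = suc (nth-++ˡ n)

nth-end : ∀ {A : Set} (r : List A) {y} → Nth (r ∷ʳ y) (length r) y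
nth-end []      = zero
nth-end (x ∷ r) = suc (nth-end r)

nth-snoc⁻ : ∀ {A : Set} (r : List A) {y j x} → Nth (r ∷ʳ y) j x → Nth r j x ⊎ j ≡ length r × x ≡ y
nth-snoc⁻ []      zero    = inj₂ (refl , refl)
nth-snoc⁻ (x ∷ r) zero    = inj₁ zero
nth-snoc⁻ (x ∷ r) (suc n) with nth-snoc⁻ r n
... | inj₁ m = inj₁ (suc m)
... | inj₂ (e , q) = inj₂ (cong suc e , q)

offset-suc : ∀ k i → offset k (suc i) ≡ shiftBy k (offset k i)
offset-suc straight i = refl
offset-suc shifted  i = refl

shiftBy-+ : ∀ k a b → shiftBy k (a + b) ≡ shiftBy k a + b
shiftBy-+ straight a b = refl
shiftBy-+ shifted  a b = refl

shiftBy-mono-≤ : ∀ k {a b} → a ≤ b → shiftBy k a ≤ shiftBy k b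
shiftBy-mono-≤ straight le = le
shiftBy-mono-≤ shifted  le = s≤s le

shiftBy-mono-< : ∀ k {a b} → a < b → shiftBy k a < shiftBy k b
shiftBy-mono-< straight le = le
shiftBy-mono-< shifted  le = s≤s le

shiftBy-injective : ∀ k {a b} → shiftBy k a ≡ shiftBy k b → a ≡ b
shiftBy-injective straight e = e
shiftBy-injective shifted  e = suc-injective e

rowEndCell : ∀ {A : Set} → Kind → Filling A → ℕ → ℕ
rowEndCell k T i = offset k i + rowLen T i

rowEndCell-suc : ∀ {A : Set} k (r : List A) T i → rowEndCell k (r ∷ T) (suc i) ≡ shiftBy k (rowEndCell k T i)
rowEndCell-suc k r T i = trans (cong (_+ rowLen T i) (offset-suc k i)) (sym (shiftBy-+ k (offset k i) (rowLen T i)))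

offset-0 : ∀ k → offset k 0 ≡ 0
offset-0 straight = refl
offset-0 shifted  = refl

in-≥ : ∀ {A : Set} {k i j x} {T : Filling A} → In k T i j x → offset k i ≤ j
in-≥ {k = k} (here _) = subst (_≤ _) (sym (offset-0 k)) z≤n
in-≥ {k = k} (there {i = i} n) = subst (_≤ _) (sym (offset-suc k i)) (shiftBy-mono-≤ k (in-≥ n))

in-< : ∀ {A : Set} {k i j x} {T : Filling A} → In k T i j x → j < rowEndCell k T i
in-< {k = k} (here {r} n) = subst (λ o → _ < o + length r) (sym (offset-0 k)) (nth-< n)
in-< {k = k} (there {r} {T} {i} n) = subst (_ <_) (sym (rowEndCell-suc k r T i)) (shiftBy-mono-< k (in-< n))

in-snoc⁺ : ∀ {A : Set} {k i j x} {T : Filling A} i′ y → In k T i j x → In k (snocRow i′ y T) i j x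
in-snoc⁺ zero     y (here n)  = here (nth-++ˡ n)
in-snoc⁺ zero     y (there n) = there n
in-snoc⁺ (suc i′) y (here n)  = here n
in-snoc⁺ (suc i′) y (there n) = there (in-snoc⁺ i′ y n)

in-snoc-new : ∀ {A : Set} k i y (T : Filling A) → i ≤ length T → In k (snocRow i y T) i (rowEndCell k T i) y
in-snoc-new straight zero y []      _ = here zero
in-snoc-new shifted  zero y []      _ = here zero
in-snoc-new straight zero y (r ∷ T) _ = here (nth-end r)
in-snoc-new shifted  zero y (r ∷ T) _ = here (nth-end r)
in-snoc-new k (suc i) y (r ∷ T) (s≤s le) =
  subst (λ j → In k (r ∷ snocRow i y T) (suc i) j y) (sym (rowEndCell-suc k r T i)) (there (in-snoc-new k i y T le))

in-snoc⁻ : ∀ {A : Set} {k i j x} i′ y (T : Filling A) → i′ ≤ length T → In k (snocRow i′ y T) i j x →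
           In k T i j x ⊎ (i ≡ i′ × j ≡ rowEndCell k T i′ × x ≡ y)
in-snoc⁻ {k = k} zero y [] le (here zero) = inj₂ (refl , sym (trans (+-identityʳ _) (offset-0 k)) , refl)
in-snoc⁻ {k = k} zero y (r ∷ T) le (here n) with nth-snoc⁻ r n
... | inj₁ m = inj₁ (here m)
... | inj₂ (e , q) = inj₂ (refl , trans e (cong (_+ length r) (sym (offset-0 k))) , q)
in-snoc⁻ zero y (r ∷ T) le (there n) = inj₁ (there n)
in-snoc⁻ (suc i′) y (r ∷ T) le (here n) = inj₁ (here n)
in-snoc⁻ {k = k} (suc i′) y (r ∷ T) (s≤s le) (there n) with in-snoc⁻ i′ y T le n
... | inj₁ m = inj₁ (there m)
... | inj₂ (e , q , p) = inj₂ (cong suc e , trans (cong (shiftBy k) q) (sym (rowEndCell-suc k r T i′)) , p)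

in-exists : ∀ {A : Set} k (T : Filling A) i {j} → offset k i ≤ j → j < rowEndCell k T i → Σ[ x ∈ A ] In k T i j x
in-exists k [] i o lt = ⊥-elim (<⇒≱ (subst (_ <_) (+-identityʳ _) lt) o)
in-exists k (r ∷ T) zero o lt = map₂ here (nth-exists r (subst (λ z → _ < z + length r) (offset-0 k) lt))
in-exists straight (r ∷ T) (suc i) o lt = map₂ there (in-exists straight T i o lt)
in-exists shifted  (r ∷ T) (suc i) {suc j} o lt = map₂ there (in-exists shifted T i (≤-pred o) (s<s⁻¹ lt))

nthCol : ∀ {A : Set} → List (List A) → ℕ → List A
nthCol []       j       = []
nthCol (c ∷ cs) zero    = c
nthCol (c ∷ cs) (suc j) = nthCol cs j

pad : ∀ {A : Set} → Kind → List (List A) → List (List A)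
pad straight cs = cs
pad shifted  cs = [] ∷ cs

cols′ : ∀ {A : Set} → Kind → Filling A → List (List A)
cols′ k []      = []
cols′ k (r ∷ T) = addRow r (pad k (cols′ k T))

cols′-straight : ∀ {A : Set} (T : Filling A) → cols′ straight T ≡ columns T
cols′-straight []      = refl
cols′-straight (r ∷ T) = cong (addRow r) (cols′-straight T)

cols′-shifted : ∀ {A : Set} (T : Filling A) → cols′ shifted T ≡ shiftedColumns T
cols′-shifted []      = refl
cols′-shifted (r ∷ T) = cong (λ cs → addRow r ([] ∷ cs)) (cols′-shifted T)

AddedTo : ∀ {A : Set} → List A → List (List A) → ℕ → Set
AddedTo r cs j = (Σ[ x ∈ _ ] Nth r j x × nthCol (addRow r cs) j ≡ x ∷ nthCol cs j)
               ⊎ ((∀ {x} → ¬ Nth r j x) × nthCol (addRow r cs) j ≡ nthCol cs j)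

addRow-[] : ∀ {A : Set} (r : List A) j → AddedTo r [] j
addRow-[] []              j       = inj₂ ((λ ()) , refl)
addRow-[] (x ∷ r)         zero    = inj₁ (x , zero , refl)
addRow-[] (x ∷ [])        (suc j) = inj₂ ((λ { (suc ()) }) , refl)
addRow-[] (x ∷ r@(_ ∷ _)) (suc j) with addRow-[] r j
... | inj₁ (y , n , e) = inj₁ (y , suc n , e)
... | inj₂ (¬n , e)    = inj₂ ((λ { (suc n) → ¬n n }) , e)

addRow-nth : ∀ {A : Set} (r : List A) cs j → AddedTo r cs j
addRow-nth r       []       j       = addRow-[] r j
addRow-nth []      (c ∷ cs) j       = inj₂ ((λ ()) , cong (λ c → nthCol c j) (map-id (c ∷ cs)))
addRow-nth (x ∷ r) (c ∷ cs) zero    = inj₁ (x , zero , refl)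
addRow-nth (x ∷ r) (c ∷ cs) (suc j) with addRow-nth r cs j
... | inj₁ (y , n , e) = inj₁ (y , suc n , e)
... | inj₂ (¬n , e)    = inj₂ ((λ { (suc n) → ¬n n }) , e)

nth-unique : ∀ {A : Set} {r : List A} {j x y} → Nth r j x → Nth r j y → x ≡ y
nth-unique zero    zero    = refl
nth-unique (suc n) (suc m) = nth-unique n m

pad-col : ∀ {A : Set} k (cs : List (List A)) j → nthCol (pad k cs) (shiftBy k j) ≡ nthCol cs j
pad-col straight cs j = refl
pad-col shifted  cs j = refl

allCol⁺ : ∀ {A : Set} k {P : A → Set} (T : Filling A) j → (∀ {i y} → In k T i j y → P y) → All P (nthCol (cols′ k T) j)
allPad⁺ : ∀ {A : Set} k {P : A → Set} {r : List A} (T : Filling A) j → (∀ {i y} → In k (r ∷ T) (suc i) j y → P y) →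
          All P (nthCol (pad k (cols′ k T)) j)
allCol⁺ k []      j h = []
allCol⁺ k (r ∷ T) j h with addRow-nth r (pad k (cols′ k T)) j
... | inj₁ (x , n , e) = subst (All _) (sym e) (h (here n) ∷ allPad⁺ k {r = r} T j h)
... | inj₂ (_ , e)     = subst (All _) (sym e) (allPad⁺ k {r = r} T j h)
allPad⁺ straight T j       h = allCol⁺ straight T j (λ n → h (there n))
allPad⁺ shifted  T zero    h = []
allPad⁺ shifted  T (suc j) h = allCol⁺ shifted T j (λ n → h (there n))

allCol⁻ : ∀ {A : Set} k {P : A → Set} (T : Filling A) {i j y} → All P (nthCol (cols′ k T) j) → In k T i j y → P y
allCol⁻ k (r ∷ T) {j = j} a n with addRow-nth r (pad k (cols′ k T)) j
allCol⁻ k (r ∷ T) a (here n) | inj₁ (x , m , e) with subst (All _) e a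
... | px ∷ _ = subst _ (nth-unique m n) px
allCol⁻ k (r ∷ T) a (here n) | inj₂ (¬n , e) = ⊥-elim (¬n n)
allCol⁻ k (r ∷ T) a (there {j = j} n) | inj₁ (x , m , e) with subst (All _) e a
... | _ ∷ as = allCol⁻ k T (subst (All _) (pad-col k (cols′ k T) j) as) n
allCol⁻ k (r ∷ T) a (there {j = j} n) | inj₂ (_ , e) = allCol⁻ k T (subst (All _) (trans e (pad-col k (cols′ k T) j)) a) n

module _ {A : Set} {R : A → A → Set} where

  nthCols⁺ : ∀ {cs} → (∀ j → AllPairs R (nthCol cs j)) → All (AllPairs R) cs
  nthCols⁺ {[]}     h = []
  nthCols⁺ {c ∷ cs} h = h 0 ∷ nthCols⁺ (h ∘ suc)

  nthCols⁻ : ∀ {cs} → All (AllPairs R) cs → ∀ j → AllPairs R (nthCol cs j)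
  nthCols⁻ []       j       = []
  nthCols⁻ (a ∷ as) zero    = a
  nthCols⁻ (a ∷ as) (suc j) = nthCols⁻ as j

  ColumnsOK RowsOK : Kind → Filling A → Set
  ColumnsOK k T = ∀ {i i′ j x y} → i < i′ → In k T i j x → In k T i′ j y → R x y
  RowsOK    k T = ∀ {i j j′ x y} → j < j′ → In k T i j x → In k T i j′ y → R x y

  columns⁺ : ∀ k T → ColumnsOK k T → All (AllPairs R) (cols′ k T)
  columns⁺ k T h = nthCols⁺ (go T h)
    where
    tailOK : ∀ r T → ColumnsOK k (r ∷ T) → ColumnsOK k T
    tailOK r T h lt n m = h (s<s lt) (there n) (there m)
    padded : ∀ k T → (∀ j → AllPairs R (nthCol (cols′ k T) j)) → ∀ j → AllPairs R (nthCol (pad k (cols′ k T)) j)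
    padded straight T h j       = h j
    padded shifted  T h zero    = []
    padded shifted  T h (suc j) = h j
    go : ∀ T → ColumnsOK k T → ∀ j → AllPairs R (nthCol (cols′ k T) j)
    go []      h j = []
    go (r ∷ T) h j with addRow-nth r (pad k (cols′ k T)) j
    ... | inj₁ (x , n , e) = subst (AllPairs R) (sym e) (allPad⁺ k {r = r} T j (λ m → h′ m n) ∷ padded k T (go T (tailOK r T h)) j)
      where
      h′ : ∀ {i y} → In k (r ∷ T) (suc i) j y → Nth r j x → R x y
      h′ m n = h z<s (here n) m
    ... | inj₂ (_ , e) = subst (AllPairs R) (sym e) (padded k T (go T (tailOK r T h)) j)

  columns⁻ : ∀ k T → All (AllPairs R) (cols′ k T) → ColumnsOK k T
  columns⁻ k T a = go T (nthCols⁻ a)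
    where
    go : ∀ T → (∀ j → AllPairs R (nthCol (cols′ k T) j)) → ColumnsOK k T
    go (r ∷ T) h lt n m = entry h lt n m refl
      where
      tailOK : ∀ j → AllPairs R (nthCol (cols′ k T) j)
      tailOK j with addRow-nth r (pad k (cols′ k T)) (shiftBy k j)
      ... | inj₁ (x , n , e) with subst (AllPairs R) (trans e (cong (x ∷_) (pad-col k (cols′ k T) j))) (h (shiftBy k j))
      ...   | _ ∷ as = as
      tailOK j | inj₂ (_ , e) = subst (AllPairs R) (trans e (pad-col k (cols′ k T) j)) (h (shiftBy k j))
      entry : (∀ j → AllPairs R (nthCol (cols′ k (r ∷ T)) j)) → ∀ {i i′ j j′ x y} → i < i′ → In k (r ∷ T) i j x → In k (r ∷ T) i′ j′ y → j ≡ j′ → R x y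
      entry h lt (here {j = j} n) (there {j = j′} m) refl with addRow-nth r (pad k (cols′ k T)) j
      ... | inj₂ (¬n , _) = ⊥-elim (¬n n)
      ... | inj₁ (x , n′ , e) with subst (AllPairs R) (trans e (cong (x ∷_) (pad-col k (cols′ k T) j′))) (h j)
      ...   | a ∷ _ = subst (λ x → R x _) (nth-unique n′ n) (allCol⁻ k T a m)
      entry h lt (there n) (there m) e with shiftBy-injective k e
      ... | refl = go T tailOK (s<s⁻¹ lt) n m

  allNth⁺ : ∀ {P : A → Set} (r : List A) → (∀ {j x} → Nth r j x → P x) → All P r
  allNth⁺ []      h = []
  allNth⁺ (x ∷ r) h = h zero ∷ allNth⁺ r (h ∘ suc)

  allNth⁻ : ∀ {P : A → Set} {r : List A} → All P r → ∀ {j x} → Nth r j x → P x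
  allNth⁻ (p ∷ ps) zero    = p
  allNth⁻ (p ∷ ps) (suc n) = allNth⁻ ps n

  pairs⁺ : ∀ (r : List A) → (∀ {j j′ x y} → j < j′ → Nth r j x → Nth r j′ y → R x y) → AllPairs R r
  pairs⁺ []      h = []
  pairs⁺ (x ∷ r) h = allNth⁺ r (λ n → h z<s zero (suc n)) ∷ pairs⁺ r (λ lt n m → h (s<s lt) (suc n) (suc m))

  pairs⁻ : ∀ {r : List A} → AllPairs R r → ∀ {j j′ x y} → j < j′ → Nth r j x → Nth r j′ y → R x y
  pairs⁻ (a ∷ as) lt zero    (suc m) = allNth⁻ a m
  pairs⁻ (a ∷ as) lt (suc n) (suc m) = pairs⁻ as (s<s⁻¹ lt) n m

  rows⁺ : ∀ k T → RowsOK k T → All (AllPairs R) T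
  rows⁺ k []      h = []
  rows⁺ k (r ∷ T) h = pairs⁺ r (λ lt n m → h lt (here n) (here m)) ∷
    rows⁺ k T (λ lt n m → h (shiftBy-mono-< k lt) (there n) (there m))

  rows⁻ : ∀ k T → All (AllPairs R) T → RowsOK k T
  rows⁻ k (r ∷ T) (a ∷ as) lt n m = go n m refl lt
    where
    reflects : ∀ k {a b} → shiftBy k a < shiftBy k b → a < b
    reflects straight lt = lt
    reflects shifted  lt = s<s⁻¹ lt
    go : ∀ {i i′ j j′ x y} → In k (r ∷ T) i j x → In k (r ∷ T) i′ j′ y → i ≡ i′ → j < j′ → R x y
    go (here n)  (here m)  refl lt = pairs⁻ a lt n m
    go (there n) (there m) refl lt = rows⁻ k T as (reflects k lt) n m

-- Tableaux

-- In the straight case all entries are to be unprimed; `ColumnPair`, which admits equal entries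
-- only if primed, then means strict increase.
NeedsPlain : Kind → ℕ → ℕ → Set
NeedsPlain straight i j = ⊤
NeedsPlain shifted  i j = i ≡ j

record Tableau (k : Kind) (T : Filling X′) : Set where
  field
    rowsOK  : RowsOK {R = RowPair} k T
    colsOK  : ColumnsOK {R = ColumnPair} k T
    plainOK : ∀ {i j x} → In k T i j x → NeedsPlain k i j → Unprimed x
open Tableau public

before-irrefl : ∀ {e} → ¬ Before e e
before-irrefl (less lt)   = n≮n _ lt
before-irrefl (across lt) = n≮n _ lt
before-irrefl (along lt)  = n≮n _ lt

before-rowPair : ∀ {i j j′ x y} → Before ((i , j) , x) ((i , j′) , y) → RowPair x y
before-rowPair (less lt)  = <⇒≤ lt , λ { refl → ⊥-elim (n≮n _ lt) }
before-rowPair (across _) = ≤-refl , λ _ → unprimed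
before-rowPair (along lt) = ⊥-elim (n≮n _ lt)

before-columnPair : ∀ {i i′ j x y} → Before ((i , j) , x) ((i′ , j) , y) → ColumnPair x y
before-columnPair (less lt)   = <⇒≤ lt , λ { refl → ⊥-elim (n≮n _ lt) }
before-columnPair (across lt) = ⊥-elim (n≮n _ lt)
before-columnPair (along _)   = ≤-refl , λ _ → primed

rank-injective : ∀ {x y} → rank x ≡ rank y → x ≡ y
rank-injective {primed i}   {primed j}   e = cong primed (*-cancelˡ-≡ i j 2 e)
rank-injective {primed i}   {unprimed j} e = ⊥-elim (even≢odd i j e)
rank-injective {unprimed i} {primed j}   e = ⊥-elim (even≢odd j i (sym e))
rank-injective {unprimed i} {unprimed j} e = cong unprimed (*-cancelˡ-≡ i j 2 (suc-injective e))

rowPair-before : ∀ {i j j′ x y} → j < j′ → RowPair x y → Before ((i , j) , x) ((i , j′) , y)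
rowPair-before {x = x} {y} lt (le , h) with m≤n⇒m<n∨m≡n le
... | inj₁ l = less l
... | inj₂ e with rank-injective {x} {y} e
...   | refl with h refl
...     | unprimed = across lt

columnPair-before : ∀ {i i′ j x y} → i < i′ → ColumnPair x y → Before ((i , j) , x) ((i′ , j) , y)
columnPair-before {x = x} {y} lt (le , h) with m≤n⇒m<n∨m≡n le
... | inj₁ l = less l
... | inj₂ e with rank-injective {x} {y} e
...   | refl with h refl
...     | primed = along lt

tableau-snoc : ∀ {k T S c y} → Tableau k T → Young k S → Addable S c → Rows k T S →
  AllCells k (λ e → Before e (c , y)) T → (NeedsPlain k (proj₁ c) (proj₂ c) → Unprimed y) →
  Tableau k (snocRow (proj₁ c) y T)
tableau-snoc {k} {T} {S} {ic , jc} {y} Tb Y A R h pl = record { rowsOK = r ; colsOK = c ; plainOK = p }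
  where
  le = rows-≤ {T = T} Y A R
  jc≡ : rowEndCell k T ic ≡ jc
  jc≡ = trans (R ic) (rowEq A)
  split : ∀ {i j x} → In k (snocRow ic y T) i j x → In k T i j x ⊎ (i ≡ ic × j ≡ jc × x ≡ y)
  split n with in-snoc⁻ ic y T le n
  ... | inj₁ m = inj₁ m
  ... | inj₂ (e , q , s) = inj₂ (e , trans q jc≡ , s)
  r : RowsOK {R = RowPair} k (snocRow ic y T)
  r lt n m with split n | split m
  ... | inj₁ n′ | inj₁ m′ = rowsOK Tb lt n′ m′
  ... | inj₁ n′ | inj₂ (refl , refl , refl) = before-rowPair (h n′)
  ... | inj₂ (refl , refl , refl) | inj₁ m′ = ⊥-elim (<-asym lt (subst (_ <_) jc≡ (in-< m′)))
  ... | inj₂ (refl , refl , refl) | inj₂ (_ , refl , _) = ⊥-elim (n≮n _ lt)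
  c : ColumnsOK {R = ColumnPair} k (snocRow ic y T)
  c lt n m with split n | split m
  ... | inj₁ n′ | inj₁ m′ = colsOK Tb lt n′ m′
  ... | inj₁ n′ | inj₂ (refl , refl , refl) = before-columnPair (h n′)
  ... | inj₂ (refl , refl , refl) | inj₁ m′ =
    ⊥-elim (<-asym lt (subst (_ <_) (colEq A) (inCol Y (in-≥ m′) (subst (_ <_) (R _) (in-< m′)))))
  ... | inj₂ (refl , _ , _) | inj₂ (refl , _ , _) = ⊥-elim (n≮n _ lt)
  p : ∀ {i j x} → In k (snocRow ic y T) i j x → NeedsPlain k i j → Unprimed x
  p n np with split n
  ... | inj₁ n′ = plainOK Tb n′ np
  ... | inj₂ (refl , refl , refl) = pl np

tableau-unsnoc : ∀ {k T} i y → Tableau k (snocRow i y T) → Tableau k T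
tableau-unsnoc i y Tb = record
  { rowsOK  = λ lt n m → rowsOK Tb lt (in-snoc⁺ i y n) (in-snoc⁺ i y m)
  ; colsOK  = λ lt n m → colsOK Tb lt (in-snoc⁺ i y n) (in-snoc⁺ i y m)
  ; plainOK = λ n → plainOK Tb (in-snoc⁺ i y n) }

Tableau-[] : ∀ {k} → Tableau k []
Tableau-[] = record { rowsOK = λ { _ () } ; colsOK = λ { _ () } ; plainOK = λ () }

-- `offset k 1` is 0 or 1, so this unfolds to `IsPartition` or `IsStrictPartition`.
Diagram : Kind → List ℕ → Set
Diagram k μ = All (0 <_) μ × Linked (λ a b → offset k 1 + b ≤ a) μ

NonEmpty : ∀ {A : Set} → Filling A → Set
NonEmpty = All (λ r → 0 < length r)

nonEmpty-snoc : ∀ {A : Set} i (y : A) {T} → NonEmpty T → NonEmpty (snocRow i y T)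
nonEmpty-snoc i       y []       = z<s ∷ []
nonEmpty-snoc zero    y {r ∷ _} (n ∷ ns) = subst (0 <_) (sym (length-snoc r y)) z<s ∷ ns
nonEmpty-snoc (suc i) y (n ∷ ns) = n ∷ nonEmpty-snoc i y ns

-- The row must be non-empty: the ends of empty rows of a shifted shape follow the diagonal to the
-- right.
diagram-steps : ∀ {A : Set} k (T : Filling A) → Diagram k (shapeᵗ T) →
                ∀ i → 0 < rowLen T (suc i) → rowEndCell k T (suc i) ≤ rowEndCell k T i
diagram-steps k (r ∷ [])     d zero    ()
diagram-steps k (r ∷ [])     d (suc i) ()
diagram-steps k (r ∷ r′ ∷ T) (_ , l ∷ _) zero lt = subst (λ z → offset k 1 + length r′ ≤ z + length r) (sym (offset-0 k)) l
diagram-steps k (r ∷ r′ ∷ T) (_ ∷ p , _ ∷ l) (suc i) lt =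
  subst₂ _≤_ (sym (rowEndCell-suc k r (r′ ∷ T) (suc i))) (sym (rowEndCell-suc k r (r′ ∷ T) i))
    (shiftBy-mono-≤ k (diagram-steps k (r′ ∷ T) (p , l) i lt))

steps-diagram : ∀ {A : Set} k (T : Filling A) → NonEmpty T →
  (∀ i → 0 < rowLen T (suc i) → rowEndCell k T (suc i) ≤ rowEndCell k T i) → Diagram k (shapeᵗ T)
steps-diagram k []       n h = [] , []
steps-diagram k (r ∷ []) (n ∷ _) h = n ∷ [] , [-]
steps-diagram k (r ∷ r′ ∷ T) (n ∷ ns@(n′ ∷ _)) h with steps-diagram k (r′ ∷ T) ns rest
  where
  reflects : ∀ k {a b} → shiftBy k a ≤ shiftBy k b → a ≤ b
  reflects straight le = le
  reflects shifted  le = ≤-pred le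
  rest : ∀ i → 0 < rowLen (r′ ∷ T) (suc i) → rowEndCell k (r′ ∷ T) (suc i) ≤ rowEndCell k (r′ ∷ T) i
  rest i lt = reflects k (subst₂ _≤_ (rowEndCell-suc k r (r′ ∷ T) (suc i)) (rowEndCell-suc k r (r′ ∷ T) i) (h (suc i) lt))
... | p , l = n ∷ p , subst (λ z → offset k 1 + length r′ ≤ z + length r) (offset-0 k) (h 0 n′) ∷ l

rows-diagram : ∀ {A : Set} {k S} (T : Filling A) → NonEmpty T → Young k S → Rows k T S → Diagram k (shapeᵗ T)
rows-diagram {k = k} {S} T n Y R = steps-diagram k T n go
  where
  go : ∀ i → 0 < rowLen T (suc i) → rowEndCell k T (suc i) ≤ rowEndCell k T i
  go i lt with rowEndCell k T (suc i) in e
  ... | zero = z≤n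
  ... | suc l = subst (l <_) (sym (R i)) (inRow Y (<-trans (n<1+n i) (inCol Y
                  (≤-pred (subst (suc (offset k (suc i)) ≤_) e (m<m+n (offset k (suc i)) lt)))
                  (subst (l <_) (trans (sym e) (R (suc i))) ≤-refl))))

markOf : X′ → Mark
markOf (primed _)   = barred
markOf (unprimed _) = plain

letter-markOf : ∀ x → letter (markOf x) ∣ x ∣ ≡ x
letter-markOf (primed _)   = refl
letter-markOf (unprimed _) = refl

letter-unprimed : ∀ k {S m c v} → StateOK k S (at m c) → Tame k (at m c) → NeedsPlain k (proj₁ c) (proj₂ c) → Unprimed (letter m v)
letter-unprimed straight          ok refl np = unprimed
letter-unprimed shifted {m = plain}  ok t np = unprimed
letter-unprimed shifted {m = barred} ok t np = ⊥-elim (proj₂ ok np)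

record Built (k : Kind) (T : Filling X′) (S : Shape) : Set where
  field
    tableau  : Tableau k T
    rowsᵇ    : Rows k T S
    nonEmpty : NonEmpty T
open Built public

build-tableau : ∀ {k T S ss} vs → Built k T S → Young k S → Valid k S ss → All Placed ss → All (Tame k) ss →
  All (λ f → AllCells k (λ e → Before e f) T) (entries vs ss) → AllPairs Before (entries vs ss) → length vs ≡ length ss →
  Built k (build T vs ss) (total S ss)
build-tableau [] B Y [] [] [] h s l = B
build-tableau {k} {T} (v ∷ vs) B Y (_∷_ {s = s} ok vd) (at {m} {c} ∷ ps) (t ∷ ts) (h ∷ hs) (b ∷ bs) l =
  build-tableau vs record
    { tableau  = tableau-snoc (tableau B) Y A (rowsᵇ B) h (letter-unprimed k ok t)
    ; rowsᵇ    = rows-snoc {T = T} Y A (rowsᵇ B)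
    ; nonEmpty = nonEmpty-snoc (proj₁ c) (letter m v) (nonEmpty B) }
    (Young-⊕ Y A) vd ps ts (both hs b) bs (suc-injective l)
  where
  A = stateCell {k} {m = m} ok
  jc≡ = trans (rowsᵇ B (proj₁ c)) (rowEq A)
  both : ∀ {es} → All (λ f → AllCells k (λ e → Before e f) T) es → All (Before (c , letter m v)) es →
         All (λ f → AllCells k (λ e → Before e f) (snocRow (proj₁ c) (letter m v) T)) es
  both [] [] = []
  both {f ∷ _} (x ∷ xs) (y ∷ ys) = cell ∷ both xs ys
    where
    cell : AllCells k (λ e → Before e f) (snocRow (proj₁ c) (letter m v) T)
    cell n with in-snoc⁻ (proj₁ c) (letter m v) T (rows-≤ {T = T} Y A (rowsᵇ B)) n
    ... | inj₁ n′ = x n′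
    ... | inj₂ (refl , refl , refl) = subst (λ j → Before ((proj₁ c , j) , letter m v) f) (sym jc≡) y

build-in⁺ : ∀ {k T i j x} vs ss → In k T i j x → In k (build T vs ss) i j x
build-in⁺ []       []               n = n
build-in⁺ []       (_ ∷ _)          n = n
build-in⁺ (v ∷ vs) []               n = n
build-in⁺ (v ∷ vs) (none ∷ ss)      n = build-in⁺ vs ss n
build-in⁺ (v ∷ vs) (fresh _ ∷ ss)   n = build-in⁺ vs ss n
build-in⁺ (v ∷ vs) (at m c ∷ ss)    n = build-in⁺ vs ss (in-snoc⁺ (proj₁ c) (letter m v) n)

build-entries : ∀ {k T S ss P} vs → Young k S → Rows k T S → Valid k S ss → All Placed ss →
  AllCells k P (build T vs ss) → All P (entries vs ss)
build-entries []       Y R v ps h = []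
build-entries (v ∷ vs) Y R [] [] h = []
build-entries {k} {T} {P = P} (v ∷ vs) Y R (ok ∷ vd) (at {m} {c} ∷ ps) h =
  subst (λ j → P ((proj₁ c , j) , letter m v)) (trans (R (proj₁ c)) (rowEq A))
    (h (build-in⁺ vs _ (in-snoc-new k (proj₁ c) (letter m v) T (rows-≤ {T = T} Y A R)))) ∷
  build-entries vs (Young-⊕ Y A) (rows-snoc {T = T} Y A R) vd ps h
  where A = stateCell {k} {m = m} ok

build-in⁻ : ∀ {k T S ss i j x} vs → Young k S → Rows k T S → Valid k S ss → All Placed ss →
  In k (build T vs ss) i j x → In k T i j x ⊎ ((i , j) , x) ∈ entries vs ss
build-in⁻ []       Y R [] [] n = inj₁ n
build-in⁻ []       Y R (_ ∷ _) ps n = inj₁ n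
build-in⁻ (v ∷ vs) Y R [] [] n = inj₁ n
build-in⁻ {k} {T} (v ∷ vs) Y R (ok ∷ vd) (at {m} {c} ∷ ps) n
  with build-in⁻ vs (Young-⊕ Y (stateCell {k} {m = m} ok)) (rows-snoc {T = T} Y (stateCell {k} {m = m} ok) R) vd ps n
... | inj₂ e = inj₂ (there e)
... | inj₁ n′ with in-snoc⁻ (proj₁ c) (letter m v) T (rows-≤ {T = T} Y (stateCell {k} {m = m} ok) R) n′
...   | inj₁ n″ = inj₁ n″
...   | inj₂ (refl , e , refl) = inj₂ (here (cong (λ j → (proj₁ c , j) , letter m v) (trans e (trans (R (proj₁ c)) (rowEq (stateCell {k} {m = m} ok))))))

-- Chains

record Chain (k : Kind) (vs : List ℕ) (ss : List State) : Set where
  field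
    aligned : length vs ≡ length ss
    placed  : All Placed ss
    tame    : All (Tame k) ss
    valid   : Valid k (∅ k) ss
    steps   : Steps vs ss
open Chain public

rows-[] : ∀ {k} → Rows {A = X′} k [] (∅ k)
rows-[] i = +-identityʳ _

built-[] : ∀ {k} → Built k [] (∅ k)
built-[] = record { tableau = Tableau-[] ; rowsᵇ = rows-[] ; nonEmpty = [] }

chain-built : ∀ {k vs ss} → Chain k vs ss → Built k (build [] vs ss) (total (∅ k) ss)
chain-built {k} {vs} {ss} C = build-tableau vs built-[] (Young-∅ k) (valid C) (placed C) (tame C)
  (All.tabulate λ _ ()) (steps-sorted (steps C) (placed C)) (aligned C)

sorted-≡ : ∀ {es fs} → AllPairs Before es → AllPairs Before fs →
  (∀ {e} → e ∈ es → e ∈ fs) → (∀ {e} → e ∈ fs → e ∈ es) → es ≡ fs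
sorted-≡ [] [] f g = refl
sorted-≡ [] (_ ∷ _) f g with g (here refl)
... | ()
sorted-≡ (_ ∷ _) [] f g with f (here refl)
... | ()
sorted-≡ {e ∷ es} {e′ ∷ fs} (a ∷ as) (b ∷ bs) f g with heads (f (here refl)) (g (here refl))
  where
  heads : e ∈ e′ ∷ fs → e′ ∈ e ∷ es → e ≡ e′
  heads (here p)  _         = p
  heads (there _) (here q)  = sym q
  heads (there p) (there q) = ⊥-elim (before-irrefl (before-trans (All.lookup a q) (All.lookup b p)))
... | refl = cong (e ∷_) (sorted-≡ as bs (λ p → rest a (f (there p)) p) (λ p → rest b (g (there p)) p))
  where
  rest : ∀ {xs ys x} → All (Before e) xs → x ∈ e ∷ ys → x ∈ xs → x ∈ ys
  rest a (there q)   p = q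
  rest a (here refl) p = ⊥-elim (before-irrefl (All.lookup a p))

letter-injective : ∀ {m v m′ v′} → letter m v ≡ letter m′ v′ → m ≡ m′ × v ≡ v′
letter-injective {plain}  {m′ = plain}  refl = refl , refl
letter-injective {barred} {m′ = barred} refl = refl , refl
letter-injective {plain}  {m′ = barred} ()
letter-injective {barred} {m′ = plain}  ()

entries-injective : ∀ {vs ss vs′ ss′} → length vs ≡ length ss → length vs′ ≡ length ss′ → All Placed ss → All Placed ss′ →
  entries vs ss ≡ entries vs′ ss′ → vs ≡ vs′ × ss ≡ ss′
entries-injective {[]} {[]} {[]} {[]} _ _ _ _ _ = refl , refl
entries-injective {v ∷ vs} {_ ∷ ss} {v′ ∷ vs′} {_ ∷ ss′} l l′ (at ∷ ps) (at ∷ ps′) e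
  with letter-injective (cong proj₂ (∷-injectiveˡ e)) | cong proj₁ (∷-injectiveˡ e)
     | entries-injective {vs} {ss} {vs′} {ss′} (suc-injective l) (suc-injective l′) ps ps′ (∷-injectiveʳ e)
... | refl , refl | refl | refl , refl = refl , refl
entries-injective {[]} {[]} {_ ∷ _} {_ ∷ _} _ _ _ (at ∷ _) ()
entries-injective {_ ∷ _} {_ ∷ _} {[]} {[]} _ _ (at ∷ _) _ ()

-- The entries of a chain are the cells of its tableau sorted by the strict order `Before`, and a
-- sorted list is determined by its members.
chain-unique : ∀ {k vs ss vs′ ss′} → Chain k vs ss → Chain k vs′ ss′ → build [] vs ss ≡ build [] vs′ ss′ → vs ≡ vs′ × ss ≡ ss′
chain-unique {k} C C′ e = entries-injective (aligned C) (aligned C′) (placed C) (placed C′)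
  (sorted-≡ (steps-sorted (steps C) (placed C)) (steps-sorted (steps C′) (placed C′)) (sub C C′ e) (sub C′ C (sym e)))
  where
  sub : ∀ {vs ss vs′ ss′} → Chain k vs ss → Chain k vs′ ss′ → build [] vs ss ≡ build [] vs′ ss′ →
        ∀ {e} → e ∈ entries vs ss → e ∈ entries vs′ ss′
  sub {vs} {ss} {vs′} {ss′} C C′ q m = All.lookup (build-entries {T = []} {P = _∈ entries vs′ ss′} vs (Young-∅ k) rows-[] (valid C) (placed C)
    (λ n → [ (λ ()) , id ]′ (build-in⁻ {T = []} vs′ (Young-∅ k) rows-[] (valid C′) (placed C′) (subst (λ T → In k T _ _ _) q n)))) m

-- The chain of a tableau

-- The largest entry stands at a removable corner. It is found by comparing the last entry of the
-- first row with the largest entry of the rows below.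
record Largest (k : Kind) (T : Filling X′) : Set where
  field
    {i}   : ℕ
    {y}   : X′
    {T⁻}  : Filling X′
    split : T ≡ snocRow i y T⁻
    i≤    : i ≤ length T⁻
    below : AllCells k (λ e → Before e ((i , rowEndCell k T⁻ i) , y)) T⁻
    diag  : Diagram k (shapeᵗ T⁻)

largest-in : ∀ {k T} (L : Largest k T) → In k T (Largest.i L) (rowEndCell k (Largest.T⁻ L) (Largest.i L)) (Largest.y L)
largest-in {k} L = subst (λ U → In k U i (rowEndCell k T⁻ i) y) (sym split) (in-snoc-new k i y T⁻ i≤)
  where open Largest L

before-shift : ∀ k {i j i′ j′ x y} → Before ((i , j) , x) ((i′ , j′) , y) →
               Before ((suc i , shiftBy k j) , x) ((suc i′ , shiftBy k j′) , y)
before-shift k (less lt)   = less lt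
before-shift k (across lt) = across (shiftBy-mono-< k lt)
before-shift k (along lt)  = along (s<s lt)

before-total : ∀ {k T i j i′ j′ x y} → Tableau k T → In k T i j x → In k T i′ j′ y → i < i′ →
               Before ((i , j) , x) ((i′ , j′) , y) ⊎ Before ((i′ , j′) , y) ((i , j) , x)
before-total {i = i} {j} {i′} {j′} {x} {y} Tb n m lt with <-cmp (rank x) (rank y)
... | tri< l _ _ = inj₁ (less l)
... | tri> _ _ l = inj₂ (less l)
... | tri≈ _ e _ with rank-injective {x} {y} e
before-total {x = primed _}   Tb n m lt | tri≈ _ e _ | refl = inj₁ (along lt)
before-total {j = j} {j′ = j′} {x = unprimed _} Tb n m lt | tri≈ _ e _ | refl with <-cmp j j′
... | tri< l _ _ = inj₁ (across l)
... | tri> _ _ l = inj₂ (across l)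
... | tri≈ _ refl _ with proj₂ (colsOK Tb lt n m) refl
...   | ()

linked-head : ∀ {k a b b′ μ} → b′ ≤ b → Linked (λ a b → offset k 1 + b ≤ a) (a ∷ b ∷ μ) → offset k 1 + b′ ≤ a
linked-head {k} le (l ∷ _) = ≤-trans (+-monoʳ-≤ (offset k 1) le) l

row₀-before : ∀ {k r y T} → Tableau k ((r ∷ʳ y) ∷ T) → ∀ {j x} → Nth r j x → Before ((0 , j) , x) ((0 , length r) , y)
row₀-before {r = r} Tb n = rowPair-before (nth-< n) (rowsOK Tb (nth-< n) (here (nth-++ˡ n)) (here (nth-end r)))

largest-single : ∀ {k} r y → Tableau k ((r ∷ʳ y) ∷ []) → Largest k ((r ∷ʳ y) ∷ [])
largest-single [] y Tb = record { split = refl ; i≤ = z≤n {0} ; below = λ () ; diag = [] , [] }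
largest-single {k} r@(_ ∷ _) y Tb = record { split = refl ; i≤ = z≤n {1} ; below = b ; diag = (z<s ∷ []) , [-] }
  where
  b : AllCells k (λ e → Before e ((0 , offset k 0 + length r) , y)) (r ∷ [])
  b (here n) = subst (λ z → Before _ ((0 , z + length r) , y)) (sym (offset-0 k)) (row₀-before Tb n)

rowLen-snoc-≤ : ∀ {A : Set} i (y : A) T → i ≤ length T → ∀ r → rowLen T r ≤ rowLen (snocRow i y T) r
rowLen-snoc-≤ i y T le r with i ≟ r
... | yes refl = subst (rowLen T i ≤_) (sym (rowLen-snoc-same i y T le)) (n≤1+n _)
... | no ne = ≤-reflexive (sym (rowLen-snoc-other i y T le ne))

module _ {k : Kind} (r : List X′) (y : X′) (T : Filling X′) (Tb : Tableau k ((r ∷ʳ y) ∷ T))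
         (D : Diagram k (shapeᵗ ((r ∷ʳ y) ∷ T))) (M : Largest k T) where
  private
    module M = Largest M
    f : Entry
    f = (suc M.i , shiftBy k (rowEndCell k M.T⁻ M.i)) , M.y
    e : Entry
    e = (0 , length r) , y
    R = r ∷ʳ y

    rest-before : ∀ {i j x} → In k T i j x → Before ((suc i , shiftBy k j) , x) f ⊎ ((suc i , shiftBy k j) , x) ≡ f
    rest-before n with in-snoc⁻ M.i M.y M.T⁻ M.i≤ (subst (λ U → In k U _ _ _) M.split n)
    ... | inj₁ n′ = inj₁ (before-shift k (M.below n′))
    ... | inj₂ (refl , refl , refl) = inj₂ refl

    row-len : length R ≡ suc (length r)
    row-len = length-snoc r y

  largest-below : Before e f → Largest k (R ∷ T)
  largest-below b = record { split = cong (R ∷_) M.split ; i≤ = s≤s M.i≤ ; below = bel ; diag = d M.T⁻ M.diag M.split M.i≤ }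
    where
    bel : AllCells k (λ e → Before e ((suc M.i , rowEndCell k (R ∷ M.T⁻) (suc M.i)) , M.y)) (R ∷ M.T⁻)
    bel {x = x} n = subst (λ z → Before (_ , x) ((suc M.i , z) , M.y)) (sym (rowEndCell-suc k R M.T⁻ M.i)) (go n)
      where
      go : ∀ {i j x} → In k (R ∷ M.T⁻) i j x → Before ((i , j) , x) f
      go (here n) with nth-snoc⁻ r n
      ... | inj₁ n′ = before-trans (row₀-before Tb n′) b
      ... | inj₂ (refl , refl) = b
      go (there n) = before-shift k (M.below n)
    d : ∀ U → Diagram k (shapeᵗ U) → T ≡ snocRow M.i M.y U → M.i ≤ length U → Diagram k (shapeᵗ (R ∷ U))
    d [] _ _ _ = (All.head (proj₁ D) ∷ []) , [-]
    d (q ∷ U) (ps , ls) eq le = (All.head (proj₁ D) ∷ ps) , (lk T (proj₂ D)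
        (subst (length q ≤_) (cong (λ z → rowLen z 0) (sym eq)) (rowLen-snoc-≤ M.i M.y (q ∷ U) le 0)) ∷ ls)
      where
      lk : ∀ W → Linked (λ a b → offset k 1 + b ≤ a) (shapeᵗ (R ∷ W)) → length q ≤ rowLen W 0 → offset k 1 + length q ≤ length R
      lk (w ∷ W) l le = linked-head {k} le l
      lk []      l le = ⊥-elim (<⇒≱ (All.head ps) le)

  -- Removing the end of the first row leaves a diagram unless the second row reaches the same
  -- column. By `clash` it does not, since an entry below `y` would come after `y`, the supposed
  -- maximum.
  largest-above : Before f e → 0 < length T → Largest k (R ∷ T)
  largest-above b lt = record { split = refl ; i≤ = z≤n {suc (length T)} ; below = bel ; diag = d T lt D (λ n → n) }
    where
    bel : AllCells k (λ e → Before e ((0 , offset k 0 + length r) , y)) (r ∷ T)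
    bel {x = x} n = subst (λ z → Before (_ , x) ((0 , z + length r) , y)) (sym (offset-0 k)) (go n)
      where
      go : ∀ {i j x} → In k (r ∷ T) i j x → Before ((i , j) , x) e
      go (here n) = row₀-before Tb n
      go (there n) with rest-before n
      ... | inj₁ b′ = before-trans b′ b
      ... | inj₂ q = subst (λ g → Before g e) (sym q) b
    clash : ∀ {x} → In k (R ∷ T) 1 (length r) x → ⊥
    clash n = go n refl refl
      where
      go : ∀ {i j x} → In k (R ∷ T) i j x → i ≡ 1 → j ≡ length r → ⊥
      go (there n) refl q with columnPair-before z<s (colsOK Tb z<s (here (nth-end r)) (subst (λ z → In k (R ∷ T) 1 z _) q (there n)))
      ... | b′ with rest-before n
      ...   | inj₁ b″ = before-irrefl (before-trans b (before-trans b′ (subst (λ z → Before ((1 , z) , _) f) q b″)))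
      ...   | inj₂ p = before-irrefl (before-trans b (subst (Before e) (trans (cong (λ z → ((1 , z) , _)) (sym q)) p) b′))
    d : ∀ U → 0 < length U → Diagram k (shapeᵗ (R ∷ U)) → (∀ {i j x} → In k (R ∷ U) i j x → In k (R ∷ T) i j x) → Diagram k (shapeᵗ (r ∷ U))
    d (q ∷ U) _ (_ ∷ n ∷ ps , l ∷ ls) inc = (≤-trans (≤-trans n (m≤n+m _ (offset k 1))) le ∷ n ∷ ps) , (le ∷ ls)
      where
      le : offset k 1 + length q ≤ length r
      le with m≤n⇒m<n∨m≡n l
      ... | inj₁ lt = ≤-pred (subst (suc (offset k 1 + length q) ≤_) row-len lt)
      ... | inj₂ eq = ⊥-elim (clash (inc (proj₂ (in-exists k (R ∷ q ∷ U) 1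
                        (≤-pred (≤-trans (m<m+n (offset k 1) n) (≤-reflexive (trans eq row-len))))
                        (≤-reflexive (sym (trans eq row-len)))))))

snocView : ∀ {A : Set} (r : List A) → 0 < length r → ∃₂ λ r₀ y → r ≡ r₀ ∷ʳ y
snocView r lt with initLast r
snocView .[]         () | []
snocView .(r ∷ʳ y) lt | r ∷ʳ′ y = r , y , refl

tableau-tail : ∀ {k r T} → Tableau k (r ∷ T) → Tableau k T
tableau-tail {k} Tb = record
  { rowsOK  = λ lt n m → rowsOK Tb (shiftBy-mono-< k lt) (there n) (there m)
  ; colsOK  = λ lt n m → colsOK Tb (s<s lt) (there n) (there m)
  ; plainOK = λ n np → plainOK Tb (there n) (np′ k np) }
  where
  np′ : ∀ k {i j} → NeedsPlain k i j → NeedsPlain k (suc i) (shiftBy k j)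
  np′ straight _ = tt
  np′ shifted  e = cong suc e

largest : ∀ {k} r T → Tableau k (r ∷ T) → Diagram k (shapeᵗ (r ∷ T)) → Largest k (r ∷ T)
largest r T Tb D@(n ∷ _ , _) with snocView r n
largest ._ [] Tb D | r₀ , y , refl = largest-single r₀ y Tb
largest {k} ._ (q ∷ T) Tb D@(_ ∷ ps , _ ∷ ls) | r₀ , y , refl
  with largest q T (tableau-tail Tb) (ps , ls)
... | M with before-total Tb (here (nth-end r₀)) (there (largest-in M)) z<s
...   | inj₁ b = largest-below r₀ y (q ∷ T) Tb D M b
...   | inj₂ b = largest-above r₀ y (q ∷ T) Tb D M b z<s

build-++ : ∀ T vs ss {vs′ ss′} → length vs ≡ length ss → build T (vs ++ vs′) (ss ++ ss′) ≡ build (build T vs ss) vs′ ss′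
build-++ T []       []             e = refl
build-++ T (v ∷ vs) (none ∷ ss)    e = build-++ T vs ss (suc-injective e)
build-++ T (v ∷ vs) (fresh _ ∷ ss) e = build-++ T vs ss (suc-injective e)
build-++ T (v ∷ vs) (at _ _ ∷ ss)  e = build-++ _ vs ss (suc-injective e)

entries-++ : ∀ vs ss {vs′ ss′} → length vs ≡ length ss → entries (vs ++ vs′) (ss ++ ss′) ≡ entries vs ss ++ entries vs′ ss′
entries-++ []       []             e = refl
entries-++ (v ∷ vs) (none ∷ ss)    e = entries-++ vs ss (suc-injective e)
entries-++ (v ∷ vs) (fresh _ ∷ ss) e = entries-++ vs ss (suc-injective e)
entries-++ (v ∷ vs) (at _ _ ∷ ss)  e = cong (_ ∷_) (entries-++ vs ss (suc-injective e))

valid-++⁺ : ∀ {k S ss ss′} → Valid k S ss → Valid k (total S ss) ss′ → Valid k S (ss ++ ss′)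
valid-++⁺ []       w = w
valid-++⁺ (ok ∷ v) w = ok ∷ valid-++⁺ v w

valid-++⁻ : ∀ {k S} ss {ss′} → Valid k S (ss ++ ss′) → Valid k S ss × Valid k (total S ss) ss′
valid-++⁻ []       v        = [] , v
valid-++⁻ (s ∷ ss) (ok ∷ v) = map₁ (ok ∷_) (valid-++⁻ ss v)

before-step : ∀ {c d m m′ x y} → Before (c , letter m x) (d , letter m′ y) → Step (x , at m c) (y , at m′ d)
before-step {m = m} {m′} {x} {y} b = go m m′ b (<-cmp x y)
  where
  go : ∀ {c d} m m′ → Before (c , letter m x) (d , letter m′ y) → Tri (x < y) (x ≡ y) (y < x) → Step (x , at m c) (y , at m′ d)
  go m      m′     b          (tri< lt _ _)   = inj₁ lt
  go m      m′     b          (tri> _ _ gt)   = ⊥-elim (<⇒≱ (letter-mono m′ m gt) (before-≼ b))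
  go plain  plain  (less lt)  (tri≈ _ refl _) = ⊥-elim (n≮n _ lt)
  go plain  plain  (across l) (tri≈ _ refl _) = inj₂ (refl , plain< l)
  go plain  barred (less lt)  (tri≈ _ refl _) = ⊥-elim (<⇒≱ lt (n≤1+n _))
  go barred plain  b          (tri≈ _ refl _) = inj₂ (refl , mixed)
  go barred barred (less lt)  (tri≈ _ refl _) = ⊥-elim (n≮n _ lt)
  go barred barred (along l)  (tri≈ _ refl _) = inj₂ (refl , barred< l)

steps-snoc : ∀ {vs ss v m c} → Steps vs ss → All Placed ss → All (λ e → Before e (c , letter m v)) (entries vs ss) →
             Steps (vs ∷ʳ v) (ss ∷ʳ at m c)
steps-snoc [] [] [] = [-]
steps-snoc [-] (at ∷ []) (b ∷ []) = before-step b ∷ [-]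
steps-snoc (s ∷ st) (at ∷ ps@(at ∷ _)) (_ ∷ bs) = s ∷ steps-snoc st ps bs

∷ʳ-length : ∀ {A B : Set} {xs : List A} {ys : List B} {x y} → length xs ≡ length ys → length (xs ∷ʳ x) ≡ length (ys ∷ʳ y)
∷ʳ-length {xs = xs} {ys} {x} {y} e = trans (length-snoc xs x) (trans (cong suc e) (sym (length-snoc ys y)))

chain-snoc : ∀ {k vs ss m c v} → Chain k vs ss → StateOK k (total (∅ k) ss) (at m c) → Tame k (at m c) →
  All (λ e → Before e (c , letter m v)) (entries vs ss) → Chain k (vs ∷ʳ v) (ss ∷ʳ at m c)
chain-snoc {vs = vs} {ss} C ok t b = record
  { aligned = ∷ʳ-length {xs = vs} {ss} (aligned C)
  ; placed  = All.++⁺ (placed C) (at ∷ [])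
  ; tame    = All.++⁺ (tame C) (t ∷ [])
  ; valid   = valid-++⁺ (valid C) (ok ∷ [])
  ; steps   = steps-snoc (steps C) (placed C) b }

ChainOf : Kind → Filling X′ → Set
ChainOf k T = ∃₂ λ vs ss → Chain k vs ss × build [] vs ss ≡ T

diagram-cell : ∀ {k S} (T : Filling X′) i y → Young k S → Rows k T S → i ≤ length T → Diagram k (shapeᵗ (snocRow i y T)) →
               Addable S (i , rowEndCell k T i)
diagram-cell {k} {S} T i y Y R le D = sym (R i) ⊹ ≤-antisym (≮⇒≥ λ lt → n≮n _ (subst (rowEndCell k T i <_) (sym (R i)) (inRow Y lt))) (go i le D)
  where
  go : ∀ i → i ≤ length T → Diagram k (shapeᵗ (snocRow i y T)) → i ≤ cols S (rowEndCell k T i)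
  go zero    le D = z≤n
  go (suc i) le D = inCol Y (≤-trans (offset-mono k (n≤1+n i)) (m≤m+n _ _)) (subst (rowEndCell k T (suc i) <_) (R i)
    (subst₂ _≤_ (trans (cong (offset k (suc i) +_) (rowLen-snoc-same (suc i) y T le)) (+-suc _ _))
      (cong (offset k i +_) (rowLen-snoc-other (suc i) y T le 1+n≢n))
      (diagram-steps k (snocRow (suc i) y T) D i (subst (0 <_) (sym (rowLen-snoc-same (suc i) y T le)) z<s))))

letter-ok : ∀ k {S T} i y → Tableau k (snocRow i y T) → i ≤ length T → Addable S (i , rowEndCell k T i) →
            let s = at (markOf y) (i , rowEndCell k T i) in StateOK k S s × Tame k s
letter-ok straight {T = T} i y Tb le A with plainOK Tb (in-snoc-new straight i y T le) tt
... | unprimed = (A , tt) , refl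
letter-ok shifted {T = T} i (unprimed _) Tb le A = (A , tt) , tt
letter-ok shifted {T = T} i (primed v) Tb le A = (A , nd) , tt
  where
  nd : ¬ i ≡ rowEndCell shifted T i
  nd e with plainOK Tb (in-snoc-new shifted i (primed v) T le) e
  ... | ()

-- The chain is built from its end by removing the largest entry; `n` makes the recursion on the
-- size structural.
chainOf : ∀ {k} n T → size T ≡ n → Tableau k T → Diagram k (shapeᵗ T) → ChainOf k T
chainOf n [] _ Tb D = [] , [] , record { aligned = refl ; placed = [] ; tame = [] ; valid = [] ; steps = [] } , refl
chainOf {k} n (r ∷ T) e Tb D = go n e (largest r T Tb D)
  where
  go : ∀ n → size (r ∷ T) ≡ n → Largest k (r ∷ T) → ChainOf k (r ∷ T)
  go zero e L = ⊥-elim (0≢1+n (trans (sym e) (trans (cong size (Largest.split L)) (size-snoc _ _ (Largest.T⁻ L)))))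
  go (suc n) e L with chainOf n (Largest.T⁻ L) (suc-injective (trans (sym (size-snoc _ _ (Largest.T⁻ L))) (trans (cong size (sym (Largest.split L))) e)))
                        (tableau-unsnoc (Largest.i L) (Largest.y L) (subst (Tableau k) (Largest.split L) Tb)) (Largest.diag L)
  ... | vs , ss , C , refl = vs ∷ʳ ∣ y ∣ , ss ∷ʳ at (markOf y) c , chain-snoc C (proj₁ ok) (proj₂ ok) b ,
        trans (build-++ [] vs ss (aligned C)) (trans (cong (λ z → snocRow i z (build [] vs ss)) (letter-markOf y)) (sym (Largest.split L)))
    where
    open Largest L using (i; y)
    c = i , rowEndCell k (build [] vs ss) i
    B = chain-built C
    A = diagram-cell (build [] vs ss) i y (Young-total ss (Young-∅ k) (valid C)) (rowsᵇ B) (Largest.i≤ L) (subst (Diagram k ∘ shapeᵗ) (Largest.split L) D)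
    ok = letter-ok k i y (subst (Tableau k) (Largest.split L) Tb) (Largest.i≤ L) A
    b : All (λ e → Before e (c , letter (markOf y) ∣ y ∣)) (entries vs ss)
    b = subst (λ z → All (λ e → Before e (c , z)) (entries vs ss)) (sym (letter-markOf y))
          (build-entries {T = []} vs (Young-∅ k) rows-[] (valid C) (placed C) (Largest.below L))

-- One insertion into a chain

data Loaded : State → Set where
  fresh : Loaded (fresh plain)
  at    : ∀ {m c} → Loaded (at m c)

pass-placed : ∀ {k S ev ss ss′ o} → All Loaded ss → Pass k S ev ss ss′ o → All Placed ss′
pass-placed []         []             = []
pass-placed (fresh ∷ l) (born _ ∷ p)   = at ∷ pass-placed l p
pass-placed (at ∷ l)   (still ∷ p)    = at ∷ pass-placed l p
pass-placed (at ∷ l)   (miss _ ∷ p)   = at ∷ pass-placed l p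
pass-placed (at ∷ l)   (down _ _ ∷ p) = at ∷ pass-placed l p
pass-placed (at ∷ l)   (right _ ∷ p)  = at ∷ pass-placed l p
pass-placed (at ∷ l)   (turn _ _ ∷ p) = at ∷ pass-placed l p

act-tame : ∀ k {S ev s s′ o} → Loaded s → Tame k s → Act k S ev s s′ o → Tame k s′
act-tame straight fresh t (born _)   = refl
act-tame straight at    t still      = t
act-tame straight at    t (miss _)   = t
act-tame straight at    t (down _ _) = refl
act-tame straight at    () (right _)
act-tame straight at    t (turn () _)
act-tame shifted  _     t (born _)   = tt
act-tame shifted  _     t still      = tt
act-tame shifted  _     t (miss _)   = tt
act-tame shifted  _     t (down _ _) = tt
act-tame shifted  _     t (right _)  = tt
act-tame shifted  _     t (turn _ _) = tt

pass-tame : ∀ k {S ev ss ss′ o} → All Loaded ss → All (Tame k) ss → Pass k S ev ss ss′ o → All (Tame k) ss′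
pass-tame k []      []       []      = []
pass-tame k (l ∷ ls) (t ∷ ts) (a ∷ p) = act-tame k l t a ∷ pass-tame k ls ts p

placed-loaded : ∀ {ss} → All Placed ss → All Loaded ss
placed-loaded = All.map λ { at → at }

placed-plainFresh : ∀ {ss} → All Placed ss → All PlainFresh ss
placed-plainFresh = All.map λ { at → tt }

tame-fresh : ∀ k → Tame k (fresh plain)
tame-fresh straight = tt
tame-fresh shifted  = tt

valid-insert : ∀ {k S} ss {ss′} → Valid k S (ss ++ ss′) → Valid k S (ss ++ fresh plain ∷ ss′)
valid-insert []       v        = fresh-ok ∷ v
valid-insert (s ∷ ss) (ok ∷ v) = ok ∷ valid-insert ss v

valid-delete : ∀ {k S} ss {ss′} → Valid k S (ss ++ fresh plain ∷ ss′) → Valid k S (ss ++ ss′)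
valid-delete []       (_ ∷ v)  = v
valid-delete (s ∷ ss) (ok ∷ v) = ok ∷ valid-delete ss v

total-insert : ∀ S ss {ss′} → total S (ss ++ fresh plain ∷ ss′) ≡ total S (ss ++ ss′)
total-insert S []       = refl
total-insert S (s ∷ ss) = total-insert (S ⊕ˢ s) ss

step-≤ : ∀ {x y s t} → Step (x , s) (y , t) → x ≤ y
step-≤ (inj₁ lt)         = <⇒≤ lt
step-≤ (inj₂ (refl , _)) = ≤-refl

steps-insert : ∀ {x vs₂} vs₁ ss₁ {ss₂} → Steps (vs₁ ++ vs₂) (ss₁ ++ ss₂) → length vs₁ ≡ length ss₁ →
  All Placed (ss₁ ++ ss₂) → All (_≤ x) vs₁ → All (x <_) vs₂ → Steps (vs₁ ++ x ∷ vs₂) (ss₁ ++ fresh plain ∷ ss₂)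
steps-insert [] [] [] l ps a b = [-]
steps-insert [] [] [-] l ps a (lt ∷ _) = inj₁ lt ∷ [-]
steps-insert [] [] (s ∷ st) l ps a (lt ∷ _) = inj₁ lt ∷ (s ∷ st)
steps-insert (v ∷ []) (s ∷ []) st l (at ∷ ps) (le ∷ a) b = ascent le ∷ steps-insert [] [] (rest st) refl ps [] b
  where
  ascent : ∀ {v x m c} → v ≤ x → Step (v , at m c) (x , fresh plain)
  ascent le with m≤n⇒m<n∨m≡n le
  ... | inj₁ lt = inj₁ lt
  ... | inj₂ e  = inj₂ (e , unplaced)
  rest : ∀ {v s vs ss} → Steps (v ∷ vs) (s ∷ ss) → Steps vs ss
  rest [-]      = []
  rest (_ ∷ st) = st
steps-insert (v ∷ w ∷ vs₁) (s ∷ t ∷ ss₁) (x ∷ st) l (_ ∷ ps) (_ ∷ a) b =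
  x ∷ steps-insert (w ∷ vs₁) (t ∷ ss₁) st (suc-injective l) ps a b

steps-≤ : ∀ {v vs ss} → Steps (v ∷ vs) ss → All (v ≤_) vs
steps-≤ [-]      = []
steps-≤ (s ∷ st) = step-≤ s ∷ All.map (≤-trans (step-≤ s)) (steps-≤ st)

-- No `Asc` leads from a fresh letter to a placed one, so the recovered letter is strictly smaller
-- than its successor. It is thus the last among its equals, exactly where a new insertion would put
-- it.
steps-delete : ∀ {x vs₂} vs₁ ss₁ {ss₂} → Steps (vs₁ ++ x ∷ vs₂) (ss₁ ++ fresh plain ∷ ss₂) → length vs₁ ≡ length ss₁ →
  All Placed (ss₁ ++ ss₂) → Steps (vs₁ ++ vs₂) (ss₁ ++ ss₂) × All (_≤ x) vs₁ × All (x <_) vs₂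
steps-delete [] [] [-] l ps = [] , [] , []
steps-delete {x} [] [] (s ∷ st) l (at ∷ ps) = st , [] , lt s ∷ All.map (<-≤-trans (lt s)) (steps-≤ st)
  where
  lt : ∀ {y m c} → Step (x , fresh plain) (y , at m c) → x < y
  lt (inj₁ l) = l
  lt (inj₂ (_ , ()))
steps-delete (v ∷ []) (s ∷ []) (x ∷ st) l (p ∷ ps) with steps-delete [] [] st refl ps
... | st′ , _ , b = join x st′ b , (step-≤ x ∷ []) , b
  where
  join : ∀ {v x s vs ss} → Step (v , s) (x , fresh plain) → Steps vs ss → All (x <_) vs → Steps (v ∷ vs) (s ∷ ss)
  join a []       _        = [-]
  join a [-]      (lt ∷ _) = inj₁ (≤-<-trans (step-≤ a) lt) ∷ [-]
  join a (s ∷ st) (lt ∷ _) = inj₁ (≤-<-trans (step-≤ a) lt) ∷ (s ∷ st)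
steps-delete (v ∷ w ∷ vs₁) (s ∷ t ∷ ss₁) (x ∷ st) l (_ ∷ ps) with steps-delete (w ∷ vs₁) (t ∷ ss₁) st (suc-injective l) ps
... | st′ , (a ∷ as) , b = x ∷ st′ , (≤-trans (step-≤ x) a ∷ a ∷ as) , b

++-length-≡ : ∀ {A B : Set} (xs : List A) (xs′ : List B) {ys ys′} → length xs ≡ length xs′ → length ys ≡ length ys′ →
              length (xs ++ ys) ≡ length (xs′ ++ ys′)
++-length-≡ xs xs′ e e′ = trans (length-++ xs) (trans (cong₂ _+_ e e′) (sym (length-++ xs′)))

module _ {k : Kind} {vs₁ vs₂ : List ℕ} {ss₁ ss₂ : List State} (l₁ : length vs₁ ≡ length ss₁) where

  chain-length₂ : Chain k (vs₁ ++ vs₂) (ss₁ ++ ss₂) → length vs₂ ≡ length ss₂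
  chain-length₂ C = +-cancelˡ-≡ (length vs₁) _ _
    (trans (sym (length-++ vs₁)) (trans (aligned C) (trans (length-++ ss₁) (cong (_+ length ss₂) (sym l₁)))))

  module _ {x : ℕ} {ss′ : List State} {q : Cell}
           (P : Pass k (∅ k) nothing (ss₁ ++ fresh plain ∷ ss₂) ss′ (just q)) where

    chain-insert : Chain k (vs₁ ++ vs₂) (ss₁ ++ ss₂) → All (_≤ x) vs₁ → All (x <_) vs₂ → Chain k (vs₁ ++ x ∷ vs₂) ss′
    chain-insert C a b = record
      { aligned = trans (++-length-≡ vs₁ ss₁ l₁ (cong suc (chain-length₂ C))) (sym (pass-length P))
      ; placed  = pass-placed loaded P
      ; tame    = pass-tame k loaded (All.++⁺ (proj₁ ts) (tame-fresh k ∷ proj₂ ts)) P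
      ; valid   = valid′ (passed (Young-∅ k) tt v P)
      ; steps   = steps⁺ (Young-∅ k) tt v P (steps-insert vs₁ ss₁ (steps C) l₁ (placed C) a b) }
      where
      v = valid-insert ss₁ (valid C)
      ps = All.++⁻ ss₁ (placed C)
      ts = All.++⁻ ss₁ (tame C)
      loaded = All.++⁺ (placed-loaded (proj₁ ps)) (fresh ∷ placed-loaded (proj₂ ps))

    private
      uncross : ∀ {es e fs} → AllPairs Before (es ++ e ∷ fs) →
                All (λ f → All (λ d → Before d f) es) fs × All (Before e) fs × AllPairs Before fs × All (λ d → Before d e) es
      uncross {[]} (a ∷ as) = All.map (λ _ → []) a , a , as , []
      uncross {d ∷ es} (a ∷ as) with uncross {es} as | All.++⁻ es a
      ... | c , b , s , h | _ , (de ∷ df) = All.zipWith (λ (x , y) → x ∷ y) (df , c) , b , s , de ∷ h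

      letters-build : ∀ {Q : X′ → Set} {T} vs ss → AllLetters Q T → All (Q ∘ proj₂) (entries vs ss) → AllLetters Q (build T vs ss)
      letters-build []       []             t e = t
      letters-build []       (_ ∷ _)        t e = t
      letters-build (v ∷ vs) []             t e = t
      letters-build (v ∷ vs) (none ∷ ss)    t e = letters-build vs ss t e
      letters-build (v ∷ vs) (fresh _ ∷ ss) t e = letters-build vs ss t e
      letters-build (v ∷ vs) (at m c ∷ ss)  t (p ∷ ps) = letters-build vs ss (allLetters-snoc (proj₁ c) p t) ps

    -- The letters up to `x` do not move, and into their part of the tableau `x` goes simply at the
    -- end of the first row; the larger letters are then added by `build-into`.
    into-build : Chain k (vs₁ ++ vs₂) (ss₁ ++ ss₂) → Steps (vs₁ ++ x ∷ vs₂) ss′ →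
      Σ[ z ∈ X′ ] Into k (unprimed x) (build [] (vs₁ ++ vs₂) (ss₁ ++ ss₂)) (build [] (vs₁ ++ x ∷ vs₂) ss′) q z
    into-build C st with pass-++⁻ ss₁ P
    ... | pre′ , rest′ , mid , refl , p₁ , p₂ with Pass-functional p₁ (idle (placed-settled (All.++⁻ˡ ss₁ (placed C))))
    into-build C st | .ss₁ , at plain p ∷ rest , nothing , refl , p₁ , born e ∷ p₂ | refl , refl =
      subst₂ (λ T T′ → Σ[ z ∈ X′ ] Into k (unprimed x) T T′ q z) (sym (build-++ [] vs₁ ss₁ l₁)) (sym (build-++ [] vs₁ ss₁ l₁))
        (build-into k {T = T₀} vs₂ Y₀ A R₀ (rows-snoc {T = T₀} Y₀ A R₀) (proj₂ vv) (proj₂ ps) (proj₂ ts) p₂ (chain-length₂ C)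
          start-into (All.map (λ {f} h → allLetters-snoc (proj₁ p) (before-≼ (proj₂ h)) (letters-build vs₁ ss₁ [] (All.map before-≼ (proj₁ h))))
            (All.zipWith id (c₁ , c₂))) c₂ c₃)
      where
      ps = All.++⁻ ss₁ (placed C)
      ts = All.++⁻ ss₁ (tame C)
      vv = valid-++⁻ ss₁ (valid C)
      T₀ = build [] vs₁ ss₁
      S₁ = total (∅ k) ss₁
      Y₀ = Young-total ss₁ (Young-∅ k) (proj₁ vv)
      l-rest : length vs₂ ≡ length rest
      l-rest = trans (chain-length₂ C) (sym (pass-length p₂))
      sorted : AllPairs Before (entries vs₁ ss₁ ++ (p , unprimed x) ∷ entries vs₂ rest)
      sorted = subst (AllPairs Before) (entries-++ vs₁ ss₁ l₁) (steps-sorted st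
        (All.++⁺ (proj₁ ps) (at ∷ pass-placed (placed-loaded (proj₂ ps)) p₂)))
      us = uncross {entries vs₁ ss₁} sorted
      c₁ = proj₁ us
      c₂ = proj₁ (proj₂ us)
      c₃ = proj₁ (proj₂ (proj₂ us))
      c₄ = proj₂ (proj₂ (proj₂ us))
      A : Addable S₁ p
      A = subst (Addable S₁) (sym e) (start-addable plain Y₀ λ _ → refl)
      presorted : ∀ {es fs} → AllPairs Before (es ++ fs) → AllPairs Before es
      presorted {[]}     _        = []
      presorted {_ ∷ es} (a ∷ as) = All.++⁻ˡ es a ∷ presorted as
      R₀ : Rows k T₀ S₁
      R₀ = rowsᵇ (build-tableau vs₁ built-[] (Young-∅ k) (proj₁ vv) (proj₁ ps) (proj₁ ts) (All.tabulate λ _ ()) (presorted sorted) l₁)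
      small : AllLetters (_≼ unprimed x) T₀
      small = letters-build vs₁ ss₁ [] (All.map before-≼ c₄)
      rowStop : ∀ {T} → AllLetters (_≼ unprimed x) T → RowStop (unprimed x) T
      rowStop []      = []
      rowStop (a ∷ _) = here a
      start-into : Into k (unprimed x) T₀ (snocRow (proj₁ p) (unprimed x) T₀) p (unprimed x)
      start-into = go k R₀ e
        where
        go : ∀ k → Rows k T₀ S₁ → p ≡ start S₁ plain → Into k (unprimed x) T₀ (snocRow (proj₁ p) (unprimed x) T₀) p (unprimed x)
        go straight R refl = stop (rowStop small)
        go shifted  R refl = 1 , mix-end (cong (0 ,_) (R 0)) (stop (stopRow 0 small z≤n)) , s≤s z≤n

chain-undo : ∀ {k vs ss Z p} → Chain k vs ss → total (∅ k) ss ≗ˢ Z ⊕ p → Young k Z → Addable Z p →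
  Σ[ vs₁ ∈ List ℕ ] Σ[ vs₂ ∈ List ℕ ] Σ[ x ∈ ℕ ] Σ[ ss₁ ∈ List State ] Σ[ ss₂ ∈ List State ]
    vs ≡ vs₁ ++ x ∷ vs₂ × length vs₁ ≡ length ss₁ × Chain k (vs₁ ++ vs₂) (ss₁ ++ ss₂) ×
    All (_≤ x) vs₁ × All (x <_) vs₂ × Pass k (∅ k) nothing (ss₁ ++ fresh plain ∷ ss₂) ss (just p) ×
    total (∅ k) (ss₁ ++ ss₂) ≗ˢ Z
chain-undo {k} {vs} {ss} C tot Y A with undo-insert ss (valid C) (placed C) (tame C) tot Y A
... | pre , post , v , p₁ , p₂ , t₁ , t₂ , q , tot′ with splitAt′ vs (length pre) (length post)
        (trans (aligned C) (trans (pass-length q) (length-++ pre)))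
  where
  splitAt′ : ∀ (vs : List ℕ) a b → length vs ≡ a + suc b → Σ[ vs₁ ∈ List ℕ ] Σ[ x ∈ ℕ ] Σ[ vs₂ ∈ List ℕ ] vs ≡ vs₁ ++ x ∷ vs₂ × length vs₁ ≡ a × length vs₂ ≡ b
  splitAt′ (x ∷ vs) zero    b e = [] , x , vs , refl , refl , suc-injective e
  splitAt′ (v ∷ vs) (suc a) b e with splitAt′ vs a b (suc-injective e)
  ... | vs₁ , x , vs₂ , refl , e₁ , e₂ = v ∷ vs₁ , x , vs₂ , refl , cong suc e₁ , e₂
... | vs₁ , x , vs₂ , refl , e₁ , e₂ with steps-delete vs₁ pre (steps⁻ (Young-∅ k) tt v
        (All.++⁺ (placed-plainFresh p₁) (refl ∷ placed-plainFresh p₂)) q (steps C)) e₁ (All.++⁺ p₁ p₂)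
...   | st , a , b = vs₁ , vs₂ , x , pre , post , refl , e₁ ,
        record { aligned = ++-length-≡ vs₁ pre e₁ e₂ ; placed = All.++⁺ p₁ p₂ ; tame = All.++⁺ t₁ t₂ ; valid = valid-delete pre v ; steps = st } ,
        a , b , q , subst (_≗ˢ _) (total-insert (∅ k) pre) tot′

-- Insertion of a word

-- rw is the word read backwards, vs its letters in increasing order and O the
-- times of their insertion; xs and us are the cells they reach under the
-- insertion procedures k and k′, and os and qs the cells added on the way.
data Trace (k k′ : Kind) : List ℕ → List ℕ → List ℕ → List State → List Cell → List State → List Cell → Set where
  []     : Trace k k′ [] [] [] [] [] [] []
  extend : ∀ {rw vs₁ vs₂ O₁ O₂ xs₁ xs₂ os us₁ us₂ qs x xs o us q} →
    Trace k k′ rw (vs₁ ++ vs₂) (O₁ ++ O₂) (xs₁ ++ xs₂) os (us₁ ++ us₂) qs →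
    length vs₁ ≡ length O₁ → length vs₁ ≡ length xs₁ → length vs₁ ≡ length us₁ →
    All (_≤ x) vs₁ → All (x <_) vs₂ →
    Pass k (∅ k) nothing (xs₁ ++ fresh plain ∷ xs₂) xs (just o) →
    Pass k′ (∅ k′) nothing (us₁ ++ fresh plain ∷ us₂) us (just q) →
    Trace k k′ (x ∷ rw) (vs₁ ++ x ∷ vs₂) (O₁ ++ length rw ∷ O₂) xs (o ∷ os) us (q ∷ qs)

trace-swap : ∀ {k k′ rw vs O xs os us qs} → Trace k k′ rw vs O xs os us qs → Trace k′ k rw vs O us qs xs os
trace-swap [] = []
trace-swap (extend t a b c d e p q) = extend (trace-swap t) a c b d e q p

Chain-[] : ∀ {k} → Chain k [] []
Chain-[] = record { aligned = refl ; placed = [] ; tame = [] ; valid = [] ; steps = [] }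

trace-chain : ∀ {k k′ rw vs O xs os us qs} → Trace k k′ rw vs O xs os us qs → Chain k vs xs
trace-chain [] = Chain-[]
trace-chain (extend t _ l _ a b p _) = chain-insert l p (trace-chain t) a b

middle-length : ∀ {A : Set} (xs : List A) {y ys} → length (xs ++ y ∷ ys) ≡ suc (length (xs ++ ys))
middle-length []       = refl
middle-length (x ∷ xs) = cong suc (middle-length xs)

trace-length-O : ∀ {k k′ rw vs O xs os us qs} → Trace k k′ rw vs O xs os us qs → length O ≡ length rw
trace-length-O [] = refl
trace-length-O (extend {O₁ = O₁} t _ _ _ _ _ _ _) = trans (middle-length O₁) (cong suc (trace-length-O t))

trace-length-vs : ∀ {k k′ rw vs O xs os us qs} → Trace k k′ rw vs O xs os us qs → length vs ≡ length rw
trace-length-vs [] = refl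
trace-length-vs (extend {vs₁ = vs₁} t _ _ _ _ _ _ _) = trans (middle-length vs₁) (cong suc (trace-length-vs t))

trace-length-os : ∀ {k k′ rw vs O xs os us qs} → Trace k k′ rw vs O xs os us qs → length os ≡ length rw
trace-length-os [] = refl
trace-length-os (extend t _ _ _ _ _ _ _) = cong suc (trace-length-os t)

trace-letters : ∀ {k k′ rw vs O xs os us qs} → Trace k k′ rw vs O xs os us qs → vs ↭ rw
trace-letters [] = ↭-refl
trace-letters (extend {vs₁ = vs₁} {x = x} t _ _ _ _ _ _ _) = ↭-trans (↭.shift x vs₁ _) (prep x (trace-letters t))

pathShape : Kind → List Cell → Shape
pathShape k []       = ∅ k
pathShape k (p ∷ ps) = pathShape k ps ⊕ p

data Path (k : Kind) : List Cell → Set where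
  []  : Path k []
  _∷_ : ∀ {p ps} → Addable (pathShape k ps) p → Path k ps → Path k (p ∷ ps)

path-Young : ∀ {k ps} → Path k ps → Young k (pathShape k ps)
path-Young {k} []      = Young-∅ k
path-Young     (A ∷ P) = Young-⊕ (path-Young P) A

trace-path : ∀ {k k′ rw vs O xs os us qs} → Trace k k′ rw vs O xs os us qs →
             Path k os × total (∅ k) xs ≗ˢ pathShape k os
trace-path [] = [] , ≗-refl
trace-path {k} (extend {xs₁ = xs₁} {xs₂} {o = o} t _ l _ a b p _) with trace-path t
... | P , e = Addable-cong o e′ (adds r) ∷ P , ≗-trans (totals r) (⊕-cong o e′)
  where
  r = passed (Young-∅ k) tt (valid-insert xs₁ (valid (trace-chain t))) p
  e′ = subst (_≗ˢ _) (sym (total-insert (∅ k) xs₁)) e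

chain-split : ∀ {A : Set} (vs₁ : List ℕ) {vs₂} (xs : List A) → length (vs₁ ++ vs₂) ≡ length xs →
  ∃₂ λ xs₁ xs₂ → xs ≡ xs₁ ++ xs₂ × length vs₁ ≡ length xs₁
chain-split []        xs       e = [] , xs , refl , refl
chain-split (v ∷ vs₁) (x ∷ xs) e with chain-split vs₁ xs (suc-injective e)
... | xs₁ , xs₂ , refl , l = x ∷ xs₁ , xs₂ , refl , cong suc l

split-by : ∀ {ss} x vs → Steps vs ss → ∃₂ λ vs₁ vs₂ → vs ≡ vs₁ ++ vs₂ × All (_≤ x) vs₁ × All (x <_) vs₂
split-by x []       st = [] , [] , refl , [] , []
split-by x (v ∷ vs) st with v ≤? x
... | no v≰x = [] , v ∷ vs , refl , [] , ≰⇒> v≰x ∷ All.map (<-≤-trans (≰⇒> v≰x)) (steps-≤ st)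
split-by x (v ∷ []) [-] | yes le = v ∷ [] , [] , refl , le ∷ [] , []
split-by x (v ∷ w ∷ vs) (_ ∷ st) | yes le with split-by x (w ∷ vs) st
... | vs₁ , vs₂ , e , a , b = v ∷ vs₁ , vs₂ , cong (v ∷_) e , le ∷ a , b

TraceOf : Kind → Kind → List ℕ → Set
TraceOf k k′ rw = ∃₂ λ vs O → ∃₂ λ xs os → ∃₂ λ us qs → Trace k k′ rw vs O xs os us qs

traceOf : ∀ k k′ rw → TraceOf k k′ rw
traceOf k k′ [] = [] , [] , [] , [] , [] , [] , []
traceOf k k′ (x ∷ rw) with traceOf k k′ rw
... | vs , O , xs , os , us , qs , t with split-by x vs (steps (trace-chain t))
...   | vs₁ , vs₂ , refl , a , b with chain-split vs₁ O (trans (trace-length-vs t) (sym (trace-length-O t)))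
          | chain-split vs₁ xs (aligned (trace-chain t)) | chain-split vs₁ us (aligned (trace-chain (trace-swap t)))
...     | O₁ , O₂ , refl , l | xs₁ , xs₂ , refl , l′ | us₁ , us₂ , refl , l″
          with insert-total k (∅ k) (All.++⁻ˡ xs₁ (placed (trace-chain t))) (All.++⁻ʳ xs₁ (placed (trace-chain t)))
             | insert-total k′ (∅ k′) (All.++⁻ˡ us₁ (placed (trace-chain (trace-swap t)))) (All.++⁻ʳ us₁ (placed (trace-chain (trace-swap t))))
...       | xs′ , o , p | us′ , q , p′ = _ , _ , _ , _ , _ , _ , extend {O₁ = O₁} {us₁ = us₁} t l l′ l″ a b p p′

-- The path prescribes the corner to vacate at each step, which yields a word. Its insertion by the
-- second procedure is built up on the way back.
trace-undo : ∀ {k} k′ {vs xs} os → Chain k vs xs → Path k os → total (∅ k) xs ≗ˢ pathShape k os → length os ≡ length xs →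
  ∃₂ λ rw O → ∃₂ λ us qs → Trace k k′ rw vs O xs os us qs
trace-undo k′ {[]} {[]} [] C P e l = [] , [] , [] , [] , []
trace-undo k′ {_ ∷ _} {[]} [] C P e l = ⊥-elim (0≢1+n (sym (aligned C)))
trace-undo k′ (o ∷ os) C (A ∷ P) e l with chain-undo C e (path-Young P) A
... | vs₁ , vs₂ , x , xs₁ , xs₂ , refl , l₁ , C′ , a , b , p , e′
  with trace-undo k′ os C′ P e′ (suc-injective (trans l (trans (pass-length p) (middle-length xs₁))))
...   | rw , O , us , qs , t with chain-split vs₁ O (trans (trace-length-vs t) (sym (trace-length-O t)))
          | chain-split vs₁ us (aligned (trace-chain (trace-swap t)))
...     | O₁ , O₂ , refl , l₂ | us₁ , us₂ , refl , l₃
          with insert-total k′ (∅ k′) (All.++⁻ˡ us₁ (placed (trace-chain (trace-swap t)))) (All.++⁻ʳ us₁ (placed (trace-chain (trace-swap t))))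
...       | us′ , q , p′ = _ , _ , _ , _ , extend {O₁ = O₁} {us₁ = us₁} t l₂ l₁ l₃ a b p p′

split-unique : ∀ {x} (vs₁ vs₁′ : List ℕ) {vs₂ vs₂′} → vs₁ ++ vs₂ ≡ vs₁′ ++ vs₂′ →
  All (_≤ x) vs₁ → All (x <_) vs₂ → All (_≤ x) vs₁′ → All (x <_) vs₂′ → length vs₁ ≡ length vs₁′
split-unique []        []         e    _        _        _        _        = refl
split-unique (_ ∷ vs₁) (_ ∷ vs₁′) e    (_ ∷ a)  b        (_ ∷ a′) b′       = cong suc (split-unique vs₁ vs₁′ (∷-injectiveʳ e) a b a′ b′)
split-unique []        (_ ∷ _)    refl _        (lt ∷ _) (le ∷ _) _        = ⊥-elim (<⇒≱ lt le)
split-unique (_ ∷ _)   []         refl (le ∷ _) _        _        (lt ∷ _) = ⊥-elim (<⇒≱ lt le)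

trace-unique : ∀ {k k′ rw vs O xs os us qs vs′ O′ xs′ os′ us′ qs′} →
  Trace k k′ rw vs O xs os us qs → Trace k k′ rw vs′ O′ xs′ os′ us′ qs′ →
  vs ≡ vs′ × O ≡ O′ × (xs ≡ xs′ × os ≡ os′) × (us ≡ us′ × qs ≡ qs′)
trace-unique [] [] = refl , refl , (refl , refl) , (refl , refl)
trace-unique (extend {vs₁ = vs₁} {O₁ = O₁} {xs₁ = xs₁} {us₁ = us₁} t l l′ l″ a b p q)
             (extend {vs₁ = ws₁} {O₁ = P₁} {xs₁ = ys₁} {us₁ = zs₁} t₁ m m′ m″ a₁ b₁ p₁ q₁)
  with trace-unique t t₁
... | e , e′ , (f , refl) , (g , refl) with split-unique vs₁ ws₁ e a b a₁ b₁
...   | n with ++-cancel-≡ vs₁ ws₁ n e | ++-cancel-≡ O₁ P₁ (trans (sym l) (trans n m)) e′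
             | ++-cancel-≡ xs₁ ys₁ (trans (sym l′) (trans n m′)) f | ++-cancel-≡ us₁ zs₁ (trans (sym l″) (trans n m″)) g
...     | refl , refl | refl , refl | refl , refl | refl , refl with Pass-functional p p₁ | Pass-functional q q₁
...       | refl , refl | refl , refl = refl , refl , (refl , refl) , (refl , refl)

fresh-unique : ∀ ss ts {ss′ ts′} → All Placed (ss ++ ss′) → All Placed (ts ++ ts′) → ss ++ fresh plain ∷ ss′ ≡ ts ++ fresh plain ∷ ts′ →
  ss ≡ ts × ss′ ≡ ts′
fresh-unique []       []       _ _ refl = refl , refl
fresh-unique (s ∷ ss) (t ∷ ts) (_ ∷ p) (_ ∷ q) e = map₁ (cong₂ _∷_ (∷-injectiveˡ e)) (fresh-unique ss ts p q (∷-injectiveʳ e))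
fresh-unique []       (_ ∷ ts) _ (() ∷ _) refl
fresh-unique (_ ∷ ss) []       (() ∷ _) _ refl

-- By `pass-back` the final states and the cell added determine the states before, including the
-- place of the fresh letter, and so the letter itself.
trace-word : ∀ {k k′ rw rw′ vs O O′ xs os us us′ qs qs′ vs′ xs′ os′} →
  Trace k k′ rw vs O xs os us qs → Trace k k′ rw′ vs′ O′ xs′ os′ us′ qs′ → vs ≡ vs′ → xs ≡ xs′ → os ≡ os′ → rw ≡ rw′
trace-word [] [] _ _ _ = refl
trace-word {k} (extend {vs₁ = vs₁} {xs₁ = xs₁} t l l′ l″ a b p q) (extend {vs₁ = ws₁} {xs₁ = ys₁} t₁ m m′ m″ a₁ b₁ p₁ q₁) e refl refl
  with pass-back (Young-∅ k) tt (valid-insert xs₁ (valid (trace-chain t))) (Young-∅ k) tt (valid-insert ys₁ (valid (trace-chain t₁))) ≗-refl p p₁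
... | _ , f with fresh-unique xs₁ ys₁ (placed (trace-chain t)) (placed (trace-chain t₁)) f
...   | refl , refl with ++-cancel-≡ vs₁ ws₁ (trans l′ (sym m′)) e
...     | refl , refl = cong₂ _∷_ refl (trace-word t t₁ refl refl refl)

-- A `Trace` contains only the letters inserted so far, a `Run` the whole alphabet from the start.
-- To pass from one to the other, earlier stages are filled up with the letters still to come.
insertNone : ℕ → List State → List State
insertNone zero    ss       = none ∷ ss
insertNone (suc n) []       = []
insertNone (suc n) (s ∷ ss) = s ∷ insertNone n ss

pass-insertNone : ∀ {k S ev ss ss′ o} n → n ≤ length ss → Pass k S ev ss ss′ o → Pass k S ev (insertNone n ss) (insertNone n ss′) o
pass-insertNone zero    le       p       = none ∷ p
pass-insertNone (suc n) (s≤s le) (a ∷ p) = a ∷ pass-insertNone n le p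

flag-insertNone : ∀ {ℓ l} L₁ {L₂} ss → sameLabel l ℓ ≡ false → length ss ≡ length (L₁ ++ L₂) →
  flag ℓ (L₁ ++ l ∷ L₂) (insertNone (length L₁) ss) ≡ insertNone (length L₁) (flag ℓ (L₁ ++ L₂) ss)
flag-insertNone {ℓ} {l} []       {L₂} ss ne e rewrite ne = refl
flag-insertNone {ℓ} (m ∷ L₁) (s ∷ ss) ne e = cong (raise ℓ m s ∷_) (flag-insertNone L₁ ss ne (suc-injective e))

nones-insertNone : ∀ (L₁ : List Label) {l L₂} → map (λ _ → none) (L₁ ++ l ∷ L₂) ≡ insertNone (length L₁) (map (λ _ → none) (L₁ ++ L₂))
nones-insertNone []       = refl
nones-insertNone (m ∷ L₁) = cong (none ∷_) (nones-insertNone L₁)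

run-insertNone : ∀ {k st ss os l} L₁ {L₂} → All (λ ℓ → sameLabel l ℓ ≡ false) st → Run k (L₁ ++ L₂) st ss os →
  Run k (L₁ ++ l ∷ L₂) st (insertNone (length L₁) ss) os
run-insertNone {k} {l = l} L₁ {L₂} ns [] = subst (λ z → Run k (L₁ ++ l ∷ L₂) [] z []) (nones-insertNone L₁) []
run-insertNone {k} L₁ {L₂} (n ∷ ns) (step {ℓ} {ss = ss} r p) = step (run-insertNone L₁ ns r)
  (subst (λ z → Pass k _ _ z _ _) (sym (flag-insertNone L₁ ss n (run-length r)))
    (pass-insertNone (length L₁) (subst (length L₁ ≤_) (sym (trans (flag-length ℓ (L₁ ++ L₂) ss (run-length r)) (length-++ L₁))) (m≤m+n _ _)) p))

insertNone-++ : ∀ {A : Set} (L₁ : List A) ss₁ {ss₂} → length L₁ ≡ length ss₁ → insertNone (length L₁) (ss₁ ++ ss₂) ≡ ss₁ ++ none ∷ ss₂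
insertNone-++ []       []        e = refl
insertNone-++ (_ ∷ L₁) (s ∷ ss₁) e = cong (s ∷_) (insertNone-++ L₁ ss₁ (suc-injective e))

flag-placed : ∀ ℓ L {ss} → All Placed ss → length ss ≡ length L → flag ℓ L ss ≡ ss
flag-placed ℓ []      []        e = refl
flag-placed ℓ (l ∷ L) (at ∷ ps) e = cong₂ _∷_ (raise-at ℓ l _ _) (flag-placed ℓ L ps (suc-injective e))

later-label : ∀ {n} i → n ≤ i → All (λ ℓ → sameLabel (plain , i) ℓ ≡ false) (letters plain n)
later-label {zero}  i le = []
later-label {suc n} i le = ≢⇒≡ᵇ i n (λ e → <⇒≢ le (sym e)) ∷ later-label i (<⇒≤ le)
  where
  ≢⇒≡ᵇ : ∀ i n → i ≢ n → (i ≡ᵇ n) ≡ false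
  ≢⇒≡ᵇ zero    zero    ne = ⊥-elim (ne refl)
  ≢⇒≡ᵇ zero    (suc n) ne = refl
  ≢⇒≡ᵇ (suc i) zero    ne = refl
  ≢⇒≡ᵇ (suc i) (suc n) ne = ≢⇒≡ᵇ i n (ne ∘ cong suc)

trace-run : ∀ {k k′ rw vs O xs os us qs} → Trace k k′ rw vs O xs os us qs →
            Run k (marked plain O) (letters plain (length rw)) xs (map just os)
trace-run [] = []
trace-run {k} (extend {rw} {vs₁} {vs₂} {O₁} {O₂} {xs₁} {xs₂} t l l′ _ _ _ p _) =
  step (subst₂ (λ L z → Run k L (letters plain n) z _) labels (trans (cong (λ z → insertNone z (xs₁ ++ xs₂)) (length-map {B = Label} (plain ,_) O₁)) (insertNone-++ O₁ xs₁ l₁))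
         (run-insertNone {l = plain , n} (marked plain O₁) (later-label n ≤-refl)
           (subst (λ L → Run k L (letters plain n) (xs₁ ++ xs₂) _) (map-++ (plain ,_) O₁ O₂) (trace-run t))))
    (subst (λ z → Pass k _ _ z _ _) (sym flagged) p)
  where
  n = length rw
  C = trace-chain t
  l₁ : length O₁ ≡ length xs₁
  l₁ = trans (sym l) l′
  l₂ : length xs₂ ≡ length O₂
  l₂ = +-cancelˡ-≡ (length O₁) _ _ (trans (cong (_+ length xs₂) l₁) (trans (sym (length-++ xs₁))
         (trans (sym (aligned C)) (trans (trans (trace-length-vs t) (sym (trace-length-O t))) (length-++ O₁)))))
  labels : marked plain O₁ ++ (plain , n) ∷ marked plain O₂ ≡ marked plain (O₁ ++ n ∷ O₂)
  labels = sym (map-++ (plain ,_) O₁ (n ∷ O₂))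
  flagged : flag (plain , n) (marked plain (O₁ ++ n ∷ O₂)) (xs₁ ++ none ∷ xs₂) ≡ xs₁ ++ fresh plain ∷ xs₂
  flagged = trans (cong (λ L → flag (plain , n) L (xs₁ ++ none ∷ xs₂)) (sym labels))
    (trans (flag-++ (plain , n) (marked plain O₁) _ xs₁ _ (trans (sym l₁) (sym (length-map {B = Label} (plain ,_) O₁))))
      (cong₂ _++_ (flag-placed (plain , n) (marked plain O₁) (All.++⁻ˡ xs₁ (placed C)) (trans (sym l₁) (sym (length-map {B = Label} (plain ,_) O₁))))
        (cong₂ _∷_ (cong (λ b → if b then fresh plain else none) (≡ᵇ-refl n))
          (flag-placed (plain , n) (marked plain O₂) (All.++⁻ʳ xs₁ (placed C)) (trans l₂ (sym (length-map {B = Label} (plain ,_) O₂)))))))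

foldl-reverse : ∀ {A B : Set} (f : B → A → B) e x xs → foldl f e (reverse (x ∷ xs)) ≡ f (foldl f e (reverse xs)) x
foldl-reverse f e x xs = trans (cong (foldl f e) (unfold-reverse x xs)) (foldl-∷ʳ f e x (reverse xs))

trace-mix : ∀ {k′ rw vs O xs os us qs} → Trace shifted k′ rw vs O xs os us qs → P-mix (reverse rw) ≡ build [] vs xs
trace-mix [] = refl
trace-mix t₁@(extend {rw} {x = x} t _ l _ a b p _) with into-build l p (trace-chain t) (steps (trace-chain t₁))
... | z , n , M , le = trans (foldl-reverse _ [] x rw) (trans (cong (mixInsert x) (trace-mix t)) (insertSteps-≡ M le))

trace-rsk : ∀ {k′ rw vs O xs os us qs} → Trace straight k′ rw vs O xs os us qs → unprime (P-RSK (reverse rw)) ≡ build [] vs xs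
trace-rsk [] = refl
trace-rsk t₁@(extend {rw} {x = x} t _ l _ a b p _) with into-build l p (trace-chain t) (steps (trace-chain t₁))
... | z , M = trans (cong unprime (foldl-reverse _ [] x rw)) (trans (sym (rskInsert-unprime x (P-RSK (reverse rw))))
                (trans (cong (rskInsert′ (unprimed x)) (trace-rsk t)) (rskInsert′-≡ M)))

trace-record-determined : ∀ {rw vs O xs os us qs rw′ vs′ O′ xs′ os′ us′} →
  Trace shifted straight rw vs O xs os us qs → Trace shifted straight rw′ vs′ O′ xs′ os′ us′ qs → os ≡ os′
trace-record-determined {rw} {qs = qs} {rw′} t t′ = map-injective just-inj (record-determined (trace-run t)
    (subst (λ n → Run _ _ (letters plain n) _ _) (sym n≡) (trace-run t′)) (trace-run (trace-swap t))
    (subst (λ n → Run _ _ (letters plain n) _ _) (sym n≡) (trace-run (trace-swap t′))))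
  where
  n≡ : length rw ≡ length rw′
  n≡ = trans (sym (trace-length-os (trace-swap t))) (trace-length-os (trace-swap t′))
  just-inj : ∀ {x y : Cell} → just x ≡ just y → x ≡ y
  just-inj refl = refl

zip-proj : ∀ (O O′ : List ℕ) → length O ≡ length O′ → ∃ λ ps → map proj₁ ps ≡ O × map proj₂ ps ≡ O′
zip-proj []      []       e = [] , refl , refl
zip-proj (x ∷ O) (y ∷ O′) e with zip-proj O O′ (suc-injective e)
... | ps , refl , refl = (x , y) ∷ ps , refl , refl

trace-insertion-determined : ∀ {rw vs O xs os us qs rw′ vs′ O′ xs′ os′ us′ qs′} →
  Trace shifted straight rw vs O xs os us qs → Trace shifted straight rw′ vs′ O′ xs′ os′ us′ qs′ →
  vs ≡ vs′ → xs ≡ xs′ → us ≡ us′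
trace-insertion-determined {rw} {O = O} {rw′ = rw′} {O′ = O′} t t′ e refl with zip-proj O O′ (trans (trace-length-O t) (trans n≡ (sym (trace-length-O t′))))
  where
  n≡ : length rw ≡ length rw′
  n≡ = trans (sym (trace-length-vs t)) (trans (cong length e) (trace-length-vs t′))
... | ps , refl , refl = insertion-determined ps (trace-run t) (subst (λ n → Run _ _ (letters plain n) _ _) (sym n≡) (trace-run t′))
    (trace-run (trace-swap t)) (subst (λ n → Run _ _ (letters plain n) _ _) (sym n≡) (trace-run (trace-swap t′)))
  where
  n≡ : length rw ≡ length rw′
  n≡ = trans (sym (trace-length-vs t)) (trans (cong length e) (trace-length-vs t′))

-- Shifted and Young tableaux

diagonal⁺ : ∀ {T} → (∀ {i x} → In shifted T i i x → Unprimed x) → All Unprimed (diagonal T)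
diagonal⁺ {[]}          h = []
diagonal⁺ {[] ∷ T}      h = diagonal⁺ {T} (λ n → h (there n))
diagonal⁺ {(x ∷ r) ∷ T} h = h (here zero) ∷ diagonal⁺ {T} (λ n → h (there n))

diagonal⁻ : ∀ {T i j x} → All Unprimed (diagonal T) → In shifted T i j x → i ≡ j → Unprimed x
diagonal⁻ {(_ ∷ r) ∷ T} (u ∷ _)  (here zero) refl = u
diagonal⁻ {[] ∷ T}      us       (there n)   e    = diagonal⁻ us n (suc-injective e)
diagonal⁻ {(_ ∷ r) ∷ T} (_ ∷ us) (there n)   e    = diagonal⁻ us n (suc-injective e)

shifted-tableau⁺ : ∀ {T} → Tableau shifted T → IsShiftedTableau (shapeᵗ T) T
shifted-tableau⁺ {T} Tb = refl , rows⁺ shifted T (rowsOK Tb) ,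
  subst (All (AllPairs ColumnPair)) (cols′-shifted T) (columns⁺ shifted T (colsOK Tb)) ,
  diagonal⁺ (λ n → plainOK Tb n refl)

shifted-tableau⁻ : ∀ {ν T} → IsShiftedTableau ν T → Tableau shifted T
shifted-tableau⁻ {ν} {T} (_ , r , c , d) = record
  { rowsOK  = rows⁻ shifted T r
  ; colsOK  = columns⁻ shifted T (subst (All (AllPairs ColumnPair)) (sym (cols′-shifted T)) c)
  ; plainOK = λ n e → diagonal⁻ d n e }

nth-map⁺ : ∀ {A B : Set} {f : A → B} {r j x} → Nth r j x → Nth (map f r) j (f x)
nth-map⁺ zero    = zero
nth-map⁺ (suc n) = suc (nth-map⁺ n)

nth-map⁻ : ∀ {A B : Set} {f : A → B} r {j y} → Nth (map f r) j y → Σ[ x ∈ A ] y ≡ f x × Nth r j x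
nth-map⁻ (x ∷ r) zero    = x , refl , zero
nth-map⁻ (x ∷ r) (suc n) = map₂ (map₂ suc) (nth-map⁻ r n)

in-unprime⁺ : ∀ {k U i j v} → In k U i j v → In k (unprime U) i j (unprimed v)
in-unprime⁺ (here n)  = here (nth-map⁺ n)
in-unprime⁺ (there n) = there (in-unprime⁺ n)

in-unprime⁻ : ∀ {k} U {i j x} → In k (unprime U) i j x → Σ[ v ∈ ℕ ] x ≡ unprimed v × In k U i j v
in-unprime⁻ (r ∷ U) (here n)  = map₂ (map₂ here) (nth-map⁻ r n)
in-unprime⁻ (r ∷ U) (there n) = map₂ (map₂ there) (in-unprime⁻ U n)

young-tableau⁺ : ∀ {U} → Tableau straight (unprime U) → IsYoungTableau (shapeᵗ U) U
young-tableau⁺ {U} Tb = refl ,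
  rows⁺ straight U (λ {i} {j} {j′} {x} {y} lt n m → *-cancelˡ-≤ 2 (≤-pred (proj₁ (rowsOK Tb lt (in-unprime⁺ n) (in-unprime⁺ m))))) ,
  subst (All (AllPairs _<_)) (cols′-straight U) (columns⁺ straight U (λ lt n m → strict (colsOK Tb lt (in-unprime⁺ n) (in-unprime⁺ m))))
  where
  strict : ∀ {x y} → ColumnPair (unprimed x) (unprimed y) → x < y
  strict {x} {y} (le , h) = ≤∧≢⇒< (*-cancelˡ-≤ 2 (≤-pred le)) λ { refl → case h refl of λ () }

young-tableau⁻ : ∀ {μ U} → IsYoungTableau μ U → Tableau straight (unprime U)
young-tableau⁻ {μ} {U} (_ , r , c) = record { rowsOK = ro ; colsOK = co ; plainOK = pl }
  where
  ro : RowsOK {R = RowPair} straight (unprime U)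
  ro lt n m with in-unprime⁻ U n | in-unprime⁻ U m
  ... | x , refl , n′ | y , refl , m′ = s≤s (*-monoʳ-≤ 2 (rows⁻ straight U r lt n′ m′)) , λ _ → unprimed
  co : ColumnsOK {R = ColumnPair} straight (unprime U)
  co lt n m with in-unprime⁻ U n | in-unprime⁻ U m
  ... | x , refl , n′ | y , refl , m′
    with columns⁻ straight U (subst (All (AllPairs _<_)) (sym (cols′-straight U)) c) lt n′ m′
  ...   | l = s≤s (*-monoʳ-≤ 2 (<⇒≤ l)) , λ { refl → ⊥-elim (n≮n _ l) }
  pl : ∀ {i j x} → In straight (unprime U) i j x → NeedsPlain straight i j → Unprimed x
  pl n _ with in-unprime⁻ U n
  ... | _ , refl , _ = unprimed

shape-unprime : ∀ U → shapeᵗ (unprime U) ≡ shapeᵗ U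
shape-unprime []      = refl
shape-unprime (r ∷ U) = cong₂ _∷_ (length-map unprimed r) (shape-unprime U)

unprime-injective : ∀ {U V} → unprime U ≡ unprime V → U ≡ V
unprime-injective = map-injective (map-injective λ { refl → refl })

size-shape : ∀ {A B : Set} (T : Filling A) (U : Filling B) → shapeᵗ T ≡ shapeᵗ U → size T ≡ size U
size-shape []      []      e = refl
size-shape (r ∷ T) (q ∷ U) e = trans (length-++ r) (trans (cong₂ _+_ (∷-injectiveˡ e) (size-shape T U (∷-injectiveʳ e))) (sym (length-++ q)))

size-build : ∀ T vs ss → length vs ≡ length ss → All Placed ss → size (build T vs ss) ≡ length ss + size T
size-build T []       []             e []        = refl
size-build T (v ∷ vs) (at m c ∷ ss)  e (at ∷ ps) =
  trans (size-build _ vs ss (suc-injective e) ps) (trans (cong (length ss +_) (size-snoc (proj₁ c) _ T)) (+-suc (length ss) (size T)))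

rows-determine : ∀ {k S S′} → Young k S → Young k S′ → (∀ i → rows S i ≡ rows S′ i) → S ≗ˢ S′
rows-determine {k} {S} {S′} Y Y′ r = r & λ j → ≤-antisym (le Y Y′ r j) (le Y′ Y (sym ∘ r) j)
  where
  le : ∀ {S S′} → Young k S → Young k S′ → (∀ i → rows S i ≡ rows S′ i) → ∀ j → cols S j ≤ cols S′ j
  le {S} {S′} Y Y′ r j = ≮⇒≥ λ lt → n≮n _ (inCol Y′ (off Y lt) (subst (j <_) (r (cols S′ j)) (inRow Y lt)))

-- Words with given insertion and recording tableaux

valid-path : ∀ {k ss} ps → Path k ps → Valid k (pathShape k ps) ss → All Placed ss →
  Σ[ qs ∈ List Cell ] Path k qs × total (pathShape k ps) ss ≗ˢ pathShape k qs × length qs ≡ length ss + length ps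
valid-path ps P [] [] = ps , P , ≗-refl , refl
valid-path {k} {s ∷ ss} ps P (ok ∷ v) (at {m} {c} ∷ pl) with valid-path (c ∷ ps) (stateCell {k} {m = m} ok ∷ P) v pl
... | qs , Q , e , l = qs , Q , e , trans l (+-suc (length ss) (length ps))

-- The chain of the tableau adds its cells in increasing order of letters; this supplies one
-- recording path for the shape.
tableau-path : ∀ {k T} → Tableau k T → Diagram k (shapeᵗ T) →
  Σ[ os ∈ List Cell ] Path k os × Rows k T (pathShape k os) × length os ≡ size T
tableau-path {k} {T} Tb D with chainOf (size T) T refl Tb D
... | vs , ss , C , refl with valid-path [] [] (valid C) (placed C)
...   | os , P , e , l = os , P , (λ i → trans (rowsᵇ (chain-built C) i) (rows-≗ e i)) ,
        trans l (sym (size-build [] vs ss (aligned C) (placed C)))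

tableau-trace : ∀ {k} k′ {T os} → Tableau k T → Diagram k (shapeᵗ T) → Path k os → Rows k T (pathShape k os) → length os ≡ size T →
  ∃₂ λ rw vs → ∃₂ λ O xs → ∃₂ λ us qs → Trace k k′ rw vs O xs os us qs × build [] vs xs ≡ T
tableau-trace {k} k′ {T} {os} Tb D P R l with chainOf (size T) T refl Tb D
... | vs , xs , C , refl with trace-undo k′ os C P
        (rows-determine (Young-total xs (Young-∅ k) (valid C)) (path-Young P) (λ i → trans (sym (rowsᵇ (chain-built C) i)) (R i)))
        (trans l (trans (size-build [] vs xs (aligned C) (placed C)) (+-identityʳ _)))
...   | rw , O , us , qs , t = rw , vs , O , xs , us , qs , t , refl

record Recorded (w : Word) (os qs : List Cell) : Set where
  constructor recorded
  field
    {vs O} : List ℕ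
    {xs us} : List State
    trace : Trace shifted straight (reverse w) vs O xs os us qs

recorded-mix : ∀ {w os qs} (r : Recorded w os qs) → P-mix w ≡ build [] (Recorded.vs r) (Recorded.xs r)
recorded-mix {w} (recorded t) = trans (cong P-mix (sym (reverse-involutive w))) (trace-mix t)

recorded-rsk : ∀ {w os qs} (r : Recorded w os qs) → unprime (P-RSK w) ≡ build [] (Recorded.vs r) (Recorded.us r)
recorded-rsk {w} (recorded t) = trans (cong (unprime ∘ P-RSK) (sym (reverse-involutive w))) (trace-rsk (trace-swap t))

record-of : ∀ w → ∃₂ λ os qs → Recorded w os qs
record-of w with traceOf shifted straight (reverse w)
... | _ , _ , _ , os , _ , qs , t = os , qs , recorded t

recorded-functional : ∀ {w os os′ qs qs′} → Recorded w os qs → Recorded w os′ qs′ → os ≡ os′ × qs ≡ qs′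
recorded-functional (recorded t) (recorded t′) with trace-unique t t′
... | _ , _ , (_ , e) , (_ , e′) = e , e′

recorded-determined : ∀ {w w′ os os′ qs} → Recorded w os qs → Recorded w′ os′ qs → os ≡ os′
recorded-determined (recorded t) (recorded t′) = trace-record-determined t t′

mix-built : ∀ {w os qs} → Recorded w os qs → Built shifted (P-mix w) (pathShape shifted os)
mix-built {w} r@(recorded t) = subst (λ T → Built shifted T _) (sym (recorded-mix r)) record
  { tableau = tableau B ; nonEmpty = nonEmpty B
  ; rowsᵇ = λ i → trans (rowsᵇ B i) (rows-≗ (proj₂ (trace-path t)) i) }
  where B = chain-built (trace-chain t)

rsk-built : ∀ {w os qs} → Recorded w os qs → Built straight (unprime (P-RSK w)) (pathShape straight qs)
rsk-built {w} r@(recorded t) = subst (λ T → Built straight T _) (sym (recorded-rsk r)) record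
  { tableau = tableau B ; nonEmpty = nonEmpty B
  ; rowsᵇ = λ i → trans (rowsᵇ B i) (rows-≗ (proj₂ (trace-path (trace-swap t))) i) }
  where B = chain-built (trace-chain (trace-swap t))

mix-injective : ∀ {w w′ os qs qs′} → Recorded w os qs → Recorded w′ os qs′ → P-mix w ≡ P-mix w′ → w ≡ w′
mix-injective r@(recorded t) r′@(recorded t′) e
  with chain-unique (trace-chain t) (trace-chain t′) (trans (sym (recorded-mix r)) (trans e (recorded-mix r′)))
... | p , q = reverse-injective (trace-word t t′ p q refl)

rsk-injective : ∀ {w w′ os os′ qs} → Recorded w os qs → Recorded w′ os′ qs → P-RSK w ≡ P-RSK w′ → w ≡ w′
rsk-injective r@(recorded t) r′@(recorded t′) e
  with chain-unique (trace-chain (trace-swap t)) (trace-chain (trace-swap t′))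
         (trans (sym (recorded-rsk r)) (trans (cong unprime e) (recorded-rsk r′)))
... | p , q = reverse-injective (trace-word (trace-swap t) (trace-swap t′) p q refl)

mix-determines-rsk : ∀ w w′ → P-mix w ≡ P-mix w′ → P-RSK w ≡ P-RSK w′
mix-determines-rsk w w′ e with record-of w | record-of w′
... | _ , _ , r@(recorded t) | _ , _ , r′@(recorded t′)
  with chain-unique (trace-chain t) (trace-chain t′) (trans (sym (recorded-mix r)) (trans e (recorded-mix r′)))
...   | p , q = unprime-injective (trans (recorded-rsk r)
        (trans (cong₂ (build []) p (trace-insertion-determined t t′ p q)) (sym (recorded-rsk r′))))

mix-surjective : ∀ {T os} → Tableau shifted T → Diagram shifted (shapeᵗ T) → Path shifted os → Rows shifted T (pathShape shifted os) →
  length os ≡ size T → Σ[ w ∈ Word ] P-mix w ≡ T × Σ[ qs ∈ List Cell ] Recorded w os qs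
mix-surjective Tb D P R l with tableau-trace straight Tb D P R l
... | rw , vs , O , xs , us , qs , t , e = reverse rw , trans (trace-mix t) e , qs ,
      recorded (subst (λ z → Trace _ _ z _ _ _ _ _ _) (sym (reverse-involutive rw)) t)

rsk-surjective : ∀ {U w os qs} → Recorded w os qs → Tableau straight (unprime U) → Diagram straight (shapeᵗ U) → shapeᵗ U ≡ shapeᵗ (P-RSK w) →
  Σ[ w′ ∈ Word ] P-RSK w′ ≡ U × Σ[ os′ ∈ List Cell ] Recorded w′ os′ qs
rsk-surjective {U} {w} {os} {qs} r@(recorded t) Tb D e
  with tableau-trace shifted Tb (subst (Diagram straight) (sym (shape-unprime U)) D) (proj₁ (trace-path (trace-swap t)))
         (λ i → trans (cong (offset straight i +_) (shape-rowLen (unprime U) (unprime (P-RSK w)) sh i)) (rowsᵇ (rsk-built r) i))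
         (trans (trace-length-os (trace-swap t)) (trans (sym (trans (size-build [] (Recorded.vs r) (Recorded.us r) (aligned C) (placed C)) (trans (+-identityʳ _)
           (trans (sym (aligned C)) (trace-length-vs t))))) (size-shape (build [] (Recorded.vs r) (Recorded.us r)) (unprime U) (trans (cong shapeᵗ (sym (recorded-rsk r))) (sym sh)))))
  where
  C = trace-chain (trace-swap t)
  sh : shapeᵗ (unprime U) ≡ shapeᵗ (unprime (P-RSK w))
  sh = trans (shape-unprime U) (trans e (sym (shape-unprime (P-RSK w))))
... | rw , vs , O , us , xs , os′ , t′ , e′ = reverse rw , unprime-injective (trans (trace-rsk t′) e′) , os′ ,
      recorded (subst (λ z → Trace _ _ z _ _ _ _ _ _) (sym (reverse-involutive rw)) (trace-swap t′))

mix-tableau : ∀ w → IsShiftedTableau (shapeᵗ (P-mix w)) (P-mix w)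
mix-tableau w = shifted-tableau⁺ (tableau (mix-built (proj₂ (proj₂ (record-of w)))))

rsk-tableau : ∀ w → IsYoungTableau (shapeᵗ (P-RSK w)) (P-RSK w)
rsk-tableau w = young-tableau⁺ (tableau (rsk-built (proj₂ (proj₂ (record-of w)))))

rsk-partition : ∀ w → IsPartition (shapeᵗ (P-RSK w))
rsk-partition w with record-of w
... | _ , _ , r@(recorded t) = subst IsPartition (shape-unprime (P-RSK w))
      (rows-diagram (unprime (P-RSK w)) (nonEmpty B) (path-Young (proj₁ (trace-path (trace-swap t)))) (rowsᵇ B))
  where B = rsk-built r

concat-snoc : ∀ {A : Set} i (y : A) T → concat (snocRow i y T) ↭ y ∷ concat T
concat-snoc i       y []      = ↭-refl
concat-snoc zero    y (r ∷ T) = ↭-trans (↭-reflexive (++-assoc r (y ∷ []) (concat T))) (↭.shift y r (concat T))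
concat-snoc (suc i) y (r ∷ T) = ↭-trans (↭.++⁺ˡ r (concat-snoc i y T)) (↭.shift y r (concat T))

∣letter∣ : ∀ m v → ∣ letter m v ∣ ≡ v
∣letter∣ plain  v = refl
∣letter∣ barred v = refl

build-letters : ∀ T vs ss → length vs ≡ length ss → All Placed ss → map ∣_∣ (concat (build T vs ss)) ↭ vs ++ map ∣_∣ (concat T)
build-letters T []       []            e []        = ↭-refl
build-letters T (v ∷ vs) (at m c ∷ ss) e (at ∷ ps) = ↭-trans (build-letters _ vs ss (suc-injective e) ps)
  (↭-trans (↭.++⁺ˡ vs (↭-trans (↭.map⁺ ∣_∣ (concat-snoc (proj₁ c) (letter m v) T)) (↭-reflexive (cong (_∷ map ∣_∣ (concat T)) (∣letter∣ m v)))))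
    (↭.shift v vs _))

chain-letters : ∀ {k vs ss} → Chain k vs ss → map ∣_∣ (concat (build [] vs ss)) ↭ vs
chain-letters {vs = vs} {ss} C = ↭-trans (build-letters [] vs ss (aligned C) (placed C)) (↭-reflexive (++-identityʳ vs))

mix-letters : ∀ w → map ∣_∣ (concat (P-mix w)) ↭ w
mix-letters w with record-of w
... | _ , _ , r@(recorded t) = ↭-trans (↭-reflexive (cong (map ∣_∣ ∘ concat) (recorded-mix r)))
      (↭-trans (chain-letters (trace-chain t)) (↭-trans (trace-letters t) (↭.↭-reverse w)))

rsk-letters : ∀ w → concat (P-RSK w) ↭ w
rsk-letters w with record-of w
... | _ , _ , r@(recorded t) = ↭-trans (↭-reflexive (trans (sym (strip (P-RSK w))) (cong (map ∣_∣ ∘ concat) (recorded-rsk r))))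
      (↭-trans (chain-letters (trace-chain (trace-swap t))) (↭-trans (trace-letters t) (↭.↭-reverse w)))
  where
  strip : ∀ U → map ∣_∣ (concat (unprime U)) ≡ concat U
  strip U = trans (cong (map ∣_∣) (concat-map U)) (trans (sym (map-∘ (concat U))) (map-id (concat U)))

-- Counting in lists

-- Each partner is removed from `ys` once it is used. A relation replaces the map since partners
-- come out of existence statements.
injection-length : ∀ {A B : Set} {R : A → B → Set} {xs : List A} {ys : List B} → Unique xs →
  (∀ {x} → x ∈ xs → Σ[ y ∈ B ] y ∈ ys × R x y) → (∀ {x x′ y} → R x y → R x′ y → x ≡ x′) → length xs ≤ length ys
injection-length {xs = []} u f i = z≤n
injection-length {R = R} {x ∷ xs} {ys} (a ∷ u) f i with f (here refl)
... | y , m , r with ∈-∃++ m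
...   | ys₁ , ys₂ , refl = subst (suc (length xs) ≤_) (sym (middle-length ys₁)) (s≤s (injection-length {R = R} u g i))
  where
  g : ∀ {x′} → x′ ∈ xs → Σ[ y′ ∈ _ ] y′ ∈ ys₁ ++ ys₂ × R x′ y′
  g m′ with f (there m′)
  ... | y′ , n , r′ with ∈-++⁻ ys₁ n
  ...   | inj₁ n₁ = y′ , ∈-++⁺ˡ n₁ , r′
  ...   | inj₂ (there n₂) = y′ , ∈-++⁺ʳ ys₁ n₂ , r′
  ...   | inj₂ (here refl) = ⊥-elim (All.lookup a m′ (i r r′))

same-members-length : ∀ {A : Set} {xs ys : List A} → Unique xs → Unique ys → (∀ {x} → x ∈ xs → x ∈ ys) → (∀ {x} → x ∈ ys → x ∈ xs) →
  length xs ≡ length ys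
same-members-length u v f g = ≤-antisym (injection-length {R = _≡_} u (λ m → _ , f m , refl) λ { refl refl → refl })
                                        (injection-length {R = _≡_} v (λ m → _ , g m , refl) λ { refl refl → refl })

concatMap-unique : ∀ {A B : Set} {f : A → List B} {xs} → Unique xs → (∀ {x} → x ∈ xs → Unique (f x)) →
  (∀ {x y z} → x ∈ xs → y ∈ xs → z ∈ f x → z ∈ f y → x ≡ y) → Unique (concatMap f xs)
concatMap-unique {xs = []} u g h = []
concatMap-unique {f = f} {x ∷ xs} (a ∷ u) g h = Unique.++⁺ (g (here refl)) (concatMap-unique u (g ∘ there) (λ m n → h (there m) (there n)))
  λ (m , n) → clash m (∈-concatMap⁻ f {xs = xs} n)
  where
  clash : ∀ {z} → z ∈ f x → Any ((z ∈_) ∘ f) xs → ⊥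
  clash m n with find n
  ... | y , y∈ , z∈ = All.lookup a y∈ (h (here refl) (there y∈) m z∈)

∈-concatMap : ∀ {A B : Set} (f : A → List B) {xs x z} → x ∈ xs → z ∈ f x → z ∈ concatMap f xs
∈-concatMap f m n = ∈-concatMap⁺ f (Any.map (λ { refl → n }) m)

∈-concatMap′ : ∀ {A B : Set} (f : A → List B) xs {z} → z ∈ concatMap f xs → Σ[ x ∈ A ] x ∈ xs × z ∈ f x
∈-concatMap′ f xs m = find (∈-concatMap⁻ f {xs = xs} m)

length-concatMap : ∀ {A B : Set} (f : A → List B) xs → length (concatMap f xs) ≡ sum (map (length ∘ f) xs)
length-concatMap f []       = refl
length-concatMap f (x ∷ xs) = trans (length-++ (f x)) (cong (length (f x) +_) (length-concatMap f xs))

sum-constant : ∀ {A : Set} (f : A → ℕ) {c} xs → (∀ {x} → x ∈ xs → f x ≡ c) → sum (map f xs) ≡ c * length xs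
sum-constant f {c} []       h = sym (*-zeroʳ c)
sum-constant f {c} (x ∷ xs) h = trans (cong₂ _+_ (h (here refl)) (sum-constant f xs (h ∘ there))) (sym (*-suc c (length xs)))

map-cong-∈ : ∀ {A B : Set} {f g : A → B} {xs} → (∀ {x} → x ∈ xs → f x ≡ g x) → map f xs ≡ map g xs
map-cong-∈ {xs = []}     h = refl
map-cong-∈ {xs = x ∷ xs} h = cong₂ _∷_ (h (here refl)) (map-cong-∈ (h ∘ there))

unique-one : ∀ {A : Set} {xs : List A} {y} → Unique xs → y ∈ xs → (∀ {x} → x ∈ xs → x ≡ y) → length xs ≡ 1
unique-one {y = y} u m h = same-members-length {ys = y ∷ []} u ([] ∷ []) (λ n → here (h n)) λ { (here refl) → m }

-- Words, fillings and partitions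

∈-wordsOver⁺ : ∀ {A : Set} {as w : List A} → All (_∈ as) w → w ∈ wordsOver as (length w)
∈-wordsOver⁺ []       = here refl
∈-wordsOver⁺ (m ∷ ms) = ∈-cartesianProductWith⁺ _∷_ m (∈-wordsOver⁺ ms)

∈-wordsOver⁻ : ∀ {A : Set} (as : List A) n {w} → w ∈ wordsOver as n → All (_∈ as) w
∈-wordsOver⁻ as zero    (here refl) = []
∈-wordsOver⁻ as (suc n) m with ∈-cartesianProductWith⁻ _∷_ as (wordsOver as n) m
... | a , w , a∈ , w∈ , refl = a∈ ∷ ∈-wordsOver⁻ as n w∈

wordsOver-unique : ∀ {A : Set} {as : List A} n → Unique as → Unique (wordsOver as n)
wordsOver-unique zero    u = [] ∷ []
wordsOver-unique (suc n) u = Unique.cartesianProductWith⁺ _∷_ (λ e → ∷-injective e) u (wordsOver-unique n u)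

∈-fillings⁺ : ∀ {A : Set} {as : List A} {T} → AllLetters (_∈ as) T → T ∈ fillings as (shapeᵗ T)
∈-fillings⁺ []       = here refl
∈-fillings⁺ (r ∷ rs) = ∈-cartesianProductWith⁺ _∷_ (∈-wordsOver⁺ r) (∈-fillings⁺ rs)

∈-fillings⁻ : ∀ {A : Set} (as : List A) s {T} → T ∈ fillings as s → AllLetters (_∈ as) T
∈-fillings⁻ as []      (here refl) = []
∈-fillings⁻ as (k ∷ s) m with ∈-cartesianProductWith⁻ _∷_ (wordsOver as k) (fillings as s) m
... | r , T , r∈ , T∈ , refl = ∈-wordsOver⁻ as k r∈ ∷ ∈-fillings⁻ as s T∈

fillings-unique : ∀ {A : Set} {as : List A} s → Unique as → Unique (fillings as s)
fillings-unique []      u = [] ∷ []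
fillings-unique (k ∷ s) u = Unique.cartesianProductWith⁺ _∷_ (λ e → ∷-injective e) (wordsOver-unique k u) (fillings-unique s u)

Positive : List ℕ → Set
Positive = All (0 <_)

compositions-sum : ∀ n {c} → c ∈ compositions n → Positive c × sum c ≡ n
compositions-sum zero    (here refl) = [] , refl
compositions-sum (suc n) m with ∈-concatMap′ _ (compositions n) m
... | [] , c∈ , here refl = z<s ∷ [] , cong suc (proj₂ (compositions-sum n c∈))
... | k ∷ ks , c∈ , here refl = z<s ∷ proj₁ (compositions-sum n c∈) , cong suc (proj₂ (compositions-sum n c∈))
... | k ∷ ks , c∈ , there (here refl) = z<s ∷ All.tail (proj₁ (compositions-sum n c∈)) , cong suc (proj₂ (compositions-sum n c∈))

∈-compositions : ∀ n {c} → Positive c → sum c ≡ n → c ∈ compositions n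
∈-compositions zero {[]} [] e = here refl
∈-compositions zero {suc _ ∷ _} _ ()
∈-compositions zero {zero ∷ _} (() ∷ _) _
∈-compositions (suc n) {zero ∷ c} (() ∷ _) e
∈-compositions (suc n) {suc zero ∷ []} (_ ∷ ps) e = ∈-concatMap _ (∈-compositions n {[]} ps (suc-injective e)) (here refl)
∈-compositions (suc n) {suc zero ∷ c@(_ ∷ _)} (_ ∷ ps) e = ∈-concatMap _ (∈-compositions n {c} ps (suc-injective e)) (here refl)
∈-compositions (suc n) {suc (suc k) ∷ c} (_ ∷ ps) e = ∈-concatMap _ (∈-compositions n {suc k ∷ c} (z<s ∷ ps) (suc-injective e)) (there (here refl))

compositions-unique : ∀ n → Unique (compositions n)
compositions-unique zero    = [] ∷ []
compositions-unique (suc n) = concatMap-unique (compositions-unique n) (λ {c} _ → each c)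
  (λ m m′ → inj (proj₁ (compositions-sum n m)) (proj₁ (compositions-sum n m′)))
  where
  each : ∀ c → Unique _
  each []       = [] ∷ []
  each (k ∷ ks) = ((λ e → 1+n≢n (cong length (∷-injectiveʳ e))) ∷ []) ∷ [] ∷ []
  inj : ∀ {c c′ z} → Positive c → Positive c′ → z ∈ _ → z ∈ _ → c ≡ c′
  inj {[]}    {[]}    _ _ _ _ = refl
  inj {[]}    {_ ∷ _} _ _ (here refl) (here ())
  inj {[]}    {_ ∷ _} _ (lt ∷ _) (here refl) (there (here refl)) = ⊥-elim (n≮n _ lt)
  inj {_ ∷ _} {[]}    _ _ (here ()) (here refl)
  inj {_ ∷ _} {[]}    (lt ∷ _) _ (there (here refl)) (here refl) = ⊥-elim (n≮n _ lt)
  inj {_ ∷ _} {_ ∷ _} _ _ (here refl) (here refl) = refl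
  inj {_ ∷ _} {_ ∷ _} _ (lt ∷ _) (here refl) (there (here refl)) = ⊥-elim (n≮n _ lt)
  inj {_ ∷ _} {_ ∷ _} (lt ∷ _) _ (there (here refl)) (here refl) = ⊥-elim (n≮n _ lt)
  inj {_ ∷ _} {_ ∷ _} _ _ (there (here refl)) (there (here refl)) = refl

∈-partitions : ∀ {μ} → IsPartition μ → μ ∈ partitions (sum μ)
∈-partitions {μ} p = ∈-filter⁺ isPartition? (∈-compositions (sum μ) (proj₁ p) refl) p

partitions⁻ : ∀ n {μ} → μ ∈ partitions n → IsPartition μ × sum μ ≡ n
partitions⁻ n m with ∈-filter⁻ isPartition? {xs = compositions n} m
... | m′ , p = p , proj₂ (compositions-sum n m′)

partitions-unique : ∀ n → Unique (partitions n)
partitions-unique n = Unique.filter⁺ isPartition? (compositions-unique n)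

sum-shape : ∀ {A : Set} (T : Filling A) → sum (shapeᵗ T) ≡ size T
sum-shape []      = refl
sum-shape (r ∷ T) = trans (cong (length r +_) (sum-shape T)) (sym (length-++ r))

-- Shifted classes over a plactic class

dedup-distinct : ∀ {A : Set} {R : A → A → Set} (R? : ∀ x y → Dec (R x y)) xs → AllPairs (λ x y → ¬ R x y) (deduplicate R? xs)
dedup-distinct R? []       = []
dedup-distinct R? (x ∷ xs) = All.all-filter (¬? ∘ R? x) (deduplicate R? xs) ∷ AllPairs.filter⁺ (¬? ∘ R? x) (dedup-distinct R? xs)

-- The shifted tableaux of shape `ν` whose classes `π` maps to the class of `U`; its length is the
-- coefficient of that class in the image of `𝒫 ν`.
over : List ℕ → Filling ℕ → List (Filling X′)
over ν U = map P-mix (filter (λ w → isShiftedTableau? ν (P-mix w)) (fibre U))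

over-unique : ∀ ν U → Unique (over ν U)
over-unique ν U = AllPairs.map⁺ (AllPairs.filter⁺ (λ w → isShiftedTableau? ν (P-mix w))
  (dedup-distinct (λ v w → P-mix v ≟ᵗ′ P-mix w) (placticClass U)))

∈-over⁺ : ∀ {ν} w → IsShiftedTableau ν (P-mix w) → P-mix w ∈ over ν (P-RSK w)
∈-over⁺ {ν} w s with find (Any′.deduplicate⁺ (λ v w → P-mix v ≟ᵗ′ P-mix w) {P = λ v → P-mix w ≡ P-mix v}
    (λ e p → trans p (sym e)) (Any.map (cong P-mix) w∈))
  where
  L = rsk-letters w
  w∈ : w ∈ placticClass (P-RSK w)
  w∈ = ∈-filter⁺ (λ v → P-RSK v ≟ᵗ P-RSK w) (subst (λ n → w ∈ wordsOver (concat (P-RSK w)) n) (sym (↭.↭-length L))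
         (∈-wordsOver⁺ (All.tabulate λ m → ↭.∈-resp-↭ (↭-sym L) m))) refl
... | v , v∈ , e = subst (_∈ over ν (P-RSK w)) (sym e)
      (∈-map⁺ P-mix (∈-filter⁺ (λ w → isShiftedTableau? ν (P-mix w)) v∈ (subst (IsShiftedTableau ν) e s)))

∈-over⁻ : ∀ {ν} U {T} → T ∈ over ν U → Σ[ w ∈ Word ] P-RSK w ≡ U × P-mix w ≡ T × IsShiftedTableau ν T
∈-over⁻ {ν} U m with ∈-map⁻ P-mix m
... | w , w∈ , refl with ∈-filter⁻ (λ w → isShiftedTableau? ν (P-mix w)) {xs = fibre U} w∈
...   | w∈′ , s = w , proj₂ (∈-filter⁻ (λ v → P-RSK v ≟ᵗ U) {xs = wordsOver (concat U) (size U)} (Any′.deduplicate⁻ _ w∈′)) , refl , s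

nonEmpty-shape : ∀ {A B : Set} (T : Filling A) (U : Filling B) → NonEmpty T → NonEmpty U → (∀ i → rowLen T i ≡ rowLen U i) → shapeᵗ T ≡ shapeᵗ U
nonEmpty-shape []      []      _ _ h = refl
nonEmpty-shape (r ∷ T) (q ∷ U) (_ ∷ ns) (_ ∷ ms) h = cong₂ _∷_ (h 0) (nonEmpty-shape T U ns ms (h ∘ suc))
nonEmpty-shape []      (q ∷ U) _ (m ∷ _) h = ⊥-elim (<⇒≢ m (h 0))
nonEmpty-shape (r ∷ T) []      (n ∷ _) _ h = ⊥-elim (<⇒≢ n (sym (h 0)))

strict-diagram : ∀ {ν T} → IsStrictPartition ν → IsShiftedTableau ν T → Diagram shifted (shapeᵗ T)
strict-diagram p (refl , _) = p

-- The injection replaces U by U′ and keeps both recording tableaux.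
over-≤ : ∀ {ν μ U U′} → IsStrictPartition ν → IsPartition μ → IsYoungTableau μ U → IsYoungTableau μ U′ →
         length (over ν U) ≤ length (over ν U′)
over-≤ {ν} {μ} {U} {U′} sp p y y′ = go (over ν U) (over-unique ν U) (∈-over⁻ U)
  where
  go : ∀ Ts → Unique Ts → (∀ {T} → T ∈ Ts → Σ[ w ∈ Word ] P-RSK w ≡ U × P-mix w ≡ T × IsShiftedTableau ν T) → length Ts ≤ length (over ν U′)
  go []           _ _ = z≤n
  go Ts@(T₀ ∷ _) u f with f (here refl)
  -- One mixed recording path `R` is fixed for all tableaux: it depends on their common shape only.
  ... | _ , _ , _ , s₀ with tableau-path (shifted-tableau⁻ s₀) (strict-diagram sp s₀)
  ...   | R , P , R₀ , l₀ = injection-length {R = Linked′} u exists injective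
    where
    Linked′ : Filling X′ → Filling X′ → Set
    Linked′ T T′ = ∃₂ λ w w′ → ∃ λ qs → Recorded w R qs × Recorded w′ R qs × P-mix w ≡ T × P-RSK w ≡ U × P-mix w′ ≡ T′ × P-RSK w′ ≡ U′

    same : ∀ {T} → IsShiftedTableau ν T → Rows shifted T (pathShape shifted R)
    same {T} (e , _) i = trans (cong (i +_) (shape-rowLen T T₀ (trans e (sym (proj₁ s₀))) i)) (R₀ i)

    exists : ∀ {T} → T ∈ Ts → Σ[ T′ ∈ Filling X′ ] T′ ∈ over ν U′ × Linked′ T T′
    exists {T} m with f m
    -- The word `w₁` that shows `T` to lie over `U` may have any recording path. It is replaced by
    -- the word with path `R`, whose RSK tableau is again `U` since `T` determines it.
    ... | w₁ , e₁ , e₂ , s with mix-surjective (shifted-tableau⁻ s) (strict-diagram sp s) P (same s)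
                                 (trans l₀ (size-shape T₀ T (trans (proj₁ s₀) (sym (proj₁ s)))))
    ...   | w , e , qs , r with trans (mix-determines-rsk w w₁ (trans e (sym e₂))) e₁
    ...     | e₃ with rsk-surjective {U = U′} r (young-tableau⁻ y′) (subst IsPartition (sym (proj₁ y′)) p)
                        (trans (proj₁ y′) (sym (trans (cong shapeᵗ e₃) (proj₁ y))))
    -- `w′` shares the RSK recording path of `w`, hence also the path `R`, so its mixed tableau has
    -- shape `ν`.
    ...       | w′ , e₄ , os′ , r′ with recorded-determined r′ r
    ...         | refl = P-mix w′ , subst (λ V → P-mix w′ ∈ over ν V) e₄ (∈-over⁺ w′ s′) , w , w′ , qs , r , r′ , e , e₃ , refl , e₄
      where
      B = mix-built r′
      s′ : IsShiftedTableau ν (P-mix w′)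
      s′ = subst (λ n → IsShiftedTableau n (P-mix w′)) (trans (nonEmpty-shape (P-mix w′) T (nonEmpty B)
             (All.map⁻ (proj₁ (strict-diagram sp s))) (λ i → +-cancelˡ-≡ i _ _ (trans (rowsᵇ B i) (sym (same s i))))) (proj₁ s)) (mix-tableau w′)

    injective : ∀ {T₁ T₂ T′} → Linked′ T₁ T′ → Linked′ T₂ T′ → T₁ ≡ T₂
    injective (w₁ , w₁′ , qs₁ , r₁ , r₁′ , a₁ , b₁ , c₁ , d₁) (w₂ , w₂′ , qs₂ , r₂ , r₂′ , a₂ , b₂ , c₂ , d₂)
      with mix-injective r₁′ r₂′ (trans c₁ (sym c₂))
    ... | refl with recorded-functional r₁′ r₂′
    ...   | _ , refl with rsk-injective r₁ r₂ (trans b₁ (sym b₂))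
    ...     | refl = trans (sym a₁) a₂

over-≡ : ∀ {ν μ U U′} → IsStrictPartition ν → IsPartition μ → IsYoungTableau μ U → IsYoungTableau μ U′ →
         length (over ν U) ≡ length (over ν U′)
over-≡ sp p y y′ = ≤-antisym (over-≤ sp p y y′) (over-≤ sp p y′ y)

-- Contents

count : ℕ → List ℕ → ℕ
count i is = length (filter (_≟ i) is)

count-∷ : ∀ i x is → count i (x ∷ is) ≡ δ x i + count i is
count-∷ i x is = go (x ≟ i)
  where
  go : Dec (x ≡ i) → count i (x ∷ is) ≡ δ x i + count i is
  go (yes refl) = trans (cong length (filter-accept (_≟ i) refl)) (cong (_+ count i is) (sym (δ-refl i)))
  go (no ne)    = trans (cong length (filter-reject (_≟ i) ne)) (cong (_+ count i is) (sym (δ-≢ ne)))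

count-sum : ∀ i is → count i is ≡ sum (map (λ x → δ x i) is)
count-sum i []       = refl
count-sum i (x ∷ is) = trans (count-∷ i x is) (cong (δ x i +_) (count-sum i is))

count-↭ : ∀ i {is js} → is ↭ js → count i is ≡ count i js
count-↭ i {is} {js} p = trans (count-sum i is) (trans (sum-↭ (↭.map⁺ _ p)) (sym (count-sum i js)))

count-++ : ∀ i xs ys → count i (xs ++ ys) ≡ count i xs + count i ys
count-++ i xs ys = trans (cong length (filter-++ (_≟ i) xs ys)) (length-++ (filter (_≟ i) xs))

exponents-↭ : ∀ m {is js} → is ↭ js → exponents m is ≡ exponents m js
exponents-↭ m p = map-cong (λ i → count-↭ i p) (upTo m)

map-applyUpTo′ : ∀ {A B : Set} (f : A → B) g n → map f (applyUpTo g n) ≡ applyUpTo (f ∘ g) n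
map-applyUpTo′ f g zero    = refl
map-applyUpTo′ f g (suc n) = cong (f (g 0) ∷_) (map-applyUpTo′ f (g ∘ suc) n)

exponents-applyUpTo : ∀ m is → exponents m is ≡ applyUpTo (λ i → count i is) m
exponents-applyUpTo m is = map-applyUpTo′ (λ i → count i is) id m

-- `weight 0 μ` is the statistic Σ i μ_i with `i` counted from 0, usually denoted n(μ). Applied to a
-- content it is the sum of the letters.
weight : ℕ → List ℕ → ℕ
weight i []      = 0
weight i (k ∷ μ) = k * i + weight (suc i) μ

applyUpTo-cong : ∀ {f g : ℕ → ℕ} m → (∀ i → f i ≡ g i) → applyUpTo f m ≡ applyUpTo g m
applyUpTo-cong zero    h = refl
applyUpTo-cong (suc m) h = cong₂ _∷_ (h 0) (applyUpTo-cong m (h ∘ suc))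

+-interchange : ∀ a b c d → (a + b) + (c + d) ≡ (a + c) + (b + d)
+-interchange a b c d = trans (+-assoc a b (c + d)) (trans (cong (a +_) (+-swap b c d)) (sym (+-assoc a c (b + d))))

module _ (f h : ℕ → ℕ) where

  sum-applyUpTo-+ : ∀ m → sum (applyUpTo (λ i → f i + h i) m) ≡ sum (applyUpTo f m) + sum (applyUpTo h m)
  sum-applyUpTo-+ = go f h
    where
    go : ∀ f h m → sum (applyUpTo (λ i → f i + h i) m) ≡ sum (applyUpTo f m) + sum (applyUpTo h m)
    go f h zero    = refl
    go f h (suc m) = trans (cong (f 0 + h 0 +_) (go (f ∘ suc) (h ∘ suc) m)) (+-interchange (f 0) (h 0) _ _)

  weight-applyUpTo-+ : ∀ j m → weight j (applyUpTo (λ i → f i + h i) m) ≡ weight j (applyUpTo f m) + weight j (applyUpTo h m)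
  weight-applyUpTo-+ = go f h
    where
    go : ∀ f h j m → weight j (applyUpTo (λ i → f i + h i) m) ≡ weight j (applyUpTo f m) + weight j (applyUpTo h m)
    go f h j zero    = refl
    go f h j (suc m) = trans (cong₂ _+_ (*-distribʳ-+ j (f 0) (h 0)) (go (f ∘ suc) (h ∘ suc) (suc j) m)) (+-interchange (f 0 * j) (h 0 * j) _ _)

sum-zero : ∀ m → sum (applyUpTo (λ _ → 0) m) ≡ 0
sum-zero zero    = refl
sum-zero (suc m) = sum-zero m

weight-zero : ∀ j m → weight j (applyUpTo (λ _ → 0) m) ≡ 0
weight-zero j zero    = refl
weight-zero j (suc m) = weight-zero (suc j) m

sum-δ : ∀ {x m} → x < m → sum (applyUpTo (δ x) m) ≡ 1
sum-δ {zero}  {suc m} lt = cong suc (sum-zero m)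
sum-δ {suc x} {suc m} lt = sum-δ (s<s⁻¹ lt)

weight-δ : ∀ {x m} j → x < m → weight j (applyUpTo (δ x) m) ≡ j + x
weight-δ {zero}  {suc m} j lt = cong₂ _+_ (*-identityˡ j) (weight-zero (suc j) m)
weight-δ {suc x} {suc m} j lt = trans (weight-δ (suc j) (s<s⁻¹ lt)) (sym (+-suc j x))

sum-exponents : ∀ {m is} → All (_< m) is → sum (exponents m is) ≡ length is
sum-exponents {m} {is} a = trans (cong sum (exponents-applyUpTo m is)) (go a)
  where
  go : ∀ {is} → All (_< m) is → sum (applyUpTo (λ i → count i is) m) ≡ length is
  go [] = sum-zero m
  go {x ∷ is} (lt ∷ a) = trans (cong sum (applyUpTo-cong m (λ i → count-∷ i x is)))
    (trans (sum-applyUpTo-+ (δ x) (λ i → count i is) m) (cong₂ _+_ (sum-δ lt) (go a)))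

weight-exponents : ∀ {m is} → All (_< m) is → weight 0 (exponents m is) ≡ sum is
weight-exponents {m} {is} a = trans (cong (weight 0) (exponents-applyUpTo m is)) (go a)
  where
  go : ∀ {is} → All (_< m) is → weight 0 (applyUpTo (λ i → count i is) m) ≡ sum is
  go [] = weight-zero 0 m
  go {x ∷ is} (lt ∷ a) = trans (cong (weight 0) (applyUpTo-cong m (λ i → count-∷ i x is)))
    (trans (weight-applyUpTo-+ (δ x) (λ i → count i is) 0 m) (cong₂ _+_ (weight-δ 0 lt) (go a)))

-- The superstandard tableau: every row is constant, with letters increasing by one from row to row.
-- It represents its shape in the counts below.
canon : ℕ → List ℕ → Filling ℕ
canon i []      = []
canon i (k ∷ μ) = replicate k i ∷ canon (suc i) μ

shape-canon : ∀ i μ → shapeᵗ (canon i μ) ≡ μ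
shape-canon i []      = refl
shape-canon i (k ∷ μ) = cong₂ _∷_ (length-replicate k) (shape-canon (suc i) μ)

in-canon : ∀ s μ {i j v} → In straight (canon s μ) i j v → v ≡ s + i
in-canon s (k ∷ μ) (here n) = trans (nth-replicate k n) (sym (+-identityʳ s))
  where
  nth-replicate : ∀ k {j v} → Nth (replicate k s) j v → v ≡ s
  nth-replicate (suc k) zero    = refl
  nth-replicate (suc k) (suc n) = nth-replicate k n
in-canon s (k ∷ μ) (there n) = trans (in-canon (suc s) μ n) (sym (+-suc s _))

canon-young : ∀ μ → IsYoungTableau μ (canon 0 μ)
canon-young μ = shape-canon 0 μ ,
  rows⁺ straight (canon 0 μ) (λ _ n m → ≤-reflexive (trans (in-canon 0 μ n) (sym (in-canon 0 μ m)))) ,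
  subst (All (AllPairs _<_)) (cols′-straight (canon 0 μ))
    (columns⁺ straight (canon 0 μ) λ lt n m → subst₂ _<_ (sym (in-canon 0 μ n)) (sym (in-canon 0 μ m)) lt)

canon-letters : ∀ s μ → AllLetters (_< s + length μ) (canon s μ)
canon-letters s []      = []
canon-letters s (k ∷ μ) = All.replicate⁺ k (m<m+n s z<s) ∷ subst (λ n → AllLetters (_< n) (canon (suc s) μ)) (sym (+-suc s (length μ))) (canon-letters (suc s) μ)

count-absent : ∀ {i is} → All (i ≢_) is → count i is ≡ 0
count-absent [] = refl
count-absent {i} {x ∷ is} (ne ∷ a) = trans (count-∷ i x is) (cong₂ _+_ (δ-≢ (ne ∘ sym)) (count-absent a))

count-replicate : ∀ s k → count s (replicate k s) ≡ k
count-replicate s zero    = refl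
count-replicate s (suc k) = trans (count-∷ s s _) (cong₂ _+_ (δ-refl s) (count-replicate s k))

canon-≥ : ∀ s μ → AllLetters (s ≤_) (canon s μ)
canon-≥ s []      = []
canon-≥ s (k ∷ μ) = All.replicate⁺ k ≤-refl ∷ All.map (All.map <⇒≤) (canon-≥ (suc s) μ)

count-canon-head : ∀ s k μ → count (s + 0) (concat (canon s (k ∷ μ))) ≡ k
count-canon-head s k μ rewrite +-identityʳ s = trans (count-++ s (replicate k s) _)
  (trans (cong₂ _+_ (count-replicate s k) (count-absent (All.concat⁺ (All.map (All.map <⇒≢) (canon-≥ (suc s) μ))))) (+-identityʳ k))

count-canon-tail : ∀ s k μ t → count (s + suc t) (concat (canon s (k ∷ μ))) ≡ count (suc s + t) (concat (canon (suc s) μ))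
count-canon-tail s k μ t rewrite +-suc s t = trans (count-++ (suc s + t) (replicate k s) _)
  (cong (_+ count (suc s + t) (concat (canon (suc s) μ))) (count-absent (All.replicate⁺ k (<⇒≢ (s≤s (m≤m+n s t)) ∘ sym))))

canon-counts : ∀ s μ → applyUpTo (λ t → count (s + t) (concat (canon s μ))) (length μ) ≡ μ
canon-counts s []      = refl
canon-counts s (k ∷ μ) = cong₂ _∷_ (count-canon-head s k μ)
  (trans (applyUpTo-cong (length μ) (count-canon-tail s k μ)) (canon-counts (suc s) μ))

-- Only the first `length μ` letters are counted, which reads off the parts of `μ′` one by one; the
-- equality of the sums excludes further parts.
canon-content : ∀ s {μ μ′} → Positive μ → Positive μ′ → sum μ′ ≡ sum μ →
  applyUpTo (λ t → count (s + t) (concat (canon s μ′))) (length μ) ≡ μ → μ′ ≡ μ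
canon-content s {[]}    {[]}     _ _ _ _ = refl
canon-content s {[]}    {k ∷ μ′} _ (lt ∷ _) e _ = ⊥-elim (<⇒≢ (<-≤-trans lt (m≤m+n k _)) (sym e))
canon-content s {k ∷ μ} {[]}     (lt ∷ _) _ _ q = ⊥-elim (<⇒≢ lt (∷-injectiveˡ q))
canon-content s {k ∷ μ} {k′ ∷ μ′} (_ ∷ p) (_ ∷ p′) e q with trans (sym (count-canon-head s k′ μ′)) (∷-injectiveˡ q)
... | refl = cong (k ∷_) (canon-content (suc s) p p′ (+-cancelˡ-≡ k _ _ e)
      (trans (sym (applyUpTo-cong (length μ) (count-canon-tail s k μ′))) (∷-injectiveʳ q)))

-- Unitriangularity of the Kostka numbers

young-≥ : ∀ {μ U} → IsPartition μ → IsYoungTableau μ U → ∀ i {j v} → In straight U i j v → i ≤ v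
young-≥ p y zero n = z≤n
young-≥ {U = U} p y@(refl , _ , c) (suc i) n
  with in-exists straight U i z≤n (<-≤-trans (in-< n) (diagram-steps straight U p i (≤-<-trans z≤n (in-< n))))
... | v′ , n′ = ≤-<-trans (young-≥ p y i n′)
      (columns⁻ straight U (subst (All (AllPairs _<_)) (sym (cols′-straight U)) c) (n<1+n i) n′ n)

+-tight : ∀ {a b c d} → a ≤ b → c ≤ d → a + c ≡ b + d → a ≡ b × c ≡ d
+-tight {a} {b} {c} {d} le l e with m≤n⇒m<n∨m≡n le
... | inj₁ lt = ⊥-elim (<⇒≢ (+-mono-<-≤ lt l) e)
... | inj₂ refl = refl , +-cancelˡ-≡ a c d e

row-weight : ∀ {i r} → All (i ≤_) r → length r * i ≤ sum r × (length r * i ≡ sum r → r ≡ replicate (length r) i)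
row-weight [] = z≤n , λ _ → refl
row-weight {i} {x ∷ r} (le ∷ a) with row-weight a
... | l , h = +-mono-≤ le l , λ e → let p , q = +-tight le l e in cong₂ _∷_ (sym p) (h q)

-- Each entry of row `i` is replaced by its lower bound `s + i`; the sums agree only if no entry
-- exceeds its bound.
tableau-weight : ∀ s U → (∀ {i j v} → In straight U i j v → s + i ≤ v) →
  weight s (shapeᵗ U) ≤ sum (concat U) × (weight s (shapeᵗ U) ≡ sum (concat U) → U ≡ canon s (shapeᵗ U))
tableau-weight s []      h = z≤n , λ _ → refl
tableau-weight s (r ∷ U) h with row-weight {s} {r} (allNth⁺ {R = _≡_} r (λ {_} {v} n → subst (_≤ v) (+-identityʳ s) (h (here n))))
                              | tableau-weight (suc s) U (λ {i} {_} {v} n → subst (_≤ v) (+-suc s i) (h (there n)))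
... | l , e | l′ , e′ = subst (weight s (shapeᵗ (r ∷ U)) ≤_) (sym (sum-++ r (concat U))) (+-mono-≤ l l′) , λ q →
      let p , p′ = +-tight l l′ (trans q (sum-++ r (concat U))) in cong₂ _∷_ (e p) (e′ p′)

youngOf : List ℕ → List ℕ → List (Filling ℕ)
youngOf α μ = filter (λ U → exponents (length α) (concat U) ≟ˢ α) (youngTableaux (length α) μ)

youngOf-unique : ∀ α μ → Unique (youngOf α μ)
youngOf-unique α μ = Unique.filter⁺ _ (Unique.filter⁺ (isYoungTableau? μ) (fillings-unique μ (Unique.upTo⁺ (length α))))

∈-youngOf⁺ : ∀ α {μ U} → IsYoungTableau μ U → AllLetters (_< length α) U → exponents (length α) (concat U) ≡ α → U ∈ youngOf α μ
∈-youngOf⁺ α {μ} {U} y@(refl , _) l e = ∈-filter⁺ (λ U → exponents (length α) (concat U) ≟ˢ α)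
  (∈-filter⁺ (isYoungTableau? μ) (∈-fillings⁺ (All.map (All.map ∈-upTo⁺) l)) y) e

∈-youngOf⁻ : ∀ α μ {U} → U ∈ youngOf α μ → IsYoungTableau μ U × All (_< length α) (concat U) × exponents (length α) (concat U) ≡ α
∈-youngOf⁻ α μ m with ∈-filter⁻ (λ U → exponents (length α) (concat U) ≟ˢ α) {xs = youngTableaux (length α) μ} m
... | m′ , e with ∈-filter⁻ (isYoungTableau? μ) {xs = fillings (upTo (length α)) μ} m′
...   | m″ , y = y , All.concat⁺ (All.map (All.map ∈-upTo⁻) (∈-fillings⁻ (upTo (length α)) μ m″)) , e

kostka-diagonal : ∀ {μ} → IsPartition μ → length (youngOf μ μ) ≡ 1
kostka-diagonal {μ} p = unique-one (youngOf-unique μ μ)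
  (∈-youngOf⁺ μ (canon-young μ) (canon-letters 0 μ) (trans (exponents-applyUpTo (length μ) (concat (canon 0 μ))) (canon-counts 0 μ))) only
  where
  only : ∀ {U} → U ∈ youngOf μ μ → U ≡ canon 0 μ
  only {U} m with ∈-youngOf⁻ μ μ m
  ... | y@(e , _) , l , q = trans (proj₂ (tableau-weight 0 U (λ {i} n → young-≥ p y i n))
          (trans (cong (weight 0) (trans e (sym q))) (weight-exponents l))) (cong (canon 0) e)

-- The entries sum to the weight of the content `μ`, which is at least that of the shape `μ′`.
-- Equality would make the tableau superstandard, with content equal to its shape.
kostka-triangular : ∀ {μ μ′} → IsPartition μ → IsPartition μ′ → sum μ′ ≡ sum μ → μ′ ≢ μ →
  ∀ {U} → U ∈ youngOf μ μ′ → weight 0 μ′ < weight 0 μ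
kostka-triangular {μ} {μ′} p p′ s ne {U} m with ∈-youngOf⁻ μ μ′ m
... | y@(e , _) , l , q with tableau-weight 0 U (λ {i} n → young-≥ p′ y i n)
...   | le , h = ≤∧≢⇒< (subst₂ _≤_ (cong (weight 0) e) w le) λ eq → ne (canon-content 0 (proj₁ p) (proj₁ p′) s
          (trans (sym (exponents-applyUpTo (length μ) (concat (canon 0 μ′)))) (trans (cong (exponents (length μ) ∘ concat)
            (sym (trans (h (trans (cong (weight 0) e) (trans eq (sym w)))) (cong (canon 0) e)))) q)))
  where
  w : sum (concat U) ≡ weight 0 μ
  w = trans (sym (weight-exponents l)) (cong (weight 0) q)

-- Counting shifted tableaux by content

-- Repeats the local alphabet of `shiftedTableaux`, with which it agrees by definition.
alphabet : ℕ → List X′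
alphabet n = concatMap (λ i → primed i ∷ unprimed i ∷ []) (upTo n)

∈-alphabet⁺ : ∀ {n} x → ∣ x ∣ < n → x ∈ alphabet n
∈-alphabet⁺ (primed i)   lt = ∈-concatMap _ (∈-upTo⁺ lt) (here refl)
∈-alphabet⁺ (unprimed i) lt = ∈-concatMap _ (∈-upTo⁺ lt) (there (here refl))

∈-alphabet⁻ : ∀ n {x} → x ∈ alphabet n → ∣ x ∣ < n
∈-alphabet⁻ n m with ∈-concatMap′ (λ i → primed i ∷ unprimed i ∷ []) (upTo n) m
... | i , m′ , here refl         = ∈-upTo⁻ m′
... | i , m′ , there (here refl) = ∈-upTo⁻ m′

alphabet-unique : ∀ n → Unique (alphabet n)
alphabet-unique n = concatMap-unique (Unique.upTo⁺ n) (λ _ → ((λ ()) ∷ []) ∷ [] ∷ []) λ _ _ → inj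
  where
  inj : ∀ {i j z} → z ∈ primed i ∷ unprimed i ∷ [] → z ∈ primed j ∷ unprimed j ∷ [] → i ≡ j
  inj (here refl)         (here refl)         = refl
  inj (here refl)         (there (here ()))
  inj (there (here refl)) (here ())
  inj (there (here refl)) (there (here refl)) = refl

shiftedOf : List ℕ → List ℕ → List (Filling X′)
shiftedOf α ν = filter (λ T → exponents (length α) (map ∣_∣ (concat T)) ≟ˢ α) (shiftedTableaux (length α) ν)

shiftedOf-unique : ∀ α ν → Unique (shiftedOf α ν)
shiftedOf-unique α ν = Unique.filter⁺ _ (Unique.filter⁺ (isShiftedTableau? ν) (fillings-unique ν (alphabet-unique (length α))))

module _ {ν : List ℕ} (sp : IsStrictPartition ν) (α : List ℕ) where
  private
    m = length α

    byContent : List (Filling X′)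
    byContent = concatMap (λ μ → concatMap (over ν) (youngOf α μ)) (partitions (sum α))

    word-of : ∀ {T} → IsShiftedTableau ν T → Σ[ w ∈ Word ] P-mix w ≡ T
    word-of s with tableau-path (shifted-tableau⁻ s) (strict-diagram sp s)
    ... | os , P , R , l with mix-surjective (shifted-tableau⁻ s) (strict-diagram sp s) P R l
    ...   | w , e , _ = w , e

    to : ∀ {T} → T ∈ shiftedOf α ν → T ∈ byContent
    to {T} mem with ∈-filter⁻ (λ T → exponents m (map ∣_∣ (concat T)) ≟ˢ α) {xs = shiftedTableaux m ν} mem
    ... | mem′ , e with ∈-filter⁻ (isShiftedTableau? ν) {xs = fillings (alphabet m) ν} mem′
    ...   | mem″ , s with word-of s
    ...     | w , refl = ∈-concatMap (λ μ → concatMap (over ν) (youngOf α μ)) μ∈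
                (∈-concatMap (over ν) (∈-youngOf⁺ α (rsk-tableau w) (All.concat⁻ (↭.All-resp-↭ p small)) content) (∈-over⁺ w s))
      where
      p : map ∣_∣ (concat (P-mix w)) ↭ concat (P-RSK w)
      p = ↭-trans (mix-letters w) (↭-sym (rsk-letters w))
      small : All (_< m) (map ∣_∣ (concat (P-mix w)))
      small = All.map⁺ (All.concat⁺ (All.map (All.map (∈-alphabet⁻ m)) (∈-fillings⁻ (alphabet m) ν mem″)))
      content : exponents m (concat (P-RSK w)) ≡ α
      content = trans (sym (exponents-↭ m p)) e
      μ∈ : shapeᵗ (P-RSK w) ∈ partitions (sum α)
      μ∈ = subst (λ n → shapeᵗ (P-RSK w) ∈ partitions n) (trans (sum-shape (P-RSK w))
             (trans (sym (sum-exponents (↭.All-resp-↭ p small))) (cong sum content))) (∈-partitions (rsk-partition w))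

    from : ∀ {T} → T ∈ byContent → T ∈ shiftedOf α ν
    from mem with ∈-concatMap′ (λ μ → concatMap (over ν) (youngOf α μ)) (partitions (sum α)) mem
    ... | μ , _ , mem₁ with ∈-concatMap′ (over ν) (youngOf α μ) mem₁
    ...   | U , U∈ , mem₂ with ∈-youngOf⁻ α μ U∈ | ∈-over⁻ U mem₂
    ...     | _ , l , c | w , refl , refl , s@(sh , _) = ∈-filter⁺ (λ T → exponents m (map ∣_∣ (concat T)) ≟ˢ α)
                (∈-filter⁺ (isShiftedTableau? ν) (subst (λ n → P-mix w ∈ fillings (alphabet m) n) sh
                  (∈-fillings⁺ (All.map (All.map (∈-alphabet⁺ _)) (All.concat⁻ (All.map⁻ (↭.All-resp-↭ (↭-sym p) l)))))) s)
                (trans (exponents-↭ m p) c)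
      where
      p : map ∣_∣ (concat (P-mix w)) ↭ concat (P-RSK w)
      p = ↭-trans (mix-letters w) (↭-sym (rsk-letters w))

    over-injective : ∀ {U V T} → T ∈ over ν U → T ∈ over ν V → U ≡ V
    over-injective {U} {V} a b with ∈-over⁻ U a | ∈-over⁻ V b
    ... | w , refl , e , _ | w′ , refl , e′ , _ = mix-determines-rsk w w′ (trans e (sym e′))

    byContent-unique : Unique byContent
    byContent-unique = concatMap-unique (partitions-unique (sum α))
      (λ {μ} _ → concatMap-unique (youngOf-unique α μ) (λ {U} _ → over-unique ν U) (λ {U} {V} _ _ → over-injective {U} {V}))
      λ {μ} {μ′} _ _ a b → same (∈-concatMap′ (over ν) (youngOf α μ) a) (∈-concatMap′ (over ν) (youngOf α μ′) b)
      where
      same : ∀ {μ μ′ T} → Σ[ U ∈ _ ] U ∈ youngOf α μ × T ∈ over ν U → Σ[ U ∈ _ ] U ∈ youngOf α μ′ × T ∈ over ν U → μ ≡ μ′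
      same {μ} {μ′} (U , U∈ , a) (V , V∈ , b) with over-injective {U} {V} a b
      ... | refl = trans (sym (proj₁ (proj₁ (∈-youngOf⁻ α μ U∈)))) (proj₁ (proj₁ (∈-youngOf⁻ α μ′ V∈)))

  -- Each shifted tableau lies over exactly one Young tableau, which has the same content. How many
  -- lie over a Young tableau depends on its shape alone, so `canon 0 μ` may stand for all those of
  -- shape `μ`.
  shifted-count : length (shiftedOf α ν) ≡ sum (map (λ μ → length (over ν (canon 0 μ)) * length (youngOf α μ)) (partitions (sum α)))
  shifted-count = trans (same-members-length (shiftedOf-unique α ν) byContent-unique to from)
    (trans (length-concatMap (λ μ → concatMap (over ν) (youngOf α μ)) (partitions (sum α))) (cong sum (map-cong-∈ λ {μ} μ∈ →
      trans (length-concatMap (over ν) (youngOf α μ)) (sum-constant (length ∘ over ν) (youngOf α μ) λ U∈ →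
        over-≡ sp (proj₁ (partitions⁻ (sum α) μ∈)) (proj₁ (∈-youngOf⁻ α μ U∈)) (canon-young μ)))))

-- Rational coefficients

nat : ℕ → ℚ
nat zero    = 0ℚ
nat (suc n) = 1ℚ ℚ.+ nat n

nat-+ : ∀ a b → nat (a + b) ≡ nat a ℚ.+ nat b
nat-+ zero    b = sym (ℚ.+-identityˡ (nat b))
nat-+ (suc a) b = trans (cong (1ℚ ℚ.+_) (nat-+ a b)) (sym (ℚ.+-assoc 1ℚ (nat a) (nat b)))

nat-* : ∀ a b → nat (a * b) ≡ nat a ℚ.* nat b
nat-* zero    b = sym (ℚ.*-zeroˡ (nat b))
nat-* (suc a) b = trans (nat-+ b (a * b)) (trans (cong₂ ℚ._+_ (sym (ℚ.*-identityˡ (nat b))) (nat-* a b)) (sym (ℚ.*-distribʳ-+ (nat b) 1ℚ (nat a))))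

nat-sum : ∀ ns → nat (sum ns) ≡ sumℚ (map nat ns)
nat-sum []       = refl
nat-sum (n ∷ ns) = trans (nat-+ n (sum ns)) (cong (nat n ℚ.+_) (nat-sum ns))

sum-indicator : ∀ {A : Set} {P : A → Set} (P? : ∀ x → Dec (P x)) xs → sumℚ (map (indicator ∘ P?) xs) ≡ nat (length (filter P? xs))
sum-indicator P? []       = refl
sum-indicator P? (x ∷ xs) with does (P? x)
... | true  = cong (1ℚ ℚ.+_) (sum-indicator P? xs)
... | false = trans (ℚ.+-identityˡ _) (sum-indicator P? xs)

+ℚ-cancelˡ : ∀ p {q r} → p ℚ.+ q ≡ p ℚ.+ r → q ≡ r
+ℚ-cancelˡ p {q} {r} e = trans (sym (undo′ q)) (trans (cong (ℚ.- p ℚ.+_) e) (undo′ r))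
  where
  undo′ : ∀ q → ℚ.- p ℚ.+ (p ℚ.+ q) ≡ q
  undo′ q = trans (sym (ℚ.+-assoc (ℚ.- p) p q)) (trans (cong (ℚ._+ q) (ℚ.+-inverseˡ p)) (ℚ.+-identityˡ q))

+ℚ-cancelʳ : ∀ p {q r} → q ℚ.+ p ≡ r ℚ.+ p → q ≡ r
+ℚ-cancelʳ p {q} {r} e = +ℚ-cancelˡ p (trans (ℚ.+-comm p q) (trans e (ℚ.+-comm r p)))

module _ {A : Set} (f h : A → ℚ) where

  sums-agree-at : ∀ {y xs} → Unique xs → y ∈ xs → (∀ {x} → x ∈ xs → x ≢ y → f x ≡ h x) →
    sumℚ (map f xs) ≡ sumℚ (map h xs) → f y ≡ h y
  sums-agree-at {y} {x ∷ xs} (a ∷ u) (here refl) g e = +ℚ-cancelʳ (sumℚ (map f xs)) (trans e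
    (cong (λ z → h y ℚ.+ sumℚ z) (map-cong-∈ λ m → sym (g (there m) λ { refl → All.lookup a m refl }))))
  sums-agree-at {y} {x ∷ xs} (a ∷ u) (there m) g e = sums-agree-at u m (g ∘ there)
    (+ℚ-cancelˡ (f x) (trans e (cong (ℚ._+ sumℚ (map h xs)) (sym (g (here refl) (All.lookup a m))))))

sum-single : ∀ {A : Set} (f : A → ℚ) {y xs} → Unique xs → y ∈ xs → (∀ {x} → x ∈ xs → x ≢ y → f x ≡ 0ℚ) → sumℚ (map f xs) ≡ f y
sum-single f {y} {x ∷ xs} (a ∷ u) (here refl) g = trans (cong (f y ℚ.+_) (zeros xs λ m → g (there m) λ { refl → All.lookup a m refl })) (ℚ.+-identityʳ (f y))
  where
  zeros : ∀ xs → (∀ {x} → x ∈ xs → f x ≡ 0ℚ) → sumℚ (map f xs) ≡ 0ℚ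
  zeros []       h = refl
  zeros (x ∷ xs) h = trans (cong₂ ℚ._+_ (h (here refl)) (zeros xs (h ∘ there))) (ℚ.+-identityˡ 0ℚ)
sum-single f {y} {x ∷ xs} (a ∷ u) (there m) g =
  trans (cong₂ ℚ._+_ (g (here refl) (All.lookup a m)) (sum-single f u m (g ∘ there))) (ℚ.+-identityˡ (f y))

module _ {ν : List ℕ} (sp : IsStrictPartition ν) {g : List ℕ → ℚ} (expansion : schurP ν ≈ˢ schurSeries g) where

  classes : List ℕ → ℚ
  classes μ = nat (length (over ν (canon 0 μ)))

  -- The coefficient of x^α in `schurP ν` is evaluated in two ways: over the plactic classes, and by
  -- the given Schur expansion. Both are combinations of the same Kostka numbers.
  expansions-agree : ∀ α → sumℚ (map (λ μ → classes μ ℚ.* nat (length (youngOf α μ))) (partitions (sum α)))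
                         ≡ sumℚ (map (λ μ → g μ ℚ.* nat (length (youngOf α μ))) (partitions (sum α)))
  expansions-agree α = begin
    sumℚ (map (λ μ → classes μ ℚ.* nat (length (youngOf α μ))) parts)
      ≡⟨ cong sumℚ (map-cong (λ μ → sym (nat-* (length (over ν (canon 0 μ))) _)) parts) ⟩
    sumℚ (map (nat ∘ products) parts)            ≡⟨ cong sumℚ (map-∘ parts) ⟩
    sumℚ (map nat (map products parts))          ≡⟨ sym (nat-sum (map products parts)) ⟩
    nat (sum (map products parts))               ≡⟨ cong nat (sym (shifted-count sp α)) ⟩
    nat (length (shiftedOf α ν))                 ≡⟨ sym (sum-indicator (λ T → exponents (length α) (map ∣_∣ (concat T)) ≟ˢ α) (shiftedTableaux (length α) ν)) ⟩
    schurP ν α                                   ≡⟨ expansion α ⟩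
    schurSeries g α
      ≡⟨ cong sumℚ (map-cong (λ μ → cong (g μ ℚ.*_) (sum-indicator (λ U → exponents (length α) (concat U) ≟ˢ α) (youngTableaux (length α) μ))) parts) ⟩
    sumℚ (map (λ μ → g μ ℚ.* nat (length (youngOf α μ))) parts) ∎
    where
    open ≡-Reasoning
    parts = partitions (sum α)
    products : List ℕ → ℕ
    products μ = length (over ν (canon 0 μ)) * length (youngOf α μ)

  -- By induction on Σ i μ_i, which decreases strictly along nonzero Kostka numbers.
  coefficient : ∀ n {μ} → weight 0 μ < n → IsPartition μ → classes μ ≡ g μ
  -- The content is chosen as `μ` itself: there `μ` has Kostka number 1, and all other terms of the
  -- two sums are known to agree.
  coefficient (suc n) {μ} lt p = trans (sym (one (classes μ))) (trans (sums-agree-at _ _ (partitions-unique (sum μ)) (∈-partitions p) others (expansions-agree μ)) (one (g μ)))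
    where
    one : ∀ q → q ℚ.* nat (length (youngOf μ μ)) ≡ q
    one q = trans (cong (λ k → q ℚ.* nat k) (kostka-diagonal p)) (trans (cong (q ℚ.*_) (ℚ.+-identityʳ 1ℚ)) (ℚ.*-identityʳ q))
    others : ∀ {μ′} → μ′ ∈ partitions (sum μ) → μ′ ≢ μ → classes μ′ ℚ.* nat (length (youngOf μ μ′)) ≡ g μ′ ℚ.* nat (length (youngOf μ μ′))
    others {μ′} m ne with partitions⁻ (sum μ) m
    ... | p′ , s with youngOf μ μ′ | kostka-triangular p p′ s ne
    ...   | []    | _ = trans (ℚ.*-zeroʳ (classes μ′)) (sym (ℚ.*-zeroʳ (g μ′)))
    ...   | U ∷ _ | t = cong (ℚ._* _) (coefficient n (<-≤-trans (t (here refl)) (≤-pred lt)) p′)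

mainTheorem6 : (ν : List ℕ) → IsStrictPartition ν →
    (g : List ℕ → ℚ) → schurP ν ≈ˢ schurSeries g →
    π (𝒫 ν) ≈ᶠ placticSchurSum g
mainTheorem6 ν sp g expansion u = begin
  sumℚ (map (λ w → indicator (isShiftedTableau? ν (P-mix w))) (fibre U))
    ≡⟨ sum-indicator (λ w → isShiftedTableau? ν (P-mix w)) (fibre U) ⟩
  nat (length (filter (λ w → isShiftedTableau? ν (P-mix w)) (fibre U)))
    ≡⟨ cong nat (sym (length-map P-mix (filter (λ w → isShiftedTableau? ν (P-mix w)) (fibre U)))) ⟩
  nat (length (over ν U))
    ≡⟨ cong nat (over-≡ {U = U} sp (rsk-partition u) (rsk-tableau u) (canon-young μ₀)) ⟩
  nat (length (over ν (canon 0 μ₀)))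
    ≡⟨ coefficient sp {g = g} expansion (suc (weight 0 μ₀)) (n<1+n _) (rsk-partition u) ⟩
  g μ₀
    ≡⟨ sym (trans (cong (g μ₀ ℚ.*_) (cong (λ b → if b then 1ℚ else 0ℚ) (dec-true (μ₀ ≟ˢ μ₀) refl))) (ℚ.*-identityʳ (g μ₀))) ⟩
  g μ₀ ℚ.* indicator (μ₀ ≟ˢ μ₀)
    ≡⟨ sym (sum-single (λ μ → g μ ℚ.* indicator (μ₀ ≟ˢ μ)) (partitions-unique (size U))
         (subst (λ n → μ₀ ∈ partitions n) (sum-shape U) (∈-partitions (rsk-partition u))) others) ⟩
  sumℚ (map (λ μ → g μ ℚ.* indicator (μ₀ ≟ˢ μ)) (partitions (size U))) ∎
  where
  open ≡-Reasoning
  U = P-RSK u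
  μ₀ = shapeᵗ U
  others : ∀ {μ} → μ ∈ partitions (size U) → μ ≢ μ₀ → g μ ℚ.* indicator (μ₀ ≟ˢ μ) ≡ 0ℚ
  others {μ} _ ne = trans (cong (g μ ℚ.*_) (cong (λ b → if b then 1ℚ else 0ℚ) (dec-false (μ₀ ≟ˢ μ) (ne ∘ sym)))) (ℚ.*-zeroʳ (g μ))
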